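{- Let $(X,\Sigma,s,t)$ be a symmetric monoidal closed (SMC) signature. Then the category $\mathcal{C}_{X,\Sigma}$ (defined in the context, with its SMC structure) is the classifying category of the syntactic SMC theory with signature $(X,\Sigma)$ and no equations: there is a bijection, natural in the SMC category $\mathcal{D}$, between strict SMC functors $\mathcal{C}_{X,\Sigma}\to\mathcal{D}$ and interpretations $(X,\Sigma)\to\mathcal{D}$.
   Context: **Signatures and interpretations.** For a set $X$, $\overline X$ is the set of formal types generated by $e ::= x \mid I \mid e\otimes e \mid e\multimap e$ ($x\in X$). An SMC signature $(X,\Sigma,s,t)$ is a set $X$, a set $\Sigma$ and functions $s,t:\Sigma\to\overline X$; $\Sigma(a,b)=\{f\in\Sigma: s(f)=a,\ t(f)=b\}$. SMC categories come with chosen structure ($\otimes$, $I$, $\multimap$, constraints, units $\eta_{ab}:a\to b\multimap(a\otimes b)$ and counits $\epsilon_{ab}:(a\multimap b)\otimes a\to b$); a strict SMC functor preserves all of it on the nose. An interpretation $F:(X,\Sigma)\to\mathcal{D}$ (of the theory with no equations) in an SMC category $\mathcal{D}$ is a function $F_X:X\to\mathrm{ob}\,\mathcal{D}$ together with functions $F_{a,b}:\Sigma(a,b)\to\mathcal{D}(\overline{F_X}(a),\overline{F_X}(b))$ for $a,b\in\overline X$, where $\overline{F_X}:\overline X\to\mathrm{ob}\,\mathcal{D}$ is the unique extension of $F_X$ commuting with $I,\otimes,\multimap$. Strict SMC functors $\mathcal{D}\to\mathcal{D}'$ act on interpretations by postcomposition. **The category $\mathcal{C}_{X,\Sigma}$.**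 $\mathcal{C}_X$ is the free SMC category on the set $X$, with object set $\overline X$. For a list $\Gamma\in\Sigma^*$, put $\mathrm{ty}()=I$, $\mathrm{ty}(\alpha)=s(\alpha)\multimap t(\alpha)$, $\mathrm{ty}(\alpha_1,\dots,\alpha_n)=\mathrm{ty}(\alpha_1,\dots,\alpha_{n-1})\otimes\mathrm{ty}(\alpha_n)$ for $n\ge 2$. The category $\mathcal{C}'_{X,\Sigma}$ has objects $\overline X$; a morphism $U\to V$ is a pair $(\Gamma,\phi)$ with $\Gamma\in\Sigma^*$ and $\phi:\mathrm{ty}(\Gamma)\otimes U\to V$ in $\mathcal{C}_X$; the identity on $U$ is $()$ with the canonical isomorphism $I\otimes U\to U$; the composite of $(\Gamma,\phi):U\to V$ and $(\Delta,\psi):V\to W$ is $(\Delta+\Gamma,\xi)$ where $+$ is concatenation and $\xi$ is $\mathrm{ty}(\Delta+\Gamma)\otimes U\cong\mathrm{ty}(\Delta)\otimes(\mathrm{ty}(\Gamma)\otimes U)\xrightarrow{\mathrm{ty}(\Delta)\otimes\phi}\mathrm{ty}(\Delta)\otimes V\xrightarrow{\psi}W$. $\mathcal{C}_{X,\Sigma}$ is the quotient of $\mathcal{C}'_{X,\Sigma}$ by the equivalence relation (a congruence) generated by $(\sigma\Gamma,\phi)\sim(\Gamma,\phi\circ(\hat\sigma\otimes U))$ for $\Gamma=(\alpha_1,\dots,\alpha_n)$, $\sigma\in S_n$, $\sigma\Gamma=(\alpha_{\sigma(1)},\dots,\alpha_{\sigma(n)})$, $\phi:\mathrm{ty}(\sigma\Gamma)\otimes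 U\to V$, where $\hat\sigma:\mathrm{ty}(\Gamma)\to\mathrm{ty}(\sigma\Gamma)$ is the canonical isomorphism permuting tensor factors. Its SMC structure: on objects, the type constructors; the tensor of $(\Gamma,\phi):U\to V$ and $(\Gamma',\phi'):U'\to V'$ is represented by $\Gamma+\Gamma'$ and $\mathrm{ty}(\Gamma+\Gamma')\otimes(U\otimes U')\cong(\mathrm{ty}(\Gamma)\otimes U)\otimes(\mathrm{ty}(\Gamma')\otimes U')\xrightarrow{\phi\otimes\phi'}V\otimes V'$; all structure maps are the images of those of $\mathcal{C}_X$ under the functor $\mathcal{C}_X\to\mathcal{C}_{X,\Sigma}$ sending $\phi:U\to V$ to the class of $((),\,I\otimes U\cong U\xrightarrow{\phi}V)$; the closed structure is induced by the bijections $\mathcal{C}_X(\mathrm{ty}(\Gamma)\otimes(U\otimes V),W)\cong\mathcal{C}_X(\mathrm{ty}(\Gamma)\otimes U,V\multimap W)$. -}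

{-# OPTIONS --with-K #-}

module Defs where

open import Level using (Level; _⊔_) renaming (suc to lsuc)
open import Data.List.Base using (List; []; _∷_; _++_; foldl)
open import Data.List.Relation.Binary.Permutation.Propositional
  using (_↭_; refl; prep; swap; trans)
open import Data.Product using (Σ-syntax; _×_; _,_)
open import Relation.Binary using (Rel; Setoid; IsEquivalence)
open import Relation.Binary.Construct.Closure.Equivalence as EqC using (EqClosure)
open import Relation.Binary.PropositionalEquality as ≡ using (_≡_)
import Relation.Binary.Reasoning.Setoid as SetoidReasoning

-- A category has a type of objects compared by _≡_ (so that functors can be
-- strict) and hom-setoids.  K is in force, so equality of objects is
-- proof-irrelevant, as it is for a set of objects.

record SMCC (o ℓ e : Level) : Set (lsuc (o ⊔ ℓ ⊔ e)) where
  infix  4 _≈_ _⇒_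
  infixr 9 _∘_
  infixr 10 _⊗₁_ _⊗_ _⊸₁_ _⊸_
  field
    Obj : Set o
    _⇒_ : Obj → Obj → Set ℓ
    _≈_ : ∀ {A B} → Rel (A ⇒ B) e
    id  : ∀ {A} → A ⇒ A
    _∘_ : ∀ {A B C} → B ⇒ C → A ⇒ B → A ⇒ C

    ≈-equiv : ∀ {A B} → IsEquivalence (_≈_ {A} {B})
    ∘-cong  : ∀ {A B C} {f f' : B ⇒ C} {g g' : A ⇒ B} → f ≈ f' → g ≈ g' → f ∘ g ≈ f' ∘ g'
    assoc   : ∀ {A B C D} {f : C ⇒ D} {g : B ⇒ C} {h : A ⇒ B} → (f ∘ g) ∘ h ≈ f ∘ (g ∘ h)
    idˡ     : ∀ {A B} {f : A ⇒ B} → id ∘ f ≈ f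
    idʳ     : ∀ {A B} {f : A ⇒ B} → f ∘ id ≈ f

    I    : Obj
    _⊗_  : Obj → Obj → Obj
    _⊗₁_ : ∀ {A A' B B'} → A ⇒ A' → B ⇒ B' → A ⊗ B ⇒ A' ⊗ B'
    λ⇒   : ∀ {A} → I ⊗ A ⇒ A
    λ⇐   : ∀ {A} → A ⇒ I ⊗ A
    ρ⇒   : ∀ {A} → A ⊗ I ⇒ A
    ρ⇐   : ∀ {A} → A ⇒ A ⊗ I
    α⇒   : ∀ {A B C} → (A ⊗ B) ⊗ C ⇒ A ⊗ (B ⊗ C)
    α⇐   : ∀ {A B C} → A ⊗ (B ⊗ C) ⇒ (A ⊗ B) ⊗ C
    σ    : ∀ {A B} → A ⊗ B ⇒ B ⊗ A

    ⊗-cong : ∀ {A A' B B'} {f f' : A ⇒ A'} {g g' : B ⇒ B'} →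
             f ≈ f' → g ≈ g' → f ⊗₁ g ≈ f' ⊗₁ g'
    ⊗-id   : ∀ {A B} → id {A} ⊗₁ id {B} ≈ id
    ⊗-∘    : ∀ {A A' A″ B B' B″} {f : A' ⇒ A″} {g : A ⇒ A'} {h : B' ⇒ B″} {k : B ⇒ B'} →
             (f ∘ g) ⊗₁ (h ∘ k) ≈ (f ⊗₁ h) ∘ (g ⊗₁ k)
    λ-isoˡ : ∀ {A} → λ⇐ ∘ λ⇒ ≈ id {I ⊗ A}
    λ-isoʳ : ∀ {A} → λ⇒ ∘ λ⇐ ≈ id {A}
    ρ-isoˡ : ∀ {A} → ρ⇐ ∘ ρ⇒ ≈ id {A ⊗ I}
    ρ-isoʳ : ∀ {A} → ρ⇒ ∘ ρ⇐ ≈ id {A}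
    α-isoˡ : ∀ {A B C} → α⇐ ∘ α⇒ ≈ id {(A ⊗ B) ⊗ C}
    α-isoʳ : ∀ {A B C} → α⇒ ∘ α⇐ ≈ id {A ⊗ (B ⊗ C)}
    λ-nat  : ∀ {A B} {f : A ⇒ B} → λ⇒ ∘ (id ⊗₁ f) ≈ f ∘ λ⇒
    ρ-nat  : ∀ {A B} {f : A ⇒ B} → ρ⇒ ∘ (f ⊗₁ id) ≈ f ∘ ρ⇒
    α-nat  : ∀ {A A' B B' C C'} {f : A ⇒ A'} {g : B ⇒ B'} {h : C ⇒ C'} →
             α⇒ ∘ ((f ⊗₁ g) ⊗₁ h) ≈ (f ⊗₁ (g ⊗₁ h)) ∘ α⇒
    σ-nat  : ∀ {A A' B B'} {f : A ⇒ A'} {g : B ⇒ B'} → σ ∘ (f ⊗₁ g) ≈ (g ⊗₁ f) ∘ σ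
    σ-invol  : ∀ {A B} → σ ∘ σ ≈ id {A ⊗ B}
    triangle : ∀ {A B} → (id ⊗₁ λ⇒) ∘ α⇒ ≈ ρ⇒ {A} ⊗₁ id {B}
    pentagon : ∀ {A B C D} →
               (id {A} ⊗₁ α⇒ {B} {C} {D}) ∘ (α⇒ ∘ (α⇒ ⊗₁ id)) ≈ α⇒ ∘ α⇒
    hexagon  : ∀ {A B C} →
               (id {B} ⊗₁ σ {A} {C}) ∘ (α⇒ ∘ (σ ⊗₁ id)) ≈ α⇒ ∘ (σ ∘ α⇒)

    _⊸_  : Obj → Obj → Obj
    _⊸₁_ : ∀ {A A' B B'} → A' ⇒ A → B ⇒ B' → A ⊸ B ⇒ A' ⊸ B'
    η    : ∀ {A B} → A ⇒ B ⊸ (A ⊗ B)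
    ε    : ∀ {A B} → (A ⊸ B) ⊗ A ⇒ B

    ⊸-cong : ∀ {A A' B B'} {f f' : A' ⇒ A} {g g' : B ⇒ B'} →
             f ≈ f' → g ≈ g' → f ⊸₁ g ≈ f' ⊸₁ g'
    ⊸-id   : ∀ {A B} → id {A} ⊸₁ id {B} ≈ id
    ⊸-∘    : ∀ {A A' A″ B B' B″} {f : A″ ⇒ A'} {g : A' ⇒ A} {h : B' ⇒ B″} {k : B ⇒ B'} →
             (g ∘ f) ⊸₁ (h ∘ k) ≈ (f ⊸₁ h) ∘ (g ⊸₁ k)
    η-nat   : ∀ {A A' B} {f : A ⇒ A'} → (id {B} ⊸₁ (f ⊗₁ id)) ∘ η ≈ η ∘ f
    η-dinat : ∀ {A B B'} {g : B ⇒ B'} → (id ⊸₁ (id {A} ⊗₁ g)) ∘ η ≈ (g ⊸₁ id) ∘ η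
    ε-nat   : ∀ {A B B'} {f : B ⇒ B'} → ε ∘ ((id {A} ⊸₁ f) ⊗₁ id) ≈ f ∘ ε
    ε-dinat : ∀ {A A' B} {g : A' ⇒ A} → ε ∘ ((g ⊸₁ id {B}) ⊗₁ id) ≈ ε ∘ (id ⊗₁ g)
    zig     : ∀ {A B} → ε ∘ (η ⊗₁ id) ≈ id {A ⊗ B}
    zag     : ∀ {A B} → (id ⊸₁ ε) ∘ η ≈ id {A ⊸ B}

  hom : Obj → Obj → Setoid ℓ e
  hom A B = record { isEquivalence = ≈-equiv {A} {B} }

  σₗ : ∀ {A B C} → A ⊗ (B ⊗ C) ⇒ B ⊗ (A ⊗ C)
  σₗ = α⇒ ∘ ((σ ⊗₁ id) ∘ α⇐)

  middle : ∀ {A B C D} → (A ⊗ B) ⊗ (C ⊗ D) ⇒ (A ⊗ C) ⊗ (B ⊗ D)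
  middle = α⇐ ∘ ((id ⊗₁ σₗ) ∘ α⇒)

-- Equality of morphisms whose domains and codomains are only propositionally
-- equal.

module _ {o ℓ e : Level} (D : SMCC o ℓ e) where
  open SMCC D

  data HomEq {A B : Obj} (f : A ⇒ B) : {A' B' : Obj} → A' ⇒ B' → Set (ℓ ⊔ e) where
    ≈⇒≋ : {g : A ⇒ B} → f ≈ g → HomEq f g

  infix 4 HomEq
  syntax HomEq D f g = D [ f ≋ g ]

module _ {o ℓ e : Level} {D : SMCC o ℓ e} where
  open SMCC D

  ≋-refl : ∀ {A B} {f : A ⇒ B} → D [ f ≋ f ]
  ≋-refl = ≈⇒≋ (IsEquivalence.refl ≈-equiv)

  ≋-sym : ∀ {A B A' B'} {f : A ⇒ B} {g : A' ⇒ B'} → D [ f ≋ g ] → D [ g ≋ f ]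
  ≋-sym (≈⇒≋ p) = ≈⇒≋ (IsEquivalence.sym ≈-equiv p)

  ≋-trans : ∀ {A B A' B' A″ B″} {f : A ⇒ B} {g : A' ⇒ B'} {h : A″ ⇒ B″} →
            D [ f ≋ g ] → D [ g ≋ h ] → D [ f ≋ h ]
  ≋-trans (≈⇒≋ p) (≈⇒≋ q) = ≈⇒≋ (IsEquivalence.trans ≈-equiv p q)

record StrictFunctor {o ℓ e o' ℓ' e' : Level} (C : SMCC o ℓ e) (D : SMCC o' ℓ' e') :
                     Set (o ⊔ ℓ ⊔ e ⊔ o' ⊔ ℓ' ⊔ e') where
  private
    module C = SMCC C
    module D = SMCC D
  field
    F₀ : C.Obj → D.Obj
    F₁ : ∀ {A B} → A C.⇒ B → F₀ A D.⇒ F₀ B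
    F-cong : ∀ {A B} {f g : A C.⇒ B} → f C.≈ g → F₁ f D.≈ F₁ g
    F-id   : ∀ {A} → F₁ (C.id {A}) D.≈ D.id
    F-∘    : ∀ {A B E} {f : B C.⇒ E} {g : A C.⇒ B} → F₁ (f C.∘ g) D.≈ F₁ f D.∘ F₁ g

    F-I : F₀ C.I ≡ D.I
    F-⊗ : ∀ {A B} → F₀ (A C.⊗ B) ≡ F₀ A D.⊗ F₀ B
    F-⊸ : ∀ {A B} → F₀ (A C.⊸ B) ≡ F₀ A D.⊸ F₀ B

    F-⊗₁ : ∀ {A A' B B'} {f : A C.⇒ A'} {g : B C.⇒ B'} →
           D [ F₁ (f C.⊗₁ g) ≋ F₁ f D.⊗₁ F₁ g ]
    F-⊸₁ : ∀ {A A' B B'} {f : A' C.⇒ A} {g : B C.⇒ B'} →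
           D [ F₁ (f C.⊸₁ g) ≋ F₁ f D.⊸₁ F₁ g ]
    F-λ  : ∀ {A} → D [ F₁ (C.λ⇒ {A}) ≋ D.λ⇒ {F₀ A} ]
    F-ρ  : ∀ {A} → D [ F₁ (C.ρ⇒ {A}) ≋ D.ρ⇒ {F₀ A} ]
    F-α  : ∀ {A B E} → D [ F₁ (C.α⇒ {A} {B} {E}) ≋ D.α⇒ {F₀ A} {F₀ B} {F₀ E} ]
    F-σ  : ∀ {A B} → D [ F₁ (C.σ {A} {B}) ≋ D.σ {F₀ A} {F₀ B} ]
    F-η  : ∀ {A B} → D [ F₁ (C.η {A} {B}) ≋ D.η {F₀ A} {F₀ B} ]
    F-ε  : ∀ {A B} → D [ F₁ (C.ε {A} {B}) ≋ D.ε {F₀ A} {F₀ B} ]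

  F-≋ : ∀ {A B A' B'} {f : A C.⇒ B} {g : A' C.⇒ B'} → C [ f ≋ g ] → D [ F₁ f ≋ F₁ g ]
  F-≋ (≈⇒≋ p) = ≈⇒≋ (F-cong p)

module _ {o ℓ e o' ℓ' e' : Level} (C : SMCC o ℓ e) (D : SMCC o' ℓ' e') where
  private
    module C = SMCC C
    module D = SMCC D
  open StrictFunctor

  StrictFunctors : Setoid (o ⊔ ℓ ⊔ e ⊔ o' ⊔ ℓ' ⊔ e') (o ⊔ ℓ ⊔ o' ⊔ ℓ' ⊔ e')
  StrictFunctors = record
    { Carrier = StrictFunctor C D
    ; _≈_ = λ F G → (∀ A → F₀ F A ≡ F₀ G A)
                  × (∀ {A B} (f : A C.⇒ B) → D [ F₁ F f ≋ F₁ G f ])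
    ; isEquivalence = record
        { refl  = (λ _ → ≡.refl) , (λ _ → ≋-refl)
        ; sym   = λ (p , q) → (λ A → ≡.sym (p A)) , (λ f → ≋-sym (q f))
        ; trans = λ (p , q) (p' , q') →
                    (λ A → ≡.trans (p A) (p' A)) , (λ f → ≋-trans (q f) (q' f))
        }
    }

infixr 9 _∘F_

_∘F_ : ∀ {o₁ ℓ₁ e₁ o₂ ℓ₂ e₂ o₃ ℓ₃ e₃}
         {C : SMCC o₁ ℓ₁ e₁} {D : SMCC o₂ ℓ₂ e₂} {E : SMCC o₃ ℓ₃ e₃} →
       StrictFunctor D E → StrictFunctor C D → StrictFunctor C E
_∘F_ {E = E} G F = record
  { F₀ = λ A → G.F₀ (F.F₀ A)
  ; F₁ = λ f → G.F₁ (F.F₁ f)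
  ; F-cong = λ p → G.F-cong (F.F-cong p)
  ; F-id = E.trans (G.F-cong F.F-id) G.F-id
  ; F-∘ = E.trans (G.F-cong F.F-∘) G.F-∘
  ; F-I = ≡.trans (≡.cong G.F₀ F.F-I) G.F-I
  ; F-⊗ = ≡.trans (≡.cong G.F₀ F.F-⊗) G.F-⊗
  ; F-⊸ = ≡.trans (≡.cong G.F₀ F.F-⊸) G.F-⊸
  ; F-⊗₁ = ≋-trans (G.F-≋ F.F-⊗₁) G.F-⊗₁
  ; F-⊸₁ = ≋-trans (G.F-≋ F.F-⊸₁) G.F-⊸₁
  ; F-λ = ≋-trans (G.F-≋ F.F-λ) G.F-λ
  ; F-ρ = ≋-trans (G.F-≋ F.F-ρ) G.F-ρ
  ; F-α = ≋-trans (G.F-≋ F.F-α) G.F-α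
  ; F-σ = ≋-trans (G.F-≋ F.F-σ) G.F-σ
  ; F-η = ≋-trans (G.F-≋ F.F-η) G.F-η
  ; F-ε = ≋-trans (G.F-≋ F.F-ε) G.F-ε
  }
  where
    module G = StrictFunctor G
    module F = StrictFunctor F
    module E {A B} = IsEquivalence (SMCC.≈-equiv E {A} {B})

infixr 10 _⊗ᵗ_ _⊸ᵗ_

data Ty {x : Level} (X : Set x) : Set x where
  var  : X → Ty X
  Iᵗ   : Ty X
  _⊗ᵗ_ : Ty X → Ty X → Ty X
  _⊸ᵗ_ : Ty X → Ty X → Ty X

record Signature (x y : Level) : Set (lsuc (x ⊔ y)) where
  field
    Sort : Set x
    Op   : Set y
    dom  : Op → Ty Sort
    cod  : Op → Ty Sort

  Op⟨_,_⟩ : Ty Sort → Ty Sort → Set (x ⊔ y)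
  Op⟨ a , b ⟩ = Σ[ f ∈ Op ] (dom f ≡ a × cod f ≡ b)

module _ {o ℓ e : Level} (D : SMCC o ℓ e) where
  open SMCC D

  extend : ∀ {x} {X : Set x} → (X → Obj) → Ty X → Obj
  extend v (var a)  = v a
  extend v Iᵗ       = I
  extend v (a ⊗ᵗ b) = extend v a ⊗ extend v b
  extend v (a ⊸ᵗ b) = extend v a ⊸ extend v b

record Interpretation {x y o ℓ e : Level} (S : Signature x y) (D : SMCC o ℓ e) :
                      Set (x ⊔ y ⊔ o ⊔ ℓ) where
  open Signature S
  open SMCC D
  field
    ⟦_⟧₀ : Sort → Obj

  ⟦_⟧ : Ty Sort → Obj
  ⟦_⟧ = extend D ⟦_⟧₀

  field
    ⟦_⟧₁ : ∀ {a b} → Op⟨ a , b ⟩ → ⟦ a ⟧ ⇒ ⟦ b ⟧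

module _ {x y o ℓ e : Level} (S : Signature x y) (D : SMCC o ℓ e) where
  open Signature S
  open Interpretation

  Interpretations : Setoid (x ⊔ y ⊔ o ⊔ ℓ) (x ⊔ y ⊔ o ⊔ ℓ ⊔ e)
  Interpretations = record
    { Carrier = Interpretation S D
    ; _≈_ = λ F G → (∀ a → ⟦ F ⟧₀ a ≡ ⟦ G ⟧₀ a)
                  × (∀ {a b} (f : Op⟨ a , b ⟩) → D [ ⟦ F ⟧₁ f ≋ ⟦ G ⟧₁ f ])
    ; isEquivalence = record
        { refl  = (λ _ → ≡.refl) , (λ _ → ≋-refl)
        ; sym   = λ (p , q) → (λ a → ≡.sym (p a)) , (λ f → ≋-sym (q f))
        ; trans = λ (p , q) (p' , q') →
                    (λ a → ≡.trans (p a) (p' a)) , (λ f → ≋-trans (q f) (q' f))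
        }
    }

module _ {x o ℓ e o' ℓ' e' : Level} {X : Set x} {D : SMCC o ℓ e} {D' : SMCC o' ℓ' e'}
         (G : StrictFunctor D D') where
  open StrictFunctor G

  extend-F₀ : (v : X → SMCC.Obj D) (a : Ty X) → F₀ (extend D v a) ≡ extend D' (λ z → F₀ (v z)) a
  extend-F₀ v (var a)  = ≡.refl
  extend-F₀ v Iᵗ       = F-I
  extend-F₀ v (a ⊗ᵗ b) = ≡.trans F-⊗ (≡.cong₂ (SMCC._⊗_ D') (extend-F₀ v a) (extend-F₀ v b))
  extend-F₀ v (a ⊸ᵗ b) = ≡.trans F-⊸ (≡.cong₂ (SMCC._⊸_ D') (extend-F₀ v a) (extend-F₀ v b))

infixr 9 _·_

_·_ : ∀ {x y o ℓ e o' ℓ' e'} {S : Signature x y} {D : SMCC o ℓ e} {D' : SMCC o' ℓ' e'} →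
      StrictFunctor D D' → Interpretation S D → Interpretation S D'
_·_ {D' = D'} G F = record
  { ⟦_⟧₀ = λ a → F₀ (⟦ F ⟧₀ a)
  ; ⟦_⟧₁ = λ {a} {b} f →
      ≡.subst₂ (SMCC._⇒_ D') (extend-F₀ G ⟦ F ⟧₀ a) (extend-F₀ G ⟦ F ⟧₀ b) (F₁ (⟦ F ⟧₁ f))
  }
  where
    open StrictFunctor G
    open Interpretation

module FreeSMCC {x : Level} (X : Set x) where
  infix  4 _≈_ _⇒_
  infixr 9 _∘_
  infixr 10 _⊗₁_ _⊸₁_

  data _⇒_ : Ty X → Ty X → Set x where
    id   : ∀ {A} → A ⇒ A
    _∘_  : ∀ {A B C} → B ⇒ C → A ⇒ B → A ⇒ C
    _⊗₁_ : ∀ {A A' B B'} → A ⇒ A' → B ⇒ B' → A ⊗ᵗ B ⇒ A' ⊗ᵗ B'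
    λ⇒   : ∀ {A} → Iᵗ ⊗ᵗ A ⇒ A
    λ⇐   : ∀ {A} → A ⇒ Iᵗ ⊗ᵗ A
    ρ⇒   : ∀ {A} → A ⊗ᵗ Iᵗ ⇒ A
    ρ⇐   : ∀ {A} → A ⇒ A ⊗ᵗ Iᵗ
    α⇒   : ∀ {A B C} → (A ⊗ᵗ B) ⊗ᵗ C ⇒ A ⊗ᵗ (B ⊗ᵗ C)
    α⇐   : ∀ {A B C} → A ⊗ᵗ (B ⊗ᵗ C) ⇒ (A ⊗ᵗ B) ⊗ᵗ C
    σ    : ∀ {A B} → A ⊗ᵗ B ⇒ B ⊗ᵗ A
    _⊸₁_ : ∀ {A A' B B'} → A' ⇒ A → B ⇒ B' → A ⊸ᵗ B ⇒ A' ⊸ᵗ B'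
    η    : ∀ {A B} → A ⇒ B ⊸ᵗ (A ⊗ᵗ B)
    ε    : ∀ {A B} → (A ⊸ᵗ B) ⊗ᵗ A ⇒ B

  data _≈_ : ∀ {A B} → Rel (A ⇒ B) x where
    ≈-refl  : ∀ {A B} {f : A ⇒ B} → f ≈ f
    ≈-sym   : ∀ {A B} {f g : A ⇒ B} → f ≈ g → g ≈ f
    ≈-trans : ∀ {A B} {f g h : A ⇒ B} → f ≈ g → g ≈ h → f ≈ h
    ∘-cong  : ∀ {A B C} {f f' : B ⇒ C} {g g' : A ⇒ B} → f ≈ f' → g ≈ g' → f ∘ g ≈ f' ∘ g'
    assoc   : ∀ {A B C D} {f : C ⇒ D} {g : B ⇒ C} {h : A ⇒ B} → (f ∘ g) ∘ h ≈ f ∘ (g ∘ h)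
    idˡ     : ∀ {A B} {f : A ⇒ B} → id ∘ f ≈ f
    idʳ     : ∀ {A B} {f : A ⇒ B} → f ∘ id ≈ f

    ⊗-cong : ∀ {A A' B B'} {f f' : A ⇒ A'} {g g' : B ⇒ B'} →
             f ≈ f' → g ≈ g' → f ⊗₁ g ≈ f' ⊗₁ g'
    ⊗-id   : ∀ {A B} → id {A} ⊗₁ id {B} ≈ id
    ⊗-∘    : ∀ {A A' A″ B B' B″} {f : A' ⇒ A″} {g : A ⇒ A'} {h : B' ⇒ B″} {k : B ⇒ B'} →
             (f ∘ g) ⊗₁ (h ∘ k) ≈ (f ⊗₁ h) ∘ (g ⊗₁ k)
    λ-isoˡ : ∀ {A} → λ⇐ ∘ λ⇒ ≈ id {Iᵗ ⊗ᵗ A}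
    λ-isoʳ : ∀ {A} → λ⇒ ∘ λ⇐ ≈ id {A}
    ρ-isoˡ : ∀ {A} → ρ⇐ ∘ ρ⇒ ≈ id {A ⊗ᵗ Iᵗ}
    ρ-isoʳ : ∀ {A} → ρ⇒ ∘ ρ⇐ ≈ id {A}
    α-isoˡ : ∀ {A B C} → α⇐ ∘ α⇒ ≈ id {(A ⊗ᵗ B) ⊗ᵗ C}
    α-isoʳ : ∀ {A B C} → α⇒ ∘ α⇐ ≈ id {A ⊗ᵗ (B ⊗ᵗ C)}
    λ-nat  : ∀ {A B} {f : A ⇒ B} → λ⇒ ∘ (id ⊗₁ f) ≈ f ∘ λ⇒
    ρ-nat  : ∀ {A B} {f : A ⇒ B} → ρ⇒ ∘ (f ⊗₁ id) ≈ f ∘ ρ⇒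
    α-nat  : ∀ {A A' B B' C C'} {f : A ⇒ A'} {g : B ⇒ B'} {h : C ⇒ C'} →
             α⇒ ∘ ((f ⊗₁ g) ⊗₁ h) ≈ (f ⊗₁ (g ⊗₁ h)) ∘ α⇒
    σ-nat  : ∀ {A A' B B'} {f : A ⇒ A'} {g : B ⇒ B'} → σ ∘ (f ⊗₁ g) ≈ (g ⊗₁ f) ∘ σ
    σ-invol  : ∀ {A B} → σ ∘ σ ≈ id {A ⊗ᵗ B}
    triangle : ∀ {A B} → (id ⊗₁ λ⇒) ∘ α⇒ ≈ ρ⇒ {A} ⊗₁ id {B}
    pentagon : ∀ {A B C D} →
               (id {A} ⊗₁ α⇒ {B} {C} {D}) ∘ (α⇒ ∘ (α⇒ ⊗₁ id)) ≈ α⇒ ∘ α⇒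
    hexagon  : ∀ {A B C} →
               (id {B} ⊗₁ σ {A} {C}) ∘ (α⇒ ∘ (σ ⊗₁ id)) ≈ α⇒ ∘ (σ ∘ α⇒)

    ⊸-cong : ∀ {A A' B B'} {f f' : A' ⇒ A} {g g' : B ⇒ B'} →
             f ≈ f' → g ≈ g' → f ⊸₁ g ≈ f' ⊸₁ g'
    ⊸-id   : ∀ {A B} → id {A} ⊸₁ id {B} ≈ id
    ⊸-∘    : ∀ {A A' A″ B B' B″} {f : A″ ⇒ A'} {g : A' ⇒ A} {h : B' ⇒ B″} {k : B ⇒ B'} →
             (g ∘ f) ⊸₁ (h ∘ k) ≈ (f ⊸₁ h) ∘ (g ⊸₁ k)
    η-nat   : ∀ {A A' B} {f : A ⇒ A'} → (id {B} ⊸₁ (f ⊗₁ id)) ∘ η ≈ η ∘ f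
    η-dinat : ∀ {A B B'} {g : B ⇒ B'} → (id ⊸₁ (id {A} ⊗₁ g)) ∘ η ≈ (g ⊸₁ id) ∘ η
    ε-nat   : ∀ {A B B'} {f : B ⇒ B'} → ε ∘ ((id {A} ⊸₁ f) ⊗₁ id) ≈ f ∘ ε
    ε-dinat : ∀ {A A' B} {g : A' ⇒ A} → ε ∘ ((g ⊸₁ id {B}) ⊗₁ id) ≈ ε ∘ (id ⊗₁ g)
    zig     : ∀ {A B} → ε ∘ (η ⊗₁ id) ≈ id {A ⊗ᵗ B}
    zag     : ∀ {A B} → (id ⊸₁ ε) ∘ η ≈ id {A ⊸ᵗ B}

  Free : SMCC x x x
  Free = record
    { Obj = Ty X ; _⇒_ = _⇒_ ; _≈_ = _≈_ ; id = id ; _∘_ = _∘_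
    ; ≈-equiv = record { refl = ≈-refl ; sym = ≈-sym ; trans = ≈-trans }
    ; ∘-cong = ∘-cong ; assoc = assoc ; idˡ = idˡ ; idʳ = idʳ
    ; I = Iᵗ ; _⊗_ = _⊗ᵗ_ ; _⊗₁_ = _⊗₁_
    ; λ⇒ = λ⇒ ; λ⇐ = λ⇐ ; ρ⇒ = ρ⇒ ; ρ⇐ = ρ⇐ ; α⇒ = α⇒ ; α⇐ = α⇐ ; σ = σ
    ; ⊗-cong = ⊗-cong ; ⊗-id = ⊗-id ; ⊗-∘ = ⊗-∘
    ; λ-isoˡ = λ-isoˡ ; λ-isoʳ = λ-isoʳ ; ρ-isoˡ = ρ-isoˡ ; ρ-isoʳ = ρ-isoʳ
    ; α-isoˡ = α-isoˡ ; α-isoʳ = α-isoʳ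
    ; λ-nat = λ-nat ; ρ-nat = ρ-nat ; α-nat = α-nat ; σ-nat = σ-nat
    ; σ-invol = σ-invol ; triangle = triangle ; pentagon = pentagon ; hexagon = hexagon
    ; _⊸_ = _⊸ᵗ_ ; _⊸₁_ = _⊸₁_ ; η = η ; ε = ε
    ; ⊸-cong = ⊸-cong ; ⊸-id = ⊸-id ; ⊸-∘ = ⊸-∘
    ; η-nat = η-nat ; η-dinat = η-dinat ; ε-nat = ε-nat ; ε-dinat = ε-dinat
    ; zig = zig ; zag = zag
    }

-- The construction of 𝒞 uses only that the free SMC category is an SMC category
-- M, and the objects at f = dom f ⊸ cod f of M; it is carried out for any M, at.

module Adjoin {o ℓ e c : Level} (M : SMCC o ℓ e) {Op : Set c} (at : Op → SMCC.Obj M) where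
  open SMCC M

  tyFrom : Obj → List Op → Obj
  tyFrom = foldl (λ A f → A ⊗ at f)

  ty : List Op → Obj
  ty []      = I
  ty (f ∷ Γ) = tyFrom (at f) Γ

  -- The canonical isomorphisms between the tensor products ty are defined by
  -- passing to products nested to the right and ending in I.

  nest : List Op → Obj
  nest []      = I
  nest (f ∷ Γ) = at f ⊗ nest Γ

  nestFrom⇒ : ∀ A Γ → tyFrom A Γ ⇒ A ⊗ nest Γ
  nestFrom⇒ A []      = ρ⇐
  nestFrom⇒ A (f ∷ Γ) = α⇒ ∘ nestFrom⇒ (A ⊗ at f) Γ

  nestFrom⇐ : ∀ A Γ → A ⊗ nest Γ ⇒ tyFrom A Γ
  nestFrom⇐ A []      = ρ⇒
  nestFrom⇐ A (f ∷ Γ) = nestFrom⇐ (A ⊗ at f) Γ ∘ α⇐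

  nest⇒ : ∀ Γ → ty Γ ⇒ nest Γ
  nest⇒ []      = id
  nest⇒ (f ∷ Γ) = nestFrom⇒ (at f) Γ

  nest⇐ : ∀ Γ → nest Γ ⇒ ty Γ
  nest⇐ []      = id
  nest⇐ (f ∷ Γ) = nestFrom⇐ (at f) Γ

  splitᴺ : ∀ Δ Γ → nest (Δ ++ Γ) ⇒ nest Δ ⊗ nest Γ
  splitᴺ []      Γ = λ⇐
  splitᴺ (f ∷ Δ) Γ = α⇐ ∘ (id ⊗₁ splitᴺ Δ Γ)

  split : ∀ Δ Γ → ty (Δ ++ Γ) ⇒ ty Δ ⊗ ty Γ
  split Δ Γ = (nest⇐ Δ ⊗₁ nest⇐ Γ) ∘ (splitᴺ Δ Γ ∘ nest⇒ (Δ ++ Γ))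

  -- A derivation of Γ ↭ Δ determines a permutation of positions taking Γ to Δ,
  -- and every permutation of positions arises so; perm is the isomorphism
  -- permuting the tensor factors accordingly.

  permᴺ : ∀ {Γ Δ} → Γ ↭ Δ → nest Γ ⇒ nest Δ
  permᴺ refl         = id
  permᴺ (prep f p)   = id ⊗₁ permᴺ p
  permᴺ (swap f g p) = σₗ ∘ (id ⊗₁ (id ⊗₁ permᴺ p))
  permᴺ (trans p q)  = permᴺ q ∘ permᴺ p

  perm : ∀ {Γ Δ} → Γ ↭ Δ → ty Γ ⇒ ty Δ
  perm {Γ} {Δ} p = nest⇐ Δ ∘ (permᴺ p ∘ nest⇒ Γ)

  infix 4 _⇛_ _↝_ _~_

  record _⇛_ (U V : Obj) : Set (c ⊔ ℓ) where
    no-eta-equality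
    pattern
    constructor ⟨_,_⟩
    field
      ctx  : List Op
      body : ty ctx ⊗ U ⇒ V

  -- equal is needed because the hom-sets of M are themselves setoids.

  data _↝_ {U V : Obj} : Rel (U ⇛ V) (c ⊔ ℓ ⊔ e) where
    permute : ∀ {Γ Δ} (p : Γ ↭ Δ) (φ : ty Δ ⊗ U ⇒ V) → ⟨ Δ , φ ⟩ ↝ ⟨ Γ , φ ∘ (perm p ⊗₁ id) ⟩
    equal   : ∀ {Γ} {φ ψ : ty Γ ⊗ U ⇒ V} → φ ≈ ψ → ⟨ Γ , φ ⟩ ↝ ⟨ Γ , ψ ⟩

  _~_ : ∀ {U V} → Rel (U ⇛ V) (c ⊔ ℓ ⊔ e)
  _~_ = EqClosure _↝_

  infixr 9 _⊚_
  infixr 10 _⊠_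

  J : ∀ {U V} → U ⇒ V → U ⇛ V
  J φ = ⟨ [] , φ ∘ λ⇒ ⟩

  ι : ∀ {U} → U ⇛ U
  ι = ⟨ [] , λ⇒ ⟩

  _⊚_ : ∀ {U V W} → V ⇛ W → U ⇛ V → U ⇛ W
  ⟨ Δ , ψ ⟩ ⊚ ⟨ Γ , φ ⟩ = ⟨ Δ ++ Γ , ψ ∘ ((id ⊗₁ φ) ∘ (α⇒ ∘ (split Δ Γ ⊗₁ id))) ⟩

  _⊠_ : ∀ {U U' V V'} → U ⇛ V → U' ⇛ V' → U ⊗ U' ⇛ V ⊗ V'
  ⟨ Γ , φ ⟩ ⊠ ⟨ Γ' , φ' ⟩ = ⟨ Γ ++ Γ' , (φ ⊗₁ φ') ∘ (middle ∘ (split Γ Γ' ⊗₁ id)) ⟩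

  Λ : ∀ {U V W} → U ⊗ V ⇛ W → U ⇛ V ⊸ W
  Λ ⟨ Γ , φ ⟩ = ⟨ Γ , (id ⊸₁ (φ ∘ α⇒)) ∘ η ⟩

  _⊸⇛_ : ∀ {U U' V V'} → U' ⇛ U → V ⇛ V' → U ⊸ V ⇛ U' ⊸ V'
  f ⊸⇛ g = Λ (g ⊚ (J ε ⊚ (ι ⊠ f)))

module SMCCLemmas {o ℓ e : Level} (M : SMCC o ℓ e) where
  open SMCC M

  module E {A B : Obj} = IsEquivalence (≈-equiv {A} {B})
  module Reasoning {A B : Obj} where
    open SetoidReasoning (hom A B) public
  open Reasoning

  infixr 4 _⟩∘⟨_ refl⟩∘⟨_
  infixl 5 _⟩∘⟨refl

  _⟩∘⟨_ : ∀ {A B C} {f f' : B ⇒ C} {g g' : A ⇒ B} → f ≈ f' → g ≈ g' → f ∘ g ≈ f' ∘ g'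
  _⟩∘⟨_ = ∘-cong

  refl⟩∘⟨_ : ∀ {A B C} {f : B ⇒ C} {g g' : A ⇒ B} → g ≈ g' → f ∘ g ≈ f ∘ g'
  refl⟩∘⟨ p = ∘-cong E.refl p

  _⟩∘⟨refl : ∀ {A B C} {f f' : B ⇒ C} {g : A ⇒ B} → f ≈ f' → f ∘ g ≈ f' ∘ g
  p ⟩∘⟨refl = ∘-cong p E.refl

  pullˡ : ∀ {A B C D} {f : C ⇒ D} {g : B ⇒ C} {h : B ⇒ D} {k : A ⇒ B} →
          f ∘ g ≈ h → f ∘ (g ∘ k) ≈ h ∘ k
  pullˡ p = E.trans (E.sym assoc) (p ⟩∘⟨refl)

  pushˡ : ∀ {A B C D} {f : C ⇒ D} {g : B ⇒ C} {h : B ⇒ D} {k : A ⇒ B} →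
          h ≈ f ∘ g → h ∘ k ≈ f ∘ (g ∘ k)
  pushˡ p = E.trans (p ⟩∘⟨refl) assoc

  exch : ∀ {A B C C' D} {f : C ⇒ D} {g : B ⇒ C} {h : C' ⇒ D} {k : B ⇒ C'} {l : A ⇒ B} →
         f ∘ g ≈ h ∘ k → f ∘ (g ∘ l) ≈ h ∘ (k ∘ l)
  exch p = E.trans (pullˡ p) assoc

  cancˡ : ∀ {A B C} {f : B ⇒ C} {g : C ⇒ B} {h : A ⇒ C} → f ∘ g ≈ id → f ∘ (g ∘ h) ≈ h
  cancˡ p = E.trans (pullˡ p) idˡ

  shiftˡ : ∀ {A B C} {i : B ⇒ C} {j : C ⇒ B} {f : A ⇒ B} {g : A ⇒ C} →
           j ∘ i ≈ id → i ∘ f ≈ g → f ≈ j ∘ g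
  shiftˡ ji p = E.trans (E.sym (cancˡ ji)) (refl⟩∘⟨ p)

  shiftʳ : ∀ {A B C} {i : A ⇒ B} {j : B ⇒ A} {f : B ⇒ C} {g : A ⇒ C} →
           i ∘ j ≈ id → f ∘ i ≈ g → f ≈ g ∘ j
  shiftʳ ij p = E.trans (E.sym idʳ) (E.trans (refl⟩∘⟨ E.sym ij) (pullˡ p))

  epi : ∀ {A B C} {i : A ⇒ B} {j : B ⇒ A} {f g : B ⇒ C} →
        i ∘ j ≈ id → f ∘ i ≈ g ∘ i → f ≈ g
  epi ij p = E.trans (shiftʳ ij p) (E.trans assoc (E.trans (refl⟩∘⟨ ij) idʳ))

  mono : ∀ {A B C} {i : B ⇒ C} {j : C ⇒ B} {f g : A ⇒ B} →
         j ∘ i ≈ id → i ∘ f ≈ i ∘ g → f ≈ g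
  mono ji p = E.trans (shiftˡ ji p) (cancˡ ji)

  ⊗ˡ : ∀ {A A' B} {f f' : A ⇒ A'} → f ≈ f' → f ⊗₁ id {B} ≈ f' ⊗₁ id
  ⊗ˡ p = ⊗-cong p E.refl

  ⊗ʳ : ∀ {A B B'} {f f' : B ⇒ B'} → f ≈ f' → id {A} ⊗₁ f ≈ id ⊗₁ f'
  ⊗ʳ p = ⊗-cong E.refl p

  ∘⊗ˡ : ∀ {A A' A″ B} {f : A' ⇒ A″} {g : A ⇒ A'} →
        (f ∘ g) ⊗₁ id {B} ≈ (f ⊗₁ id) ∘ (g ⊗₁ id)
  ∘⊗ˡ = E.trans (⊗-cong E.refl (E.sym idˡ)) ⊗-∘

  ∘⊗ʳ : ∀ {A B B' B″} {f : B' ⇒ B″} {g : B ⇒ B'} →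
        id {A} ⊗₁ (f ∘ g) ≈ (id ⊗₁ f) ∘ (id ⊗₁ g)
  ∘⊗ʳ = E.trans (⊗-cong (E.sym idˡ) E.refl) ⊗-∘

  ∘⊗ʳ₃ : ∀ {A B B' B″ B‴} {f : B″ ⇒ B‴} {g : B' ⇒ B″} {h : B ⇒ B'} →
         id {A} ⊗₁ (f ∘ (g ∘ h)) ≈ (id ⊗₁ f) ∘ ((id ⊗₁ g) ∘ (id ⊗₁ h))
  ∘⊗ʳ₃ = E.trans ∘⊗ʳ (refl⟩∘⟨ ∘⊗ʳ)

  ∘⊗ˡ₃ : ∀ {A B B' B″ B‴} {f : B″ ⇒ B‴} {g : B' ⇒ B″} {h : B ⇒ B'} →
         (f ∘ (g ∘ h)) ⊗₁ id {A} ≈ (f ⊗₁ id) ∘ ((g ⊗₁ id) ∘ (h ⊗₁ id))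
  ∘⊗ˡ₃ = E.trans ∘⊗ˡ (refl⟩∘⟨ ∘⊗ˡ)

  ser₁ : ∀ {A A' B B'} {f : A ⇒ A'} {g : B ⇒ B'} → (f ⊗₁ id) ∘ (id ⊗₁ g) ≈ f ⊗₁ g
  ser₁ = E.trans (E.sym ⊗-∘) (⊗-cong idʳ idˡ)

  ser₂ : ∀ {A A' B B'} {f : A ⇒ A'} {g : B ⇒ B'} → (id ⊗₁ g) ∘ (f ⊗₁ id) ≈ f ⊗₁ g
  ser₂ = E.trans (E.sym ⊗-∘) (⊗-cong idˡ idʳ)

  swp : ∀ {A A' B B'} {f : A ⇒ A'} {g : B ⇒ B'} →
        (f ⊗₁ id) ∘ (id ⊗₁ g) ≈ (id ⊗₁ g) ∘ (f ⊗₁ id)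
  swp = E.trans ser₁ (E.sym ser₂)

  iso⊗ˡ : ∀ {A A' B} {f : A' ⇒ A} {g : A ⇒ A'} → f ∘ g ≈ id → (f ⊗₁ id {B}) ∘ (g ⊗₁ id) ≈ id
  iso⊗ˡ p = E.trans (E.sym ∘⊗ˡ) (E.trans (⊗ˡ p) ⊗-id)

  iso⊗ʳ : ∀ {A A' B} {f : A' ⇒ A} {g : A ⇒ A'} → f ∘ g ≈ id → (id {B} ⊗₁ f) ∘ (id ⊗₁ g) ≈ id
  iso⊗ʳ p = E.trans (E.sym ∘⊗ʳ) (E.trans (⊗ʳ p) ⊗-id)

  iso∘ : ∀ {A B C} {f : B ⇒ C} {g : A ⇒ B} {f' : C ⇒ B} {g' : B ⇒ A} →
         f ∘ f' ≈ id → g ∘ g' ≈ id → (f ∘ g) ∘ (g' ∘ f') ≈ id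
  iso∘ p q = E.trans assoc (E.trans (refl⟩∘⟨ cancˡ q) p)

  α-natˡ : ∀ {A A' B C} {f : A ⇒ A'} →
           α⇒ {A'} {B} {C} ∘ ((f ⊗₁ id) ⊗₁ id) ≈ (f ⊗₁ id) ∘ α⇒
  α-natˡ = E.trans α-nat (⊗-cong E.refl ⊗-id ⟩∘⟨refl)

  α-natʳ : ∀ {A B C C'} {h : C ⇒ C'} →
           α⇒ {A} {B} ∘ (id ⊗₁ h) ≈ (id ⊗₁ (id ⊗₁ h)) ∘ α⇒
  α-natʳ = E.trans (refl⟩∘⟨ ⊗-cong (E.sym ⊗-id) E.refl) α-nat

  conj : ∀ {A A' B B'} {f : A ⇒ A'} {g : B ⇒ B'} {i : A ⇒ B} {i' : A' ⇒ B'}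
         {j : B ⇒ A} {j' : B' ⇒ A'} →
         j' ∘ i' ≈ id → i ∘ j ≈ id → i' ∘ f ≈ g ∘ i → j' ∘ g ≈ f ∘ j
  conj {f = f} {g} {i} {i'} {j} {j'} a b p = begin
    j' ∘ g             ≈⟨ refl⟩∘⟨ shiftʳ b (E.sym p) ⟩
    j' ∘ ((i' ∘ f) ∘ j) ≈⟨ refl⟩∘⟨ assoc ⟩
    j' ∘ (i' ∘ (f ∘ j)) ≈⟨ cancˡ a ⟩
    f ∘ j              ∎

  α⇐-nat : ∀ {A A' B B' C C'} {f : A ⇒ A'} {g : B ⇒ B'} {h : C ⇒ C'} →
           α⇐ ∘ (f ⊗₁ (g ⊗₁ h)) ≈ ((f ⊗₁ g) ⊗₁ h) ∘ α⇐
  α⇐-nat = conj α-isoˡ α-isoʳ α-nat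

  α⇐-natˡ : ∀ {A A' B C} {f : A ⇒ A'} →
            α⇐ {A'} {B} {C} ∘ (f ⊗₁ id) ≈ ((f ⊗₁ id) ⊗₁ id) ∘ α⇐
  α⇐-natˡ = conj α-isoˡ α-isoʳ α-natˡ

  α⇐-natʳ : ∀ {A B C C'} {h : C ⇒ C'} →
            α⇐ {A} {B} ∘ (id ⊗₁ (id ⊗₁ h)) ≈ (id ⊗₁ h) ∘ α⇐
  α⇐-natʳ = conj α-isoˡ α-isoʳ α-natʳ

  λ⇐-nat : ∀ {A B} {f : A ⇒ B} → λ⇐ ∘ f ≈ (id ⊗₁ f) ∘ λ⇐
  λ⇐-nat = conj λ-isoˡ λ-isoʳ λ-nat

  ρ⇐-nat : ∀ {A B} {f : A ⇒ B} → ρ⇐ ∘ f ≈ (f ⊗₁ id) ∘ ρ⇐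
  ρ⇐-nat = conj ρ-isoˡ ρ-isoʳ ρ-nat

  I⊗-faithful : ∀ {A B} {f g : A ⇒ B} → id {I} ⊗₁ f ≈ id ⊗₁ g → f ≈ g
  I⊗-faithful p = epi λ-isoʳ (E.trans (E.sym λ-nat) (E.trans (refl⟩∘⟨ p) λ-nat))

  ⊗I-faithful : ∀ {A B} {f g : A ⇒ B} → f ⊗₁ id {I} ≈ g ⊗₁ id → f ≈ g
  ⊗I-faithful p = epi ρ-isoʳ (E.trans (E.sym ρ-nat) (E.trans (refl⟩∘⟨ p) ρ-nat))

  λ-α : ∀ {A B} → λ⇒ {A ⊗ B} ∘ α⇒ ≈ λ⇒ ⊗₁ id
  λ-α = I⊗-faithful (epi α-isoʳ (epi (iso⊗ˡ α-isoʳ) (begin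
    ((id ⊗₁ (λ⇒ ∘ α⇒)) ∘ α⇒) ∘ (α⇒ ⊗₁ id)       ≈⟨ assoc ⟩
    (id ⊗₁ (λ⇒ ∘ α⇒)) ∘ (α⇒ ∘ (α⇒ ⊗₁ id))       ≈⟨ pushˡ ∘⊗ʳ ⟩
    (id ⊗₁ λ⇒) ∘ ((id ⊗₁ α⇒) ∘ (α⇒ ∘ (α⇒ ⊗₁ id))) ≈⟨ refl⟩∘⟨ pentagon ⟩
    (id ⊗₁ λ⇒) ∘ (α⇒ ∘ α⇒)                      ≈⟨ pullˡ triangle ⟩
    (ρ⇒ ⊗₁ id) ∘ α⇒                             ≈⟨ α-natˡ ⟨
    α⇒ ∘ ((ρ⇒ ⊗₁ id) ⊗₁ id)                     ≈⟨ refl⟩∘⟨ ⊗ˡ triangle ⟨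
    α⇒ ∘ (((id ⊗₁ λ⇒) ∘ α⇒) ⊗₁ id)              ≈⟨ refl⟩∘⟨ ∘⊗ˡ ⟩
    α⇒ ∘ (((id ⊗₁ λ⇒) ⊗₁ id) ∘ (α⇒ ⊗₁ id))      ≈⟨ exch α-nat ⟩
    (id ⊗₁ (λ⇒ ⊗₁ id)) ∘ (α⇒ ∘ (α⇒ ⊗₁ id))      ≈⟨ assoc ⟨
    ((id ⊗₁ (λ⇒ ⊗₁ id)) ∘ α⇒) ∘ (α⇒ ⊗₁ id)      ∎)))

  ρ-α : ∀ {A B} → (id ⊗₁ ρ⇒) ∘ α⇒ ≈ ρ⇒ {A ⊗ B}
  ρ-α = ⊗I-faithful (mono α-isoˡ (begin
    α⇒ ∘ (((id ⊗₁ ρ⇒) ∘ α⇒) ⊗₁ id)              ≈⟨ refl⟩∘⟨ ∘⊗ˡ ⟩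
    α⇒ ∘ (((id ⊗₁ ρ⇒) ⊗₁ id) ∘ (α⇒ ⊗₁ id))      ≈⟨ exch α-nat ⟩
    (id ⊗₁ (ρ⇒ ⊗₁ id)) ∘ (α⇒ ∘ (α⇒ ⊗₁ id))      ≈⟨ ⊗ʳ triangle ⟩∘⟨refl ⟨
    (id ⊗₁ ((id ⊗₁ λ⇒) ∘ α⇒)) ∘ (α⇒ ∘ (α⇒ ⊗₁ id)) ≈⟨ pushˡ ∘⊗ʳ ⟩
    (id ⊗₁ (id ⊗₁ λ⇒)) ∘ ((id ⊗₁ α⇒) ∘ (α⇒ ∘ (α⇒ ⊗₁ id))) ≈⟨ refl⟩∘⟨ pentagon ⟩
    (id ⊗₁ (id ⊗₁ λ⇒)) ∘ (α⇒ ∘ α⇒)              ≈⟨ exch (E.sym α-natʳ) ⟩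
    α⇒ ∘ ((id ⊗₁ λ⇒) ∘ α⇒)                      ≈⟨ refl⟩∘⟨ triangle ⟩
    α⇒ ∘ (ρ⇒ ⊗₁ id)                             ∎))

  λ-σ : ∀ {A} → λ⇒ ∘ σ {A} {I} ≈ ρ⇒
  λ-σ = ⊗I-faithful (mono σ-invol (E.sym (begin
    σ ∘ (ρ⇒ ⊗₁ id)                          ≈⟨ refl⟩∘⟨ triangle ⟨
    σ ∘ ((id ⊗₁ λ⇒) ∘ α⇒)                   ≈⟨ exch σ-nat ⟩
    (λ⇒ ⊗₁ id) ∘ (σ ∘ α⇒)                   ≈⟨ pushˡ (E.sym λ-α) ⟩
    λ⇒ ∘ (α⇒ ∘ (σ ∘ α⇒))                    ≈⟨ refl⟩∘⟨ hexagon ⟨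
    λ⇒ ∘ ((id ⊗₁ σ) ∘ (α⇒ ∘ (σ ⊗₁ id)))     ≈⟨ exch λ-nat ⟩
    σ ∘ (λ⇒ ∘ (α⇒ ∘ (σ ⊗₁ id)))             ≈⟨ refl⟩∘⟨ pullˡ λ-α ⟩
    σ ∘ ((λ⇒ ⊗₁ id) ∘ (σ ⊗₁ id))            ≈⟨ refl⟩∘⟨ ∘⊗ˡ ⟨
    σ ∘ ((λ⇒ ∘ σ) ⊗₁ id)                    ∎)))

  ρ-σ : ∀ {A} → ρ⇒ ∘ σ {I} {A} ≈ λ⇒
  ρ-σ = E.trans (E.sym λ-σ ⟩∘⟨refl) (E.trans assoc (E.trans (refl⟩∘⟨ σ-invol) idʳ))

  σ-λ⇐ : ∀ {A} → σ ∘ λ⇐ ≈ ρ⇐ {A}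
  σ-λ⇐ = mono ρ-isoˡ (E.trans (pullˡ ρ-σ) (E.trans λ-isoʳ (E.sym ρ-isoʳ)))

  σ-ρ⇐ : ∀ {A} → σ ∘ ρ⇐ ≈ λ⇐ {A}
  σ-ρ⇐ = mono λ-isoˡ (E.trans (pullˡ λ-σ) (E.trans ρ-isoʳ (E.sym λ-isoʳ)))

  λ≈ρ : λ⇒ {I} ≈ ρ⇒ {I}
  λ≈ρ = ⊗I-faithful (begin
    λ⇒ ⊗₁ id            ≈⟨ λ-α ⟨
    λ⇒ ∘ α⇒             ≈⟨ mono λ-isoˡ λ-nat ⟩∘⟨refl ⟨
    (id ⊗₁ λ⇒) ∘ α⇒     ≈⟨ triangle ⟩
    ρ⇒ ⊗₁ id            ∎)

  λ⇐≈ρ⇐ : λ⇐ {I} ≈ ρ⇐ {I}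
  λ⇐≈ρ⇐ = mono λ-isoˡ (E.trans λ-isoʳ (E.sym (E.trans (λ≈ρ ⟩∘⟨refl) ρ-isoʳ)))

  λ⇒-α⇐ : ∀ {A B} → (λ⇒ ⊗₁ id) ∘ α⇐ ≈ λ⇒ {A ⊗ B}
  λ⇒-α⇐ = E.sym (shiftʳ α-isoʳ λ-α)

  α-λ⇐ : ∀ {A B} → α⇒ ∘ (λ⇐ ⊗₁ id) ≈ λ⇐ {A ⊗ B}
  α-λ⇐ = mono λ-isoˡ (E.trans (pullˡ λ-α) (E.trans (iso⊗ˡ λ-isoʳ) (E.sym λ-isoʳ)))

  ρ-α⇐ : ∀ {A B} → ρ⇒ {A ⊗ B} ∘ α⇐ ≈ id ⊗₁ ρ⇒
  ρ-α⇐ = E.sym (shiftʳ α-isoʳ ρ-α)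

  α⇐-ρ⇐ : ∀ {A B} → α⇐ ∘ (id ⊗₁ ρ⇐) ≈ ρ⇐ {A ⊗ B}
  α⇐-ρ⇐ = mono ρ-isoˡ (E.trans (pullˡ ρ-α⇐) (E.trans (iso⊗ʳ ρ-isoʳ) (E.sym ρ-isoʳ)))

  α⇐-λ⇐ : ∀ {A B} → α⇐ ∘ (id {A} ⊗₁ λ⇐) ≈ ρ⇐ ⊗₁ id {B}
  α⇐-λ⇐ = mono (iso⊗ˡ ρ-isoˡ) (E.trans (E.sym triangle ⟩∘⟨refl) (E.trans assoc
    (E.trans (refl⟩∘⟨ cancˡ α-isoʳ) (E.trans (iso⊗ʳ λ-isoʳ) (E.sym (iso⊗ˡ ρ-isoʳ))))))

  inv-unique : ∀ {A B} {f g : A ⇒ B} {f' g' : B ⇒ A} →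
               f ≈ g → f ∘ f' ≈ id → g' ∘ g ≈ id → f' ≈ g'
  inv-unique {f = f} {g} {f'} {g'} p a b =
    E.trans (E.sym (cancˡ b)) (E.trans (refl⟩∘⟨ E.trans (E.sym p ⟩∘⟨refl) a) idʳ)

  penta₁ : ∀ {A B C D} → (α⇒ {A} {B} {C} ⊗₁ id {D}) ∘ α⇐ ≈ α⇐ ∘ ((id ⊗₁ α⇐) ∘ α⇒)
  penta₁ = E.sym (shiftʳ α-isoʳ (begin
    (α⇐ ∘ ((id ⊗₁ α⇐) ∘ α⇒)) ∘ α⇒  ≈⟨ assoc ⟩
    α⇐ ∘ (((id ⊗₁ α⇐) ∘ α⇒) ∘ α⇒)  ≈⟨ refl⟩∘⟨ assoc ⟩
    α⇐ ∘ ((id ⊗₁ α⇐) ∘ (α⇒ ∘ α⇒))  ≈⟨ shiftˡ α-isoˡ (shiftˡ (iso⊗ʳ α-isoˡ) pentagon) ⟨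
    α⇒ ⊗₁ id                       ∎))

  penta₂ : ∀ {A B C D} →
           (α⇐ ⊗₁ id) ∘ (α⇐ ∘ (id ⊗₁ α⇐)) ≈ α⇐ {A ⊗ B} {C} {D} ∘ α⇐
  penta₂ = inv-unique pentagon
    (E.trans (refl⟩∘⟨ E.sym assoc) (iso∘ (iso⊗ʳ α-isoʳ) (iso∘ α-isoʳ (iso⊗ˡ α-isoʳ))))
    (iso∘ α-isoˡ α-isoˡ)

  penta₃ : ∀ {A B C D} →
           α⇒ ∘ ((α⇐ ⊗₁ id) ∘ α⇐) ≈ α⇐ {A} {B} {C ⊗ D} ∘ (id ⊗₁ α⇒)
  penta₃ = shiftʳ (iso⊗ʳ α-isoˡ) (E.trans assoc (E.trans (refl⟩∘⟨ assoc)
    (E.trans (refl⟩∘⟨ penta₂) (cancˡ α-isoʳ))))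

  σₗ-invol : ∀ {A B C} → σₗ ∘ σₗ ≈ id {A ⊗ (B ⊗ C)}
  σₗ-invol = begin
    (α⇒ ∘ ((σ ⊗₁ id) ∘ α⇐)) ∘ (α⇒ ∘ ((σ ⊗₁ id) ∘ α⇐)) ≈⟨ refl⟩∘⟨ E.sym assoc ⟩
    (α⇒ ∘ ((σ ⊗₁ id) ∘ α⇐)) ∘ ((α⇒ ∘ (σ ⊗₁ id)) ∘ α⇐) ≈⟨ iso∘ α-isoʳ (iso∘ (iso⊗ˡ σ-invol) α-isoˡ) ⟩
    id ∎

  hexagon₁ : ∀ {A B C} → α⇒ ∘ σ {C} {A ⊗ B} ≈ (id ⊗₁ σ) ∘ σₗ
  hexagon₁ = begin
    α⇒ ∘ σ                                   ≈⟨ shiftʳ α-isoʳ (E.trans assoc (E.sym hexagon)) ⟩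
    ((id ⊗₁ σ) ∘ (α⇒ ∘ (σ ⊗₁ id))) ∘ α⇐      ≈⟨ assoc ⟩
    (id ⊗₁ σ) ∘ ((α⇒ ∘ (σ ⊗₁ id)) ∘ α⇐)      ≈⟨ refl⟩∘⟨ assoc ⟩
    (id ⊗₁ σ) ∘ σₗ                           ∎

  hexagon₂ : ∀ {A B C} → σ {A ⊗ B} {C} ∘ α⇐ ≈ σₗ ∘ (id ⊗₁ σ)
  hexagon₂ = inv-unique hexagon₁ (iso∘ α-isoʳ σ-invol) (iso∘ σₗ-invol (iso⊗ʳ σ-invol))

  σₗ-via-σ : ∀ {A B C} → σ ∘ (α⇐ ∘ (id {A} ⊗₁ σ {B} {C})) ≈ σₗ
  σₗ-via-σ = E.trans (pullˡ hexagon₂) (E.trans assoc (E.trans (refl⟩∘⟨ iso⊗ʳ σ-invol) idʳ))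

  σₗ-nat : ∀ {A A' B B' C C'} {f : A ⇒ A'} {g : B ⇒ B'} {h : C ⇒ C'} →
           σₗ ∘ (f ⊗₁ (g ⊗₁ h)) ≈ (g ⊗₁ (f ⊗₁ h)) ∘ σₗ
  σₗ-nat {f = f} {g} {h} = begin
    σₗ ∘ (f ⊗₁ (g ⊗₁ h))                        ≈⟨ assoc ⟩
    α⇒ ∘ (((σ ⊗₁ id) ∘ α⇐) ∘ (f ⊗₁ (g ⊗₁ h)))   ≈⟨ refl⟩∘⟨ assoc ⟩
    α⇒ ∘ ((σ ⊗₁ id) ∘ (α⇐ ∘ (f ⊗₁ (g ⊗₁ h))))   ≈⟨ refl⟩∘⟨ refl⟩∘⟨ α⇐-nat ⟩
    α⇒ ∘ ((σ ⊗₁ id) ∘ (((f ⊗₁ g) ⊗₁ h) ∘ α⇐))   ≈⟨ refl⟩∘⟨ exch (E.trans (E.sym ⊗-∘)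
                                                    (E.trans (⊗-cong σ-nat (E.trans idˡ (E.sym idʳ))) ⊗-∘)) ⟩
    α⇒ ∘ (((g ⊗₁ f) ⊗₁ h) ∘ ((σ ⊗₁ id) ∘ α⇐))   ≈⟨ exch α-nat ⟩
    (g ⊗₁ (f ⊗₁ h)) ∘ σₗ                        ∎

  σₗ-nat₃ : ∀ {A B C C'} {h : C ⇒ C'} →
            σₗ {A} {B} ∘ (id ⊗₁ (id ⊗₁ h)) ≈ (id ⊗₁ (id ⊗₁ h)) ∘ σₗ
  σₗ-nat₃ = σₗ-nat

  σₗ-α : ∀ {A B C} → σₗ {A} {B} {C} ∘ (α⇒ ∘ (σ ⊗₁ id)) ≈ α⇒
  σₗ-α = begin
    (α⇒ ∘ ((σ ⊗₁ id) ∘ α⇐)) ∘ (α⇒ ∘ (σ ⊗₁ id))  ≈⟨ assoc ⟩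
    α⇒ ∘ (((σ ⊗₁ id) ∘ α⇐) ∘ (α⇒ ∘ (σ ⊗₁ id)))  ≈⟨ refl⟩∘⟨ iso∘ (iso⊗ˡ σ-invol) α-isoˡ ⟩
    α⇒ ∘ id                                     ≈⟨ idʳ ⟩
    α⇒                                          ∎

  σₗ-λ⇐ : ∀ {A B} → σₗ ∘ (id {A} ⊗₁ λ⇐ {B}) ≈ λ⇐
  σₗ-λ⇐ = begin
    (α⇒ ∘ ((σ ⊗₁ id) ∘ α⇐)) ∘ (id ⊗₁ λ⇐)  ≈⟨ assoc ⟩
    α⇒ ∘ (((σ ⊗₁ id) ∘ α⇐) ∘ (id ⊗₁ λ⇐))  ≈⟨ refl⟩∘⟨ assoc ⟩
    α⇒ ∘ ((σ ⊗₁ id) ∘ (α⇐ ∘ (id ⊗₁ λ⇐)))  ≈⟨ refl⟩∘⟨ refl⟩∘⟨ α⇐-λ⇐ ⟩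
    α⇒ ∘ ((σ ⊗₁ id) ∘ (ρ⇐ ⊗₁ id))         ≈⟨ refl⟩∘⟨ ∘⊗ˡ ⟨
    α⇒ ∘ ((σ ∘ ρ⇐) ⊗₁ id)                 ≈⟨ refl⟩∘⟨ ⊗ˡ σ-ρ⇐ ⟩
    α⇒ ∘ (λ⇐ ⊗₁ id)                       ≈⟨ α-λ⇐ ⟩
    λ⇐                                    ∎

  σₗ-α⇐ : ∀ {x y D G} →
          σₗ {x} {y ⊗ D} {G} ∘ (id ⊗₁ α⇐) ≈ α⇐ ∘ ((id ⊗₁ σₗ) ∘ σₗ)
  σₗ-α⇐ = begin
    (α⇒ ∘ ((σ ⊗₁ id) ∘ α⇐)) ∘ (id ⊗₁ α⇐)
      ≈⟨ E.trans assoc (refl⟩∘⟨ assoc) ⟩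
    α⇒ ∘ ((σ ⊗₁ id) ∘ (α⇐ ∘ (id ⊗₁ α⇐)))
      ≈⟨ refl⟩∘⟨ ⊗ˡ σ-split ⟩∘⟨refl ⟩
    α⇒ ∘ (((α⇐ ∘ ((id ⊗₁ σ) ∘ σₗ')) ⊗₁ id) ∘ (α⇐ ∘ (id ⊗₁ α⇐)))
      ≈⟨ refl⟩∘⟨ E.trans (∘⊗ˡ₃ ⟩∘⟨refl) (E.trans assoc (refl⟩∘⟨ assoc)) ⟩
    α⇒ ∘ ((α⇐ ⊗₁ id) ∘ (((id ⊗₁ σ) ⊗₁ id) ∘ ((σₗ' ⊗₁ id) ∘ (α⇐ ∘ (id ⊗₁ α⇐)))))
      ≈⟨ refl⟩∘⟨ refl⟩∘⟨ refl⟩∘⟨ tail ⟩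
    α⇒ ∘ ((α⇐ ⊗₁ id) ∘ (((id ⊗₁ σ) ⊗₁ id) ∘ (α⇐ ∘ ((id ⊗₁ α⇐) ∘ σₗ))))
      ≈⟨ refl⟩∘⟨ refl⟩∘⟨ exch (E.sym α⇐-nat) ⟩
    α⇒ ∘ ((α⇐ ⊗₁ id) ∘ (α⇐ ∘ ((id ⊗₁ (σ ⊗₁ id)) ∘ ((id ⊗₁ α⇐) ∘ σₗ))))
      ≈⟨ E.trans (refl⟩∘⟨ E.sym assoc) (exch penta₃) ⟩
    α⇐ ∘ ((id ⊗₁ α⇒) ∘ ((id ⊗₁ (σ ⊗₁ id)) ∘ ((id ⊗₁ α⇐) ∘ σₗ)))
      ≈⟨ refl⟩∘⟨ E.trans (∘⊗ʳ₃ ⟩∘⟨refl) (E.trans assoc (refl⟩∘⟨ assoc)) ⟨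
    α⇐ ∘ ((id ⊗₁ σₗ) ∘ σₗ)
      ∎
    where
      σₗ' : ∀ {A B C} → A ⊗ (B ⊗ C) ⇒ B ⊗ (A ⊗ C)
      σₗ' = σₗ

      σ-split : ∀ {A B C} → σ {C} {A ⊗ B} ≈ α⇐ ∘ ((id ⊗₁ σ) ∘ σₗ')
      σ-split = shiftˡ α-isoˡ hexagon₁

      tail : ∀ {A B C D} →
             (σₗ' ⊗₁ id) ∘ (α⇐ ∘ (id ⊗₁ α⇐)) ≈
             α⇐ {B} {A ⊗ C} {D} ∘ ((id ⊗₁ α⇐) ∘ σₗ)
      tail = begin
        (σₗ' ⊗₁ id) ∘ (α⇐ ∘ (id ⊗₁ α⇐))
          ≈⟨ E.trans (∘⊗ˡ₃ ⟩∘⟨refl) (E.trans assoc (refl⟩∘⟨ assoc)) ⟩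
        (α⇒ ⊗₁ id) ∘ (((σ ⊗₁ id) ⊗₁ id) ∘ ((α⇐ ⊗₁ id) ∘ (α⇐ ∘ (id ⊗₁ α⇐))))
          ≈⟨ refl⟩∘⟨ refl⟩∘⟨ penta₂ ⟩
        (α⇒ ⊗₁ id) ∘ (((σ ⊗₁ id) ⊗₁ id) ∘ (α⇐ ∘ α⇐))
          ≈⟨ refl⟩∘⟨ exch (E.sym α⇐-natˡ) ⟩
        (α⇒ ⊗₁ id) ∘ (α⇐ ∘ ((σ ⊗₁ id) ∘ α⇐))
          ≈⟨ E.trans (pullˡ penta₁) (E.trans assoc (refl⟩∘⟨ assoc)) ⟩
        α⇐ ∘ ((id ⊗₁ α⇐) ∘ (α⇒ ∘ ((σ ⊗₁ id) ∘ α⇐)))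
          ∎

  curry : ∀ {A B C} → A ⊗ B ⇒ C → A ⇒ B ⊸ C
  curry f = (id ⊸₁ f) ∘ η

  curry-cong : ∀ {A B C} {f g : A ⊗ B ⇒ C} → f ≈ g → curry f ≈ curry g
  curry-cong p = ⊸-cong E.refl p ⟩∘⟨refl

  id⊸-∘ : ∀ {A B C D} {f : C ⇒ D} {g : B ⇒ C} → id {A} ⊸₁ (f ∘ g) ≈ (id ⊸₁ f) ∘ (id ⊸₁ g)
  id⊸-∘ = E.trans (⊸-cong (E.sym idˡ) E.refl) ⊸-∘

  curry-∘ : ∀ {A A' B C} {f : A ⊗ B ⇒ C} {g : A' ⇒ A} → curry f ∘ g ≈ curry (f ∘ (g ⊗₁ id))
  curry-∘ = E.trans assoc (E.trans (refl⟩∘⟨ E.sym η-nat) (pullˡ (E.sym id⊸-∘)))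

  curry-β : ∀ {A B C} {f : A ⊗ B ⇒ C} → ε ∘ (curry f ⊗₁ id) ≈ f
  curry-β = E.trans (refl⟩∘⟨ ∘⊗ˡ) (E.trans (exch ε-nat) (E.trans (refl⟩∘⟨ zig) idʳ))

  curry-η : ∀ {A B C} {g : A ⇒ B ⊸ C} → curry (ε ∘ (g ⊗₁ id)) ≈ g
  curry-η = E.trans (E.sym curry-∘) (E.trans (zag ⟩∘⟨refl) idˡ)

  curry-id : ∀ {A B} → curry (id {A ⊗ B}) ≈ η
  curry-id = E.trans (⊸-id ⟩∘⟨refl) idˡ

module AdjoinLaws {o ℓ e c : Level} (M : SMCC o ℓ e) {Op : Set c} (at : Op → SMCC.Obj M) where
  open SMCC M
  open SMCCLemmas M
  open Reasoning
  open Adjoin M at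

  ++-assocᴺ : ∀ Θ Δ Γ → Σ[ q ∈ (Θ ++ Δ) ++ Γ ↭ Θ ++ (Δ ++ Γ) ]
    (id ⊗₁ splitᴺ Δ Γ) ∘ (splitᴺ Θ (Δ ++ Γ) ∘ permᴺ q) ≈
    α⇒ ∘ ((splitᴺ Θ Δ ⊗₁ id) ∘ splitᴺ (Θ ++ Δ) Γ)
  ++-assocᴺ [] Δ Γ = refl , (begin
    (id ⊗₁ splitᴺ Δ Γ) ∘ (λ⇐ ∘ id)        ≈⟨ refl⟩∘⟨ idʳ ⟩
    (id ⊗₁ splitᴺ Δ Γ) ∘ λ⇐               ≈⟨ λ⇐-nat ⟨
    λ⇐ ∘ splitᴺ Δ Γ                       ≈⟨ pushˡ (E.sym α-λ⇐) ⟩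
    α⇒ ∘ ((λ⇐ ⊗₁ id) ∘ splitᴺ Δ Γ)        ∎)
  ++-assocᴺ (f ∷ Θ) Δ Γ = let q , h = ++-assocᴺ Θ Δ Γ in prep f q , (begin
    (id ⊗₁ s₁) ∘ ((α⇐ ∘ (id ⊗₁ s₂)) ∘ (id ⊗₁ permᴺ q))
      ≈⟨ refl⟩∘⟨ assoc ⟩
    (id ⊗₁ s₁) ∘ (α⇐ ∘ ((id ⊗₁ s₂) ∘ (id ⊗₁ permᴺ q)))
      ≈⟨ exch (E.sym α⇐-natʳ) ⟩
    α⇐ ∘ ((id ⊗₁ (id ⊗₁ s₁)) ∘ ((id ⊗₁ s₂) ∘ (id ⊗₁ permᴺ q)))
      ≈⟨ refl⟩∘⟨ ∘⊗ʳ₃ ⟨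
    α⇐ ∘ (id ⊗₁ ((id ⊗₁ s₁) ∘ (s₂ ∘ permᴺ q)))
      ≈⟨ refl⟩∘⟨ ⊗ʳ h ⟩
    α⇐ ∘ (id ⊗₁ (α⇒ ∘ ((s₃ ⊗₁ id) ∘ s₄)))
      ≈⟨ refl⟩∘⟨ ∘⊗ʳ₃ ⟩
    α⇐ ∘ ((id ⊗₁ α⇒) ∘ ((id ⊗₁ (s₃ ⊗₁ id)) ∘ (id ⊗₁ s₄)))
      ≈⟨ exch penta₃ ⟨
    α⇒ ∘ (((α⇐ ⊗₁ id) ∘ α⇐) ∘ ((id ⊗₁ (s₃ ⊗₁ id)) ∘ (id ⊗₁ s₄)))
      ≈⟨ refl⟩∘⟨ assoc ⟩
    α⇒ ∘ ((α⇐ ⊗₁ id) ∘ (α⇐ ∘ ((id ⊗₁ (s₃ ⊗₁ id)) ∘ (id ⊗₁ s₄))))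
      ≈⟨ refl⟩∘⟨ refl⟩∘⟨ exch α⇐-nat ⟩
    α⇒ ∘ ((α⇐ ⊗₁ id) ∘ (((id ⊗₁ s₃) ⊗₁ id) ∘ (α⇐ ∘ (id ⊗₁ s₄))))
      ≈⟨ refl⟩∘⟨ pullˡ (E.sym ∘⊗ˡ) ⟩
    α⇒ ∘ (((α⇐ ∘ (id ⊗₁ s₃)) ⊗₁ id) ∘ (α⇐ ∘ (id ⊗₁ s₄)))
      ∎)
    where
      s₁ = splitᴺ Δ Γ
      s₂ = splitᴺ Θ (Δ ++ Γ)
      s₃ = splitᴺ Θ Δ
      s₄ = splitᴺ (Θ ++ Δ) Γ

  ++-unitᴺ : ∀ Γ → Σ[ q ∈ Γ ↭ Γ ++ [] ] splitᴺ Γ [] ∘ permᴺ q ≈ ρ⇐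
  ++-unitᴺ []      = refl , E.trans idʳ λ⇐≈ρ⇐
  ++-unitᴺ (f ∷ Γ) = let q , h = ++-unitᴺ Γ in prep f q , (begin
    (α⇐ ∘ (id ⊗₁ splitᴺ Γ [])) ∘ (id ⊗₁ permᴺ q)  ≈⟨ assoc ⟩
    α⇐ ∘ ((id ⊗₁ splitᴺ Γ []) ∘ (id ⊗₁ permᴺ q))  ≈⟨ refl⟩∘⟨ ∘⊗ʳ ⟨
    α⇐ ∘ (id ⊗₁ (splitᴺ Γ [] ∘ permᴺ q))          ≈⟨ refl⟩∘⟨ ⊗ʳ h ⟩
    α⇐ ∘ (id ⊗₁ ρ⇐)                               ≈⟨ α⇐-ρ⇐ ⟩
    ρ⇐                                            ∎)

  ++-rightᴺ : ∀ Δ {Γ Γ'} (p : Γ ↭ Γ') → Σ[ q ∈ Δ ++ Γ ↭ Δ ++ Γ' ]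
    splitᴺ Δ Γ' ∘ permᴺ q ≈ (id ⊗₁ permᴺ p) ∘ splitᴺ Δ Γ
  ++-rightᴺ []      p = p , λ⇐-nat
  ++-rightᴺ (f ∷ Δ) {Γ} {Γ'} p = let q , h = ++-rightᴺ Δ p in prep f q , (begin
    (α⇐ ∘ (id ⊗₁ splitᴺ Δ Γ')) ∘ (id ⊗₁ permᴺ q)        ≈⟨ assoc ⟩
    α⇐ ∘ ((id ⊗₁ splitᴺ Δ Γ') ∘ (id ⊗₁ permᴺ q))        ≈⟨ refl⟩∘⟨ ∘⊗ʳ ⟨
    α⇐ ∘ (id ⊗₁ (splitᴺ Δ Γ' ∘ permᴺ q))                ≈⟨ refl⟩∘⟨ ⊗ʳ h ⟩
    α⇐ ∘ (id ⊗₁ ((id ⊗₁ permᴺ p) ∘ splitᴺ Δ Γ))         ≈⟨ refl⟩∘⟨ ∘⊗ʳ ⟩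
    α⇐ ∘ ((id ⊗₁ (id ⊗₁ permᴺ p)) ∘ (id ⊗₁ splitᴺ Δ Γ)) ≈⟨ exch α⇐-natʳ ⟩
    (id ⊗₁ permᴺ p) ∘ (α⇐ ∘ (id ⊗₁ splitᴺ Δ Γ))         ∎)

  ++-shiftᴺ : ∀ f Δ Γ → Σ[ q ∈ f ∷ (Δ ++ Γ) ↭ Δ ++ (f ∷ Γ) ]
    splitᴺ Δ (f ∷ Γ) ∘ permᴺ q ≈ σₗ ∘ (id ⊗₁ splitᴺ Δ Γ)
  ++-shiftᴺ f []      Γ = refl , E.trans idʳ (E.sym σₗ-λ⇐)
  ++-shiftᴺ f (g ∷ Δ) Γ =
    let q , h = ++-shiftᴺ f Δ Γ in trans (swap f g refl) (prep g q) , (begin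
    (α⇐ ∘ (id ⊗₁ splitᴺ Δ (f ∷ Γ))) ∘ ((id ⊗₁ permᴺ q) ∘ (σₗ ∘ (id ⊗₁ (id ⊗₁ id))))
      ≈⟨ refl⟩∘⟨ refl⟩∘⟨ E.trans (refl⟩∘⟨ E.trans (⊗ʳ ⊗-id) ⊗-id) idʳ ⟩
    (α⇐ ∘ (id ⊗₁ splitᴺ Δ (f ∷ Γ))) ∘ ((id ⊗₁ permᴺ q) ∘ σₗ)
      ≈⟨ assoc ⟩
    α⇐ ∘ ((id ⊗₁ splitᴺ Δ (f ∷ Γ)) ∘ ((id ⊗₁ permᴺ q) ∘ σₗ))
      ≈⟨ refl⟩∘⟨ pullˡ (E.sym ∘⊗ʳ) ⟩
    α⇐ ∘ ((id ⊗₁ (splitᴺ Δ (f ∷ Γ) ∘ permᴺ q)) ∘ σₗ)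
      ≈⟨ refl⟩∘⟨ ⊗ʳ h ⟩∘⟨refl ⟩
    α⇐ ∘ ((id ⊗₁ (σₗ ∘ (id ⊗₁ splitᴺ Δ Γ))) ∘ σₗ)
      ≈⟨ refl⟩∘⟨ pushˡ ∘⊗ʳ ⟩
    α⇐ ∘ ((id ⊗₁ σₗ) ∘ ((id ⊗₁ (id ⊗₁ splitᴺ Δ Γ)) ∘ σₗ))
      ≈⟨ refl⟩∘⟨ refl⟩∘⟨ σₗ-nat₃ ⟨
    α⇐ ∘ ((id ⊗₁ σₗ) ∘ (σₗ ∘ (id ⊗₁ (id ⊗₁ splitᴺ Δ Γ))))
      ≈⟨ E.trans (refl⟩∘⟨ E.sym assoc) (E.sym assoc) ⟩
    (α⇐ ∘ ((id ⊗₁ σₗ) ∘ σₗ)) ∘ (id ⊗₁ (id ⊗₁ splitᴺ Δ Γ))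
      ≈⟨ pushˡ (E.sym σₗ-α⇐) ⟩
    σₗ ∘ ((id ⊗₁ α⇐) ∘ (id ⊗₁ (id ⊗₁ splitᴺ Δ Γ)))
      ≈⟨ refl⟩∘⟨ ∘⊗ʳ ⟨
    σₗ ∘ (id ⊗₁ (α⇐ ∘ (id ⊗₁ splitᴺ Δ Γ)))
      ∎)

  ++-commᴺ : ∀ Γ Δ → Σ[ q ∈ Γ ++ Δ ↭ Δ ++ Γ ]
    splitᴺ Δ Γ ∘ permᴺ q ≈ σ ∘ splitᴺ Γ Δ
  ++-commᴺ []      Δ = let q , h = ++-unitᴺ Δ in q , E.trans h (E.sym σ-λ⇐)
  ++-commᴺ (f ∷ Γ) Δ =
    let q , h = ++-commᴺ Γ Δ
        r , k = ++-shiftᴺ f Δ Γ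
    in trans (prep f q) r , (begin
    splitᴺ Δ (f ∷ Γ) ∘ (permᴺ r ∘ (id ⊗₁ permᴺ q))      ≈⟨ pullˡ k ⟩
    (σₗ ∘ (id ⊗₁ splitᴺ Δ Γ)) ∘ (id ⊗₁ permᴺ q)         ≈⟨ assoc ⟩
    σₗ ∘ ((id ⊗₁ splitᴺ Δ Γ) ∘ (id ⊗₁ permᴺ q))         ≈⟨ refl⟩∘⟨ ∘⊗ʳ ⟨
    σₗ ∘ (id ⊗₁ (splitᴺ Δ Γ ∘ permᴺ q))                 ≈⟨ refl⟩∘⟨ ⊗ʳ h ⟩
    σₗ ∘ (id ⊗₁ (σ ∘ splitᴺ Γ Δ))                       ≈⟨ refl⟩∘⟨ ∘⊗ʳ ⟩
    σₗ ∘ ((id ⊗₁ σ) ∘ (id ⊗₁ splitᴺ Γ Δ))               ≈⟨ exch hexagon₂ ⟨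
    σ ∘ (α⇐ ∘ (id ⊗₁ splitᴺ Γ Δ))                       ∎)

  nestFrom-isoˡ : ∀ A Γ → nestFrom⇐ A Γ ∘ nestFrom⇒ A Γ ≈ id
  nestFrom-isoˡ A []      = ρ-isoʳ
  nestFrom-isoˡ A (f ∷ Γ) = iso∘ (nestFrom-isoˡ (A ⊗ at f) Γ) α-isoˡ

  nestFrom-isoʳ : ∀ A Γ → nestFrom⇒ A Γ ∘ nestFrom⇐ A Γ ≈ id
  nestFrom-isoʳ A []      = ρ-isoˡ
  nestFrom-isoʳ A (f ∷ Γ) = iso∘ α-isoʳ (nestFrom-isoʳ (A ⊗ at f) Γ)

  nest-isoˡ : ∀ Γ → nest⇐ Γ ∘ nest⇒ Γ ≈ id
  nest-isoˡ []      = idˡ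
  nest-isoˡ (f ∷ Γ) = nestFrom-isoˡ (at f) Γ

  nest-isoʳ : ∀ Γ → nest⇒ Γ ∘ nest⇐ Γ ≈ id
  nest-isoʳ []      = idˡ
  nest-isoʳ (f ∷ Γ) = nestFrom-isoʳ (at f) Γ

  perm-nest⇐ : ∀ {Γ Γ'} (p : Γ ↭ Γ') → perm p ∘ nest⇐ Γ ≈ nest⇐ Γ' ∘ permᴺ p
  perm-nest⇐ {Γ} {Γ'} p = E.trans assoc (refl⟩∘⟨ E.trans assoc
    (E.trans (refl⟩∘⟨ nest-isoʳ Γ) idʳ))

  split-nest⇐ : ∀ Δ Γ → split Δ Γ ∘ nest⇐ (Δ ++ Γ) ≈ (nest⇐ Δ ⊗₁ nest⇐ Γ) ∘ splitᴺ Δ Γ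
  split-nest⇐ Δ Γ = E.trans assoc (refl⟩∘⟨ E.trans assoc
    (E.trans (refl⟩∘⟨ nest-isoʳ (Δ ++ Γ)) idʳ))

  nest⇐-epi : ∀ Γ {A} {f g : ty Γ ⇒ A} → f ∘ nest⇐ Γ ≈ g ∘ nest⇐ Γ → f ≈ g
  nest⇐-epi Γ = epi (nest-isoˡ Γ)

  split-perm⇐ : ∀ {Θ} Δ Γ (q : Θ ↭ Δ ++ Γ) →
    (split Δ Γ ∘ perm q) ∘ nest⇐ Θ ≈ (nest⇐ Δ ⊗₁ nest⇐ Γ) ∘ (splitᴺ Δ Γ ∘ permᴺ q)
  split-perm⇐ Δ Γ q = E.trans assoc (E.trans (refl⟩∘⟨ perm-nest⇐ q)
    (E.trans (pullˡ (split-nest⇐ Δ Γ)) assoc))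

  perm-refl : ∀ {Γ} → perm (refl {xs = Γ}) ≈ id
  perm-refl {Γ} = E.trans (refl⟩∘⟨ idˡ) (nest-isoˡ Γ)

  split-[] : ∀ Γ → split [] Γ ≈ λ⇐
  split-[] Γ = E.trans (refl⟩∘⟨ λ⇐-nat) (E.trans (pullˡ ser₂')
    (E.trans (⊗ʳ (nest-isoˡ Γ) ⟩∘⟨refl) (E.trans (⊗-id ⟩∘⟨refl) idˡ)))
    where
      ser₂' : (id ⊗₁ nest⇐ Γ) ∘ (id ⊗₁ nest⇒ Γ) ≈ id ⊗₁ (nest⇐ Γ ∘ nest⇒ Γ)
      ser₂' = E.sym ∘⊗ʳ

  ++-unit : ∀ Γ → Σ[ q ∈ Γ ↭ Γ ++ [] ] split Γ [] ∘ perm q ≈ ρ⇐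
  ++-unit Γ = let q , h = ++-unitᴺ Γ in q , nest⇐-epi Γ
    (E.trans (split-perm⇐ Γ [] q) (E.trans (refl⟩∘⟨ h) (E.sym ρ⇐-nat)))

  ++-right : ∀ Δ {Γ Γ'} (p : Γ ↭ Γ') → Σ[ q ∈ Δ ++ Γ ↭ Δ ++ Γ' ]
    split Δ Γ' ∘ perm q ≈ (id ⊗₁ perm p) ∘ split Δ Γ
  ++-right Δ {Γ} {Γ'} p = let q , h = ++-rightᴺ Δ p in q , nest⇐-epi (Δ ++ Γ) (begin
    (split Δ Γ' ∘ perm q) ∘ nest⇐ (Δ ++ Γ)                      ≈⟨ split-perm⇐ Δ Γ' q ⟩
    (nest⇐ Δ ⊗₁ nest⇐ Γ') ∘ (splitᴺ Δ Γ' ∘ permᴺ q)             ≈⟨ refl⟩∘⟨ h ⟩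
    (nest⇐ Δ ⊗₁ nest⇐ Γ') ∘ ((id ⊗₁ permᴺ p) ∘ splitᴺ Δ Γ)      ≈⟨ pullˡ (E.trans (E.sym ⊗-∘)
                                                                  (E.trans (⊗-cong (E.trans idʳ (E.sym idˡ)) (E.sym (perm-nest⇐ p))) ⊗-∘)) ⟩
    ((id ⊗₁ perm p) ∘ (nest⇐ Δ ⊗₁ nest⇐ Γ)) ∘ splitᴺ Δ Γ        ≈⟨ assoc ⟩
    (id ⊗₁ perm p) ∘ ((nest⇐ Δ ⊗₁ nest⇐ Γ) ∘ splitᴺ Δ Γ)        ≈⟨ refl⟩∘⟨ split-nest⇐ Δ Γ ⟨
    (id ⊗₁ perm p) ∘ (split Δ Γ ∘ nest⇐ (Δ ++ Γ))               ≈⟨ assoc ⟨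
    ((id ⊗₁ perm p) ∘ split Δ Γ) ∘ nest⇐ (Δ ++ Γ)               ∎)

  ++-comm : ∀ Γ Δ → Σ[ q ∈ Γ ++ Δ ↭ Δ ++ Γ ] split Δ Γ ∘ perm q ≈ σ ∘ split Γ Δ
  ++-comm Γ Δ = let q , h = ++-commᴺ Γ Δ in q , nest⇐-epi (Γ ++ Δ) (begin
    (split Δ Γ ∘ perm q) ∘ nest⇐ (Γ ++ Δ)              ≈⟨ split-perm⇐ Δ Γ q ⟩
    (nest⇐ Δ ⊗₁ nest⇐ Γ) ∘ (splitᴺ Δ Γ ∘ permᴺ q)      ≈⟨ refl⟩∘⟨ h ⟩
    (nest⇐ Δ ⊗₁ nest⇐ Γ) ∘ (σ ∘ splitᴺ Γ Δ)            ≈⟨ exch (E.sym σ-nat) ⟩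
    σ ∘ ((nest⇐ Γ ⊗₁ nest⇐ Δ) ∘ splitᴺ Γ Δ)            ≈⟨ refl⟩∘⟨ split-nest⇐ Γ Δ ⟨
    σ ∘ (split Γ Δ ∘ nest⇐ (Γ ++ Δ))                   ≈⟨ assoc ⟨
    (σ ∘ split Γ Δ) ∘ nest⇐ (Γ ++ Δ)                   ∎)

  ++-assoc : ∀ Θ Δ Γ → Σ[ q ∈ (Θ ++ Δ) ++ Γ ↭ Θ ++ (Δ ++ Γ) ]
    (id ⊗₁ split Δ Γ) ∘ (split Θ (Δ ++ Γ) ∘ perm q) ≈
    α⇒ ∘ ((split Θ Δ ⊗₁ id) ∘ split (Θ ++ Δ) Γ)
  ++-assoc Θ Δ Γ = let q , h = ++-assocᴺ Θ Δ Γ in q , nest⇐-epi ((Θ ++ Δ) ++ Γ) (begin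
    ((id ⊗₁ split Δ Γ) ∘ (split Θ (Δ ++ Γ) ∘ perm q)) ∘ nest⇐ ((Θ ++ Δ) ++ Γ)
      ≈⟨ assoc ⟩
    (id ⊗₁ split Δ Γ) ∘ ((split Θ (Δ ++ Γ) ∘ perm q) ∘ nest⇐ ((Θ ++ Δ) ++ Γ))
      ≈⟨ refl⟩∘⟨ split-perm⇐ Θ (Δ ++ Γ) q ⟩
    (id ⊗₁ split Δ Γ) ∘ ((nest⇐ Θ ⊗₁ nest⇐ (Δ ++ Γ)) ∘ (splitᴺ Θ (Δ ++ Γ) ∘ permᴺ q))
      ≈⟨ exch (E.trans (E.sym ⊗-∘) (E.trans (⊗-cong (E.trans idˡ (E.sym idʳ)) (split-nest⇐ Δ Γ)) ⊗-∘)) ⟩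
    (nest⇐ Θ ⊗₁ (nest⇐ Δ ⊗₁ nest⇐ Γ)) ∘ ((id ⊗₁ splitᴺ Δ Γ) ∘ (splitᴺ Θ (Δ ++ Γ) ∘ permᴺ q))
      ≈⟨ refl⟩∘⟨ h ⟩
    (nest⇐ Θ ⊗₁ (nest⇐ Δ ⊗₁ nest⇐ Γ)) ∘ (α⇒ ∘ ((splitᴺ Θ Δ ⊗₁ id) ∘ splitᴺ (Θ ++ Δ) Γ))
      ≈⟨ exch (E.sym α-nat) ⟩
    α⇒ ∘ (((nest⇐ Θ ⊗₁ nest⇐ Δ) ⊗₁ nest⇐ Γ) ∘ ((splitᴺ Θ Δ ⊗₁ id) ∘ splitᴺ (Θ ++ Δ) Γ))
      ≈⟨ refl⟩∘⟨ exch (E.trans (E.sym ⊗-∘) (E.trans (⊗-cong (E.sym (split-nest⇐ Θ Δ)) (E.trans idʳ (E.sym idˡ))) ⊗-∘)) ⟩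
    α⇒ ∘ ((split Θ Δ ⊗₁ id) ∘ ((nest⇐ (Θ ++ Δ) ⊗₁ nest⇐ Γ) ∘ splitᴺ (Θ ++ Δ) Γ))
      ≈⟨ refl⟩∘⟨ refl⟩∘⟨ split-nest⇐ (Θ ++ Δ) Γ ⟨
    α⇒ ∘ ((split Θ Δ ⊗₁ id) ∘ (split (Θ ++ Δ) Γ ∘ nest⇐ ((Θ ++ Δ) ++ Γ)))
      ≈⟨ E.trans assoc (refl⟩∘⟨ assoc) ⟨
    (α⇒ ∘ ((split Θ Δ ⊗₁ id) ∘ split (Θ ++ Δ) Γ)) ∘ nest⇐ ((Θ ++ Δ) ++ Γ)
      ∎)

  perm-trans : ∀ {Γ Δ Θ} (p : Γ ↭ Δ) (q : Δ ↭ Θ) → perm (trans p q) ≈ perm q ∘ perm p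
  perm-trans {Γ} {Δ} {Θ} p q = nest⇐-epi Γ (begin
    perm (trans p q) ∘ nest⇐ Γ      ≈⟨ perm-nest⇐ (trans p q) ⟩
    nest⇐ Θ ∘ (permᴺ q ∘ permᴺ p)   ≈⟨ exch (E.sym (perm-nest⇐ q)) ⟩
    perm q ∘ (nest⇐ Δ ∘ permᴺ p)    ≈⟨ refl⟩∘⟨ perm-nest⇐ p ⟨
    perm q ∘ (perm p ∘ nest⇐ Γ)     ≈⟨ assoc ⟨
    (perm q ∘ perm p) ∘ nest⇐ Γ     ∎)

  ++-left : ∀ Γ {Δ Δ'} (p : Δ ↭ Δ') → Σ[ q ∈ Δ ++ Γ ↭ Δ' ++ Γ ]
    split Δ' Γ ∘ perm q ≈ (perm p ⊗₁ id) ∘ split Δ Γ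
  ++-left Γ {Δ} {Δ'} p =
    let c₁ , h₁ = ++-comm Δ Γ
        r , k = ++-right Γ p
        c₂ , h₂ = ++-comm Γ Δ'
    in trans c₁ (trans r c₂) , (begin
    split Δ' Γ ∘ perm (trans c₁ (trans r c₂))        ≈⟨ refl⟩∘⟨ E.trans (perm-trans c₁ (trans r c₂)) (perm-trans r c₂ ⟩∘⟨refl) ⟩
    split Δ' Γ ∘ ((perm c₂ ∘ perm r) ∘ perm c₁)      ≈⟨ refl⟩∘⟨ assoc ⟩
    split Δ' Γ ∘ (perm c₂ ∘ (perm r ∘ perm c₁))      ≈⟨ exch h₂ ⟩
    σ ∘ (split Γ Δ' ∘ (perm r ∘ perm c₁))            ≈⟨ refl⟩∘⟨ exch k ⟩
    σ ∘ ((id ⊗₁ perm p) ∘ (split Γ Δ ∘ perm c₁))     ≈⟨ refl⟩∘⟨ refl⟩∘⟨ h₁ ⟩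
    σ ∘ ((id ⊗₁ perm p) ∘ (σ ∘ split Δ Γ))           ≈⟨ exch σ-nat ⟩
    (perm p ⊗₁ id) ∘ (σ ∘ (σ ∘ split Δ Γ))           ≈⟨ refl⟩∘⟨ cancˡ σ-invol ⟩
    (perm p ⊗₁ id) ∘ split Δ Γ                       ∎)

module AdjoinSMCC {o ℓ e c : Level} (M : SMCC o ℓ e) {Op : Set c} (at : Op → SMCC.Obj M) where
  open SMCC M
  open SMCCLemmas M
  open Reasoning
  open Adjoin M at
  open AdjoinLaws M at

  ~-equiv : ∀ {U V} → IsEquivalence (_~_ {U} {V})
  ~-equiv = EqC.isEquivalence _↝_

  module P {U V : Obj} = IsEquivalence (~-equiv {U} {V})

  eq : ∀ {U V Γ} {φ ψ : ty Γ ⊗ U ⇒ V} → φ ≈ ψ → ⟨ Γ , φ ⟩ ~ ⟨ Γ , ψ ⟩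
  eq p = EqC.return (equal p)

  gen : ∀ {U V Γ Δ} (p : Γ ↭ Δ) {φ : ty Γ ⊗ U ⇒ V} {ψ : ty Δ ⊗ U ⇒ V} →
        φ ≈ ψ ∘ (perm p ⊗₁ id) → ⟨ Γ , φ ⟩ ~ ⟨ Δ , ψ ⟩
  gen p {ψ = ψ} h = P.trans (eq h) (P.sym (EqC.return (permute p ψ)))

  lift : ∀ {U V U' V'} (F : U ⇛ V → U' ⇛ V') →
         (∀ {Γ Δ} (p : Γ ↭ Δ) {φ : ty Γ ⊗ U ⇒ V} {ψ : ty Δ ⊗ U ⇒ V} →
           φ ≈ ψ ∘ (perm p ⊗₁ id) → F ⟨ Γ , φ ⟩ ~ F ⟨ Δ , ψ ⟩) →
         ∀ {f g} → f ~ g → F f ~ F g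
  lift F h = EqC.gfold ~-equiv F step
    where
      step : ∀ {f g} → f ↝ g → F f ~ F g
      step (permute p φ) = P.sym (h p E.refl)
      step (equal {Γ} p) = h refl (E.trans p (E.sym
        (E.trans (refl⟩∘⟨ E.trans (⊗ˡ (perm-refl {Γ})) ⊗-id) idʳ)))

  ⊚-congˡ : ∀ {U V W} (f : U ⇛ V) {g g' : V ⇛ W} → g ~ g' → g ⊚ f ~ g' ⊚ f
  ⊚-congˡ ⟨ Γ , φ ⟩ = lift (_⊚ ⟨ Γ , φ ⟩) λ {Δ} {Δ'} p {ψ} {ψ'} h →
    let q , k = ++-left Γ p in gen q (begin
    ψ ∘ ((id ⊗₁ φ) ∘ (α⇒ ∘ (split Δ Γ ⊗₁ id)))                       ≈⟨ pushˡ h ⟩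
    ψ' ∘ ((perm p ⊗₁ id) ∘ ((id ⊗₁ φ) ∘ (α⇒ ∘ (split Δ Γ ⊗₁ id))))   ≈⟨ refl⟩∘⟨ exch swp ⟩
    ψ' ∘ ((id ⊗₁ φ) ∘ ((perm p ⊗₁ id) ∘ (α⇒ ∘ (split Δ Γ ⊗₁ id))))   ≈⟨ refl⟩∘⟨ refl⟩∘⟨ exch (E.sym α-natˡ) ⟩
    ψ' ∘ ((id ⊗₁ φ) ∘ (α⇒ ∘ (((perm p ⊗₁ id) ⊗₁ id) ∘ (split Δ Γ ⊗₁ id))))
      ≈⟨ refl⟩∘⟨ refl⟩∘⟨ refl⟩∘⟨ E.trans (E.sym ∘⊗ˡ) (E.trans (⊗ˡ (E.sym k)) ∘⊗ˡ) ⟩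
    ψ' ∘ ((id ⊗₁ φ) ∘ (α⇒ ∘ ((split Δ' Γ ⊗₁ id) ∘ (perm q ⊗₁ id))))
      ≈⟨ E.trans assoc (refl⟩∘⟨ E.trans assoc (refl⟩∘⟨ assoc)) ⟨
    (ψ' ∘ ((id ⊗₁ φ) ∘ (α⇒ ∘ (split Δ' Γ ⊗₁ id)))) ∘ (perm q ⊗₁ id)  ∎)

  ⊚-congʳ : ∀ {U V W} (g : V ⇛ W) {f f' : U ⇛ V} → f ~ f' → g ⊚ f ~ g ⊚ f'
  ⊚-congʳ ⟨ Δ , ψ ⟩ = lift (⟨ Δ , ψ ⟩ ⊚_) λ {Γ} {Γ'} p {φ} {φ'} h →
    let q , k = ++-right Δ p in gen q (begin
    ψ ∘ ((id ⊗₁ φ) ∘ (α⇒ ∘ (split Δ Γ ⊗₁ id)))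
      ≈⟨ refl⟩∘⟨ pushˡ (E.trans (⊗ʳ h) ∘⊗ʳ) ⟩
    ψ ∘ ((id ⊗₁ φ') ∘ ((id ⊗₁ (perm p ⊗₁ id)) ∘ (α⇒ ∘ (split Δ Γ ⊗₁ id))))
      ≈⟨ refl⟩∘⟨ refl⟩∘⟨ exch (E.sym α-nat) ⟩
    ψ ∘ ((id ⊗₁ φ') ∘ (α⇒ ∘ (((id ⊗₁ perm p) ⊗₁ id) ∘ (split Δ Γ ⊗₁ id))))
      ≈⟨ refl⟩∘⟨ refl⟩∘⟨ refl⟩∘⟨ E.trans (E.sym ∘⊗ˡ) (E.trans (⊗ˡ (E.sym k)) ∘⊗ˡ) ⟩
    ψ ∘ ((id ⊗₁ φ') ∘ (α⇒ ∘ ((split Δ Γ' ⊗₁ id) ∘ (perm q ⊗₁ id))))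
      ≈⟨ E.trans assoc (refl⟩∘⟨ E.trans assoc (refl⟩∘⟨ assoc)) ⟨
    (ψ ∘ ((id ⊗₁ φ') ∘ (α⇒ ∘ (split Δ Γ' ⊗₁ id)))) ∘ (perm q ⊗₁ id)  ∎)

  ⊚-cong : ∀ {U V W} {g g' : V ⇛ W} {f f' : U ⇛ V} → g ~ g' → f ~ f' → g ⊚ f ~ g' ⊚ f'
  ⊚-cong {g' = g'} {f} p q = P.trans (⊚-congˡ f p) (⊚-congʳ g' q)

  ⊚-assoc : ∀ {U V W Y} {h : W ⇛ Y} {g : V ⇛ W} {f : U ⇛ V} → (h ⊚ g) ⊚ f ~ h ⊚ (g ⊚ f)
  ⊚-assoc {h = ⟨ Θ , χ ⟩} {⟨ Δ , ψ ⟩} {⟨ Γ , φ ⟩} = let q , k = ++-assoc Θ Δ Γ in gen q (begin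
    (χ ∘ ((id ⊗₁ ψ) ∘ (α⇒ ∘ (split Θ Δ ⊗₁ id)))) ∘ ((id ⊗₁ φ) ∘ (α⇒ ∘ (split (Θ ++ Δ) Γ ⊗₁ id)))
      ≈⟨ E.trans assoc (refl⟩∘⟨ E.trans assoc (refl⟩∘⟨ assoc)) ⟩
    χ ∘ ((id ⊗₁ ψ) ∘ (α⇒ ∘ ((split Θ Δ ⊗₁ id) ∘ ((id ⊗₁ φ) ∘ (α⇒ ∘ (split (Θ ++ Δ) Γ ⊗₁ id))))))
      ≈⟨ refl⟩∘⟨ refl⟩∘⟨ refl⟩∘⟨ exch swp ⟩
    χ ∘ ((id ⊗₁ ψ) ∘ (α⇒ ∘ ((id ⊗₁ φ) ∘ ((split Θ Δ ⊗₁ id) ∘ (α⇒ ∘ (split (Θ ++ Δ) Γ ⊗₁ id))))))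
      ≈⟨ refl⟩∘⟨ refl⟩∘⟨ exch α-natʳ ⟩
    χ ∘ ((id ⊗₁ ψ) ∘ ((id ⊗₁ (id ⊗₁ φ)) ∘ (α⇒ ∘ ((split Θ Δ ⊗₁ id) ∘ (α⇒ ∘ (split (Θ ++ Δ) Γ ⊗₁ id))))))
      ≈⟨ refl⟩∘⟨ refl⟩∘⟨ refl⟩∘⟨ rearrange q k ⟩
    χ ∘ ((id ⊗₁ ψ) ∘ ((id ⊗₁ (id ⊗₁ φ)) ∘ ((id ⊗₁ α⇒) ∘ ((id ⊗₁ (split Δ Γ ⊗₁ id))
      ∘ (α⇒ ∘ ((split Θ (Δ ++ Γ) ⊗₁ id) ∘ (perm q ⊗₁ id)))))))
      ≈⟨ refl⟩∘⟨ E.trans (E.trans ∘⊗ʳ (refl⟩∘⟨ ∘⊗ʳ₃) ⟩∘⟨refl)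
         (E.trans assoc (refl⟩∘⟨ E.trans assoc (refl⟩∘⟨ assoc))) ⟨
    χ ∘ ((id ⊗₁ (ψ ∘ ((id ⊗₁ φ) ∘ (α⇒ ∘ (split Δ Γ ⊗₁ id)))))
      ∘ (α⇒ ∘ ((split Θ (Δ ++ Γ) ⊗₁ id) ∘ (perm q ⊗₁ id))))
      ≈⟨ E.trans assoc (refl⟩∘⟨ E.trans assoc (refl⟩∘⟨ assoc)) ⟨
    (χ ∘ ((id ⊗₁ (ψ ∘ ((id ⊗₁ φ) ∘ (α⇒ ∘ (split Δ Γ ⊗₁ id)))))
      ∘ (α⇒ ∘ (split Θ (Δ ++ Γ) ⊗₁ id)))) ∘ (perm q ⊗₁ id)
      ∎)
    where
      rearrange : ∀ {A} (q : (Θ ++ Δ) ++ Γ ↭ Θ ++ (Δ ++ Γ)) →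
        (id ⊗₁ split Δ Γ) ∘ (split Θ (Δ ++ Γ) ∘ perm q) ≈
          α⇒ ∘ ((split Θ Δ ⊗₁ id) ∘ split (Θ ++ Δ) Γ) →
        α⇒ ∘ ((split Θ Δ ⊗₁ id) ∘ (α⇒ ∘ (split (Θ ++ Δ) Γ ⊗₁ id {A}))) ≈
        (id ⊗₁ α⇒) ∘ ((id ⊗₁ (split Δ Γ ⊗₁ id)) ∘ (α⇒ ∘ ((split Θ (Δ ++ Γ) ⊗₁ id) ∘ (perm q ⊗₁ id))))
      rearrange q k = begin
        α⇒ ∘ ((split Θ Δ ⊗₁ id) ∘ (α⇒ ∘ (split (Θ ++ Δ) Γ ⊗₁ id)))
          ≈⟨ refl⟩∘⟨ exch (E.sym α-natˡ) ⟩
        α⇒ ∘ (α⇒ ∘ (((split Θ Δ ⊗₁ id) ⊗₁ id) ∘ (split (Θ ++ Δ) Γ ⊗₁ id)))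
          ≈⟨ E.trans (pullˡ (E.sym pentagon)) (E.trans assoc (refl⟩∘⟨ assoc)) ⟩
        (id ⊗₁ α⇒) ∘ (α⇒ ∘ ((α⇒ ⊗₁ id) ∘ (((split Θ Δ ⊗₁ id) ⊗₁ id) ∘ (split (Θ ++ Δ) Γ ⊗₁ id))))
          ≈⟨ refl⟩∘⟨ refl⟩∘⟨ E.trans (E.sym ∘⊗ˡ₃) (E.trans (⊗ˡ (E.sym k)) ∘⊗ˡ₃) ⟩
        (id ⊗₁ α⇒) ∘ (α⇒ ∘ (((id ⊗₁ split Δ Γ) ⊗₁ id) ∘ ((split Θ (Δ ++ Γ) ⊗₁ id) ∘ (perm q ⊗₁ id))))
          ≈⟨ refl⟩∘⟨ exch α-nat ⟩
        (id ⊗₁ α⇒) ∘ ((id ⊗₁ (split Δ Γ ⊗₁ id)) ∘ (α⇒ ∘ ((split Θ (Δ ++ Γ) ⊗₁ id) ∘ (perm q ⊗₁ id))))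
          ∎

  J-⊚ˡ : ∀ {U V W} {h : V ⇒ W} {Γ} {φ : ty Γ ⊗ U ⇒ V} → J h ⊚ ⟨ Γ , φ ⟩ ~ ⟨ Γ , h ∘ φ ⟩
  J-⊚ˡ {h = h} {Γ} {φ} = eq (begin
    (h ∘ λ⇒) ∘ ((id ⊗₁ φ) ∘ (α⇒ ∘ (split [] Γ ⊗₁ id)))  ≈⟨ assoc ⟩
    h ∘ (λ⇒ ∘ ((id ⊗₁ φ) ∘ (α⇒ ∘ (split [] Γ ⊗₁ id))))  ≈⟨ refl⟩∘⟨ exch λ-nat ⟩
    h ∘ (φ ∘ (λ⇒ ∘ (α⇒ ∘ (split [] Γ ⊗₁ id))))          ≈⟨ refl⟩∘⟨ refl⟩∘⟨ refl⟩∘⟨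
                                                            E.trans (refl⟩∘⟨ ⊗ˡ (split-[] Γ)) α-λ⇐ ⟩
    h ∘ (φ ∘ (λ⇒ ∘ λ⇐))                                 ≈⟨ refl⟩∘⟨ E.trans (refl⟩∘⟨ λ-isoʳ) idʳ ⟩
    h ∘ φ                                               ∎)

  J-⊚ʳ : ∀ {U V W} {h : U ⇒ V} {Γ} {φ : ty Γ ⊗ V ⇒ W} → ⟨ Γ , φ ⟩ ⊚ J h ~ ⟨ Γ , φ ∘ (id ⊗₁ h) ⟩
  J-⊚ʳ {h = h} {Γ} {φ} = let q , k = ++-unit Γ in P.sym (gen q (begin
    φ ∘ (id ⊗₁ h)
      ≈⟨ refl⟩∘⟨ E.trans (refl⟩∘⟨ iso⊗ˡ ρ-isoʳ) idʳ ⟨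
    φ ∘ ((id ⊗₁ h) ∘ ((ρ⇒ ⊗₁ id) ∘ (ρ⇐ ⊗₁ id)))
      ≈⟨ refl⟩∘⟨ refl⟩∘⟨ E.trans (E.sym triangle ⟩∘⟨ E.trans (⊗ˡ (E.sym k)) ∘⊗ˡ) assoc ⟩
    φ ∘ ((id ⊗₁ h) ∘ ((id ⊗₁ λ⇒) ∘ (α⇒ ∘ ((split Γ [] ⊗₁ id) ∘ (perm q ⊗₁ id)))))
      ≈⟨ refl⟩∘⟨ pullˡ (E.sym ∘⊗ʳ) ⟩
    φ ∘ ((id ⊗₁ (h ∘ λ⇒)) ∘ (α⇒ ∘ ((split Γ [] ⊗₁ id) ∘ (perm q ⊗₁ id))))
      ≈⟨ E.trans assoc (refl⟩∘⟨ E.trans assoc (refl⟩∘⟨ assoc)) ⟨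
    (φ ∘ ((id ⊗₁ (h ∘ λ⇒)) ∘ (α⇒ ∘ (split Γ [] ⊗₁ id)))) ∘ (perm q ⊗₁ id)
      ∎))

  J-cong : ∀ {U V} {f g : U ⇒ V} → f ≈ g → J f ~ J g
  J-cong p = eq (p ⟩∘⟨refl)

  J-id : ∀ {U} → J (id {U}) ~ ι
  J-id = eq idˡ

  J-∘ : ∀ {U V W} {g : V ⇒ W} {f : U ⇒ V} → J g ⊚ J f ~ J (g ∘ f)
  J-∘ = P.trans J-⊚ˡ (eq (E.sym assoc))

  ⊚-idˡ : ∀ {U V} {f : U ⇛ V} → ι ⊚ f ~ f
  ⊚-idˡ {f = ⟨ Γ , φ ⟩} = P.trans (⊚-congˡ ⟨ Γ , φ ⟩ (P.sym J-id)) (P.trans J-⊚ˡ (eq idˡ))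

  ⊚-idʳ : ∀ {U V} {f : U ⇛ V} → f ⊚ ι ~ f
  ⊚-idʳ {f = ⟨ Γ , φ ⟩} = P.trans (⊚-congʳ ⟨ Γ , φ ⟩ (P.sym J-id))
    (P.trans J-⊚ʳ (eq (E.trans (refl⟩∘⟨ ⊗-id) idʳ)))

  hom~ : Obj → Obj → Setoid (c ⊔ ℓ) (c ⊔ ℓ ⊔ e)
  hom~ U V = record { isEquivalence = ~-equiv {U} {V} }

  module PR {U V : Obj} where
    open SetoidReasoning (hom~ U V) public

  Sq : ∀ {U V U' V'} → U ⇒ U' → V ⇒ V' → U ⇛ V → U' ⇛ V' → Set _
  Sq i j f g = J j ⊚ f ~ g ⊚ J i

  sq-h : ∀ {U V W U' V' W'} {i : U ⇒ U'} {j : V ⇒ V'} {k : W ⇒ W'}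
           {f : U ⇛ V} {f' : V ⇛ W} {g : U' ⇛ V'} {g' : V' ⇛ W'} →
         Sq j k f' g' → Sq i j f g → Sq i k (f' ⊚ f) (g' ⊚ g)
  sq-h p q = P.trans (P.sym ⊚-assoc) (P.trans (⊚-congˡ _ p) (P.trans ⊚-assoc
    (P.trans (⊚-congʳ _ q) (P.sym ⊚-assoc))))

  sq-v : ∀ {U V U' V' U″ V″} {i : U ⇒ U'} {j : V ⇒ V'} {i' : U' ⇒ U″} {j' : V' ⇒ V″}
           {f : U ⇛ V} {g : U' ⇛ V'} {h : U″ ⇛ V″} →
         Sq i j f g → Sq i' j' g h → Sq (i' ∘ i) (j' ∘ j) f h
  sq-v p q = P.trans (⊚-congˡ _ (P.sym J-∘)) (P.trans ⊚-assoc (P.trans (⊚-congʳ _ p)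
    (P.trans (P.sym ⊚-assoc) (P.trans (⊚-congˡ _ q) (P.trans ⊚-assoc (⊚-congʳ _ J-∘))))))

  sq-resp : ∀ {U V U' V'} {i i' : U ⇒ U'} {j j' : V ⇒ V'} {f f' : U ⇛ V} {g g' : U' ⇛ V'} →
            i ≈ i' → j ≈ j' → f ~ f' → g ~ g' → Sq i j f g → Sq i' j' f' g'
  sq-resp p q r s h = P.trans (⊚-cong (J-cong (E.sym q)) (P.sym r))
    (P.trans h (⊚-cong s (J-cong p)))

  J-isoʳ : ∀ {U V W} {i : U ⇒ V} {j : V ⇒ U} {f : V ⇛ W} → i ∘ j ≈ id → (f ⊚ J i) ⊚ J j ~ f
  J-isoʳ p = P.trans ⊚-assoc (P.trans (⊚-congʳ _ (P.trans J-∘ (P.trans (J-cong p) J-id))) ⊚-idʳ)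

  J-isoˡ : ∀ {U V W} {i : V ⇒ W} {j : W ⇒ V} {f : U ⇛ V} → j ∘ i ≈ id → J j ⊚ (J i ⊚ f) ~ f
  J-isoˡ p = P.trans (P.sym ⊚-assoc)
    (P.trans (⊚-congˡ _ (P.trans J-∘ (P.trans (J-cong p) J-id))) ⊚-idˡ)

  sq-inv : ∀ {U V U' V'} {i : U ⇒ U'} {j : V ⇒ V'} {i' : U' ⇒ U} {j' : V' ⇒ V}
             {f : U ⇛ V} {g : U' ⇛ V'} →
           i ∘ i' ≈ id → j' ∘ j ≈ id → Sq i j f g → Sq i' j' g f
  sq-inv a b p = P.trans (⊚-congʳ _ (P.sym (P.trans (⊚-congˡ _ p) (J-isoʳ a))))
    (P.trans (⊚-congʳ _ ⊚-assoc) (J-isoˡ b))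

  sq-unique : ∀ {U V U' V'} {i : U ⇒ U'} {j : V ⇒ V'} {i' : U' ⇒ U}
                {f f' : U ⇛ V} {g g' : U' ⇛ V'} →
              i ∘ i' ≈ id → f ~ f' → Sq i j f g → Sq i j f' g' → g ~ g'
  sq-unique a r p q = P.trans (P.sym (J-isoʳ a)) (P.trans (⊚-congˡ _
    (P.trans (P.sym p) (P.trans (⊚-congʳ _ r) q))) (J-isoʳ a))

  sq-J : ∀ {U V U' V'} {i : U ⇒ U'} {j : V ⇒ V'} {h : U ⇒ V} {k : U' ⇒ V'} →
         j ∘ h ≈ k ∘ i → Sq i j (J h) (J k)
  sq-J p = P.trans J-∘ (P.trans (J-cong p) (P.sym J-∘))

  sq-body : ∀ {Γ U V U' V'} {i : U ⇒ U'} {j : V ⇒ V'}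
              {φ : ty Γ ⊗ U ⇒ V} {ψ : ty Γ ⊗ U' ⇒ V'} →
            j ∘ φ ≈ ψ ∘ (id ⊗₁ i) → Sq i j ⟨ Γ , φ ⟩ ⟨ Γ , ψ ⟩
  sq-body p = P.trans J-⊚ˡ (P.trans (eq p) (P.sym J-⊚ʳ))

  L : ∀ W {U V} → U ⇛ V → U ⊗ W ⇛ V ⊗ W
  L W ⟨ Γ , φ ⟩ = ⟨ Γ , (φ ⊗₁ id) ∘ α⇐ ⟩

  R : ∀ W {U V} → U ⇛ V → W ⊗ U ⇛ W ⊗ V
  R W ⟨ Γ , φ ⟩ = ⟨ Γ , (id ⊗₁ φ) ∘ σₗ ⟩

  L-cong : ∀ {W U V} {f g : U ⇛ V} → f ~ g → L W f ~ L W g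
  L-cong {W} = lift (L W) λ p {φ} {ψ} h → gen p (begin
    (φ ⊗₁ id) ∘ α⇐                                 ≈⟨ E.trans (⊗ˡ h) ∘⊗ˡ ⟩∘⟨refl ⟩
    ((ψ ⊗₁ id) ∘ ((perm p ⊗₁ id) ⊗₁ id)) ∘ α⇐      ≈⟨ assoc ⟩
    (ψ ⊗₁ id) ∘ (((perm p ⊗₁ id) ⊗₁ id) ∘ α⇐)      ≈⟨ refl⟩∘⟨ α⇐-natˡ ⟨
    (ψ ⊗₁ id) ∘ (α⇐ ∘ (perm p ⊗₁ id))              ≈⟨ assoc ⟨
    ((ψ ⊗₁ id) ∘ α⇐) ∘ (perm p ⊗₁ id)              ∎)

  L-J : ∀ {W U V} {h : U ⇒ V} → L W (J h) ~ J (h ⊗₁ id)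
  L-J = eq (E.trans (∘⊗ˡ ⟩∘⟨refl) (E.trans assoc (refl⟩∘⟨ λ⇒-α⇐)))

  L-⊚ : ∀ {W U V Y} {g : V ⇛ Y} {f : U ⇛ V} → L W (g ⊚ f) ~ L W g ⊚ L W f
  L-⊚ {g = ⟨ Δ , ψ ⟩} {⟨ Γ , φ ⟩} = eq (begin
    ((ψ ∘ ((id ⊗₁ φ) ∘ (α⇒ ∘ (split Δ Γ ⊗₁ id)))) ⊗₁ id) ∘ α⇐
      ≈⟨ E.trans (E.trans ∘⊗ˡ (refl⟩∘⟨ ∘⊗ˡ₃) ⟩∘⟨refl)
         (E.trans assoc (refl⟩∘⟨ E.trans assoc (refl⟩∘⟨ assoc))) ⟩
    (ψ ⊗₁ id) ∘ (((id ⊗₁ φ) ⊗₁ id) ∘ ((α⇒ ⊗₁ id) ∘ (((split Δ Γ ⊗₁ id) ⊗₁ id) ∘ α⇐)))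
      ≈⟨ refl⟩∘⟨ refl⟩∘⟨ refl⟩∘⟨ α⇐-natˡ ⟨
    (ψ ⊗₁ id) ∘ (((id ⊗₁ φ) ⊗₁ id) ∘ ((α⇒ ⊗₁ id) ∘ (α⇐ ∘ (split Δ Γ ⊗₁ id))))
      ≈⟨ refl⟩∘⟨ refl⟩∘⟨ E.trans (pullˡ penta₁) (E.trans assoc (refl⟩∘⟨ assoc)) ⟩
    (ψ ⊗₁ id) ∘ (((id ⊗₁ φ) ⊗₁ id) ∘ (α⇐ ∘ ((id ⊗₁ α⇐) ∘ (α⇒ ∘ (split Δ Γ ⊗₁ id)))))
      ≈⟨ refl⟩∘⟨ exch (E.sym α⇐-nat) ⟩
    (ψ ⊗₁ id) ∘ (α⇐ ∘ ((id ⊗₁ (φ ⊗₁ id)) ∘ ((id ⊗₁ α⇐) ∘ (α⇒ ∘ (split Δ Γ ⊗₁ id)))))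
      ≈⟨ refl⟩∘⟨ refl⟩∘⟨ pullˡ (E.sym ∘⊗ʳ) ⟩
    (ψ ⊗₁ id) ∘ (α⇐ ∘ ((id ⊗₁ ((φ ⊗₁ id) ∘ α⇐)) ∘ (α⇒ ∘ (split Δ Γ ⊗₁ id))))
      ≈⟨ assoc ⟨
    ((ψ ⊗₁ id) ∘ α⇐) ∘ ((id ⊗₁ ((φ ⊗₁ id) ∘ α⇐)) ∘ (α⇒ ∘ (split Δ Γ ⊗₁ id)))
      ∎)

  L-sq : ∀ {W U V U' V'} {i : U ⇒ U'} {j : V ⇒ V'} {f : U ⇛ V} {g : U' ⇛ V'} →
         Sq i j f g → Sq (i ⊗₁ id) (j ⊗₁ id) (L W f) (L W g)
  L-sq p = P.trans (⊚-congˡ _ (P.sym L-J)) (P.trans (P.sym L-⊚) (P.trans (L-cong p)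
    (P.trans L-⊚ (⊚-congʳ _ L-J))))

  L-nat : ∀ {W W' U V} {h : W ⇒ W'} {f : U ⇛ V} → Sq (id ⊗₁ h) (id ⊗₁ h) (L W f) (L W' f)
  L-nat {f = ⟨ Γ , φ ⟩} = sq-body (E.trans (exch (E.sym swp))
    (E.trans (refl⟩∘⟨ E.trans (⊗-cong (E.sym ⊗-id) E.refl ⟩∘⟨refl) (E.sym α⇐-nat)) (E.sym assoc)))

  L-α : ∀ {W Y U V} {f : U ⇛ V} → Sq α⇒ α⇒ (L Y (L W f)) (L (W ⊗ Y) f)
  L-α {f = ⟨ Γ , φ ⟩} = sq-body (begin
    α⇒ ∘ ((((φ ⊗₁ id) ∘ α⇐) ⊗₁ id) ∘ α⇐)          ≈⟨ refl⟩∘⟨ E.trans (∘⊗ˡ ⟩∘⟨refl) assoc ⟩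
    α⇒ ∘ (((φ ⊗₁ id) ⊗₁ id) ∘ ((α⇐ ⊗₁ id) ∘ α⇐))  ≈⟨ exch α-natˡ ⟩
    (φ ⊗₁ id) ∘ (α⇒ ∘ ((α⇐ ⊗₁ id) ∘ α⇐))          ≈⟨ refl⟩∘⟨ penta₃ ⟩
    (φ ⊗₁ id) ∘ (α⇐ ∘ (id ⊗₁ α⇒))                 ≈⟨ assoc ⟨
    ((φ ⊗₁ id) ∘ α⇐) ∘ (id ⊗₁ α⇒)                 ∎)

  L-ρ : ∀ {U V} {f : U ⇛ V} → Sq ρ⇒ ρ⇒ (L I f) f
  L-ρ {f = ⟨ Γ , φ ⟩} = sq-body (E.trans (exch ρ-nat) (refl⟩∘⟨ ρ-α⇐))

  L-R : ∀ {W U V} {f : U ⇛ V} → Sq σ σ (L W f) (R W f)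
  L-R {f = ⟨ Γ , φ ⟩} = sq-body (begin
    σ ∘ ((φ ⊗₁ id) ∘ α⇐)              ≈⟨ exch σ-nat ⟩
    (id ⊗₁ φ) ∘ (σ ∘ α⇐)              ≈⟨ refl⟩∘⟨ hexagon₂ ⟩
    (id ⊗₁ φ) ∘ (σₗ ∘ (id ⊗₁ σ))      ≈⟨ assoc ⟨
    ((id ⊗₁ φ) ∘ σₗ) ∘ (id ⊗₁ σ)      ∎)

  R-L : ∀ {W U V} {f : U ⇛ V} → Sq σ σ (R W f) (L W f)
  R-L = sq-inv σ-invol σ-invol L-R

  R-cong : ∀ {W U V} {f g : U ⇛ V} → f ~ g → R W f ~ R W g
  R-cong p = sq-unique σ-invol (L-cong p) L-R L-R

  R-J : ∀ {W U V} {h : U ⇒ V} → R W (J h) ~ J (id ⊗₁ h)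
  R-J = sq-unique σ-invol L-J L-R (sq-J σ-nat)

  R-⊚ : ∀ {W U V Y} {g : V ⇛ Y} {f : U ⇛ V} → R W (g ⊚ f) ~ R W g ⊚ R W f
  R-⊚ = sq-unique σ-invol L-⊚ L-R (sq-h L-R L-R)

  L-R-α : ∀ {A C U V} {g : U ⇛ V} → Sq α⇒ α⇒ (L C (R A g)) (R A (L C g))
  L-R-α = sq-resp coh coh P.refl P.refl
    (sq-v (sq-v (sq-v (sq-v (L-sq R-L) L-α) L-nat) (sq-inv α-isoʳ α-isoˡ L-α)) L-R)
    where
      coh : ∀ {A B C} → σ ∘ (α⇐ ∘ ((id ⊗₁ σ) ∘ (α⇒ ∘ (σ {A} {B} ⊗₁ id {C})))) ≈ α⇒
      coh = E.trans (E.trans (refl⟩∘⟨ E.sym assoc) (E.sym assoc))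
        (E.trans (σₗ-via-σ ⟩∘⟨refl) σₗ-α)

  R-R-α : ∀ {A B U V} {h : U ⇛ V} → Sq α⇒ α⇒ (R (A ⊗ B) h) (R A (R B h))
  R-R-α = sq-resp coh coh P.refl P.refl
    (sq-v (sq-v (sq-v (sq-v R-L L-nat) (sq-inv α-isoʳ α-isoˡ L-α)) (L-sq L-R)) L-R)
    where
      coh : ∀ {A B C} → σ ∘ ((σ ⊗₁ id) ∘ (α⇐ ∘ ((id ⊗₁ σ) ∘ σ {A ⊗ B} {C}))) ≈ α⇒
      coh = begin
        σ ∘ ((σ ⊗₁ id) ∘ (α⇐ ∘ ((id ⊗₁ σ) ∘ σ)))  ≈⟨ exch σ-nat ⟩
        (id ⊗₁ σ) ∘ (σ ∘ (α⇐ ∘ ((id ⊗₁ σ) ∘ σ)))  ≈⟨ refl⟩∘⟨ E.trans (refl⟩∘⟨ E.sym assoc) (pullˡ σₗ-via-σ) ⟩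
        (id ⊗₁ σ) ∘ (σₗ ∘ σ)                      ≈⟨ pullˡ (E.sym hexagon₁) ⟩
        (α⇒ ∘ σ) ∘ σ                              ≈⟨ E.trans assoc (E.trans (refl⟩∘⟨ σ-invol) idʳ) ⟩
        α⇒                                        ∎
  ⊠-LR : ∀ {U U' V V'} (f : U ⇛ V) (g : U' ⇛ V') → f ⊠ g ~ L V' f ⊚ R U g
  ⊠-LR ⟨ Γ , φ ⟩ ⟨ Γ' , φ' ⟩ = eq (E.sym (LR-body (split Γ Γ')))
    where
      LR-body : ∀ {A} (s : A ⇒ ty Γ ⊗ ty Γ') →
        ((φ ⊗₁ id) ∘ α⇐) ∘ ((id ⊗₁ ((id ⊗₁ φ') ∘ σₗ)) ∘ (α⇒ ∘ (s ⊗₁ id))) ≈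
        (φ ⊗₁ φ') ∘ (middle ∘ (s ⊗₁ id))
      LR-body s = begin
        ((φ ⊗₁ id) ∘ α⇐) ∘ ((id ⊗₁ ((id ⊗₁ φ') ∘ σₗ)) ∘ (α⇒ ∘ (s ⊗₁ id)))
          ≈⟨ E.trans assoc (refl⟩∘⟨ refl⟩∘⟨ pushˡ ∘⊗ʳ) ⟩
        (φ ⊗₁ id) ∘ (α⇐ ∘ ((id ⊗₁ (id ⊗₁ φ')) ∘ ((id ⊗₁ σₗ) ∘ (α⇒ ∘ (s ⊗₁ id)))))
          ≈⟨ refl⟩∘⟨ exch α⇐-natʳ ⟩
        (φ ⊗₁ id) ∘ ((id ⊗₁ φ') ∘ (α⇐ ∘ ((id ⊗₁ σₗ) ∘ (α⇒ ∘ (s ⊗₁ id)))))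
          ≈⟨ pullˡ ser₁ ⟩
        (φ ⊗₁ φ') ∘ (α⇐ ∘ ((id ⊗₁ σₗ) ∘ (α⇒ ∘ (s ⊗₁ id))))
          ≈⟨ refl⟩∘⟨ E.trans assoc (refl⟩∘⟨ assoc) ⟨
        (φ ⊗₁ φ') ∘ (middle ∘ (s ⊗₁ id))
          ∎

  ⊠-RL : ∀ {U U' V V'} (f : U ⇛ V) (g : U' ⇛ V') → f ⊠ g ~ R V g ⊚ L U' f
  ⊠-RL ⟨ Γ , φ ⟩ ⟨ Γ' , φ' ⟩ = let q , k = ++-comm Γ Γ' in gen q (E.sym (begin
    (((id ⊗₁ φ') ∘ σₗ) ∘ ((id ⊗₁ ((φ ⊗₁ id) ∘ α⇐)) ∘ (α⇒ ∘ (split Γ' Γ ⊗₁ id)))) ∘ (perm q ⊗₁ id)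
      ≈⟨ E.trans (assoc ⟩∘⟨refl) (E.trans assoc (refl⟩∘⟨ E.trans assoc
         (refl⟩∘⟨ E.trans assoc (refl⟩∘⟨ E.trans assoc (refl⟩∘⟨
           E.trans (E.sym ∘⊗ˡ) (E.trans (⊗ˡ k) ∘⊗ˡ)))))) ⟩
    (id ⊗₁ φ') ∘ (σₗ ∘ ((id ⊗₁ ((φ ⊗₁ id) ∘ α⇐)) ∘ (α⇒ ∘ ((σ ⊗₁ id) ∘ (split Γ Γ' ⊗₁ id)))))
      ≈⟨ refl⟩∘⟨ refl⟩∘⟨ pushˡ ∘⊗ʳ ⟩
    (id ⊗₁ φ') ∘ (σₗ ∘ ((id ⊗₁ (φ ⊗₁ id)) ∘ ((id ⊗₁ α⇐) ∘ (α⇒ ∘ ((σ ⊗₁ id) ∘ (split Γ Γ' ⊗₁ id))))))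
      ≈⟨ refl⟩∘⟨ exch (E.trans σₗ-nat (⊗-cong E.refl ⊗-id ⟩∘⟨refl)) ⟩
    (id ⊗₁ φ') ∘ ((φ ⊗₁ id) ∘ (σₗ ∘ ((id ⊗₁ α⇐) ∘ (α⇒ ∘ ((σ ⊗₁ id) ∘ (split Γ Γ' ⊗₁ id))))))
      ≈⟨ pullˡ ser₂ ⟩
    (φ ⊗₁ φ') ∘ (σₗ ∘ ((id ⊗₁ α⇐) ∘ (α⇒ ∘ ((σ ⊗₁ id) ∘ (split Γ Γ' ⊗₁ id)))))
      ≈⟨ refl⟩∘⟨ E.trans (pullˡ σₗ-α⇐) (E.trans assoc (refl⟩∘⟨ assoc)) ⟩
    (φ ⊗₁ φ') ∘ (α⇐ ∘ ((id ⊗₁ σₗ) ∘ (σₗ ∘ (α⇒ ∘ ((σ ⊗₁ id) ∘ (split Γ Γ' ⊗₁ id))))))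
      ≈⟨ refl⟩∘⟨ refl⟩∘⟨ refl⟩∘⟨ E.trans (refl⟩∘⟨ E.sym assoc) (pullˡ σₗ-α) ⟩
    (φ ⊗₁ φ') ∘ (α⇐ ∘ ((id ⊗₁ σₗ) ∘ (α⇒ ∘ (split Γ Γ' ⊗₁ id))))
      ≈⟨ refl⟩∘⟨ E.trans assoc (refl⟩∘⟨ assoc) ⟨
    (φ ⊗₁ φ') ∘ (middle ∘ (split Γ Γ' ⊗₁ id))
      ∎))

  ⊠-cong : ∀ {U U' V V'} {f f' : U ⇛ V} {g g' : U' ⇛ V'} → f ~ f' → g ~ g' → f ⊠ g ~ f' ⊠ g'
  ⊠-cong p q = P.trans (⊠-LR _ _) (P.trans (⊚-cong (L-cong p) (R-cong q)) (P.sym (⊠-LR _ _)))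

  J-⊠ : ∀ {U U' V V'} {f : U ⇒ V} {g : U' ⇒ V'} → J f ⊠ J g ~ J (f ⊗₁ g)
  J-⊠ {f = f} {g} = P.trans (⊠-LR (J f) (J g))
    (P.trans (⊚-cong {g' = J (f ⊗₁ id)} {f' = J (id ⊗₁ g)} L-J R-J) (P.trans J-∘ (J-cong ser₁)))

  ⊠-id : ∀ {U V} → ι {U} ⊠ ι {V} ~ ι
  ⊠-id = P.trans (⊠-cong {f = ι} {J id} {ι} {J id} (P.sym J-id) (P.sym J-id))
    (P.trans J-⊠ (P.trans (J-cong ⊗-id) J-id))

  ⊠-⊚ : ∀ {U U' V V' W W'} {f : V ⇛ W} {g : U ⇛ V} {h : V' ⇛ W'} {k : U' ⇛ V'} →
        (f ⊚ g) ⊠ (h ⊚ k) ~ (f ⊠ h) ⊚ (g ⊠ k)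
  ⊠-⊚ {f = f} {g} {h} {k} = PR.begin
    (f ⊚ g) ⊠ (h ⊚ k)                      PR.≈⟨ ⊠-LR _ _ ⟩
    L _ (f ⊚ g) ⊚ R _ (h ⊚ k)              PR.≈⟨ ⊚-cong L-⊚ R-⊚ ⟩
    (L _ f ⊚ L _ g) ⊚ (R _ h ⊚ R _ k)      PR.≈⟨ P.trans ⊚-assoc (⊚-congʳ _ (P.sym ⊚-assoc)) ⟩
    L _ f ⊚ ((L _ g ⊚ R _ h) ⊚ R _ k)      PR.≈⟨ ⊚-congʳ _ (⊚-congˡ _ (P.trans (P.sym (⊠-LR g h)) (⊠-RL g h))) ⟩
    L _ f ⊚ ((R _ h ⊚ L _ g) ⊚ R _ k)      PR.≈⟨ P.trans ⊚-assoc (⊚-congʳ _ (P.sym ⊚-assoc)) ⟨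
    (L _ f ⊚ R _ h) ⊚ (L _ g ⊚ R _ k)      PR.≈⟨ ⊚-cong (⊠-LR f h) (⊠-LR g k) ⟨
    (f ⊠ h) ⊚ (g ⊠ k)                      PR.∎

  ⊠ι : ∀ {U V W} (f : U ⇛ V) → f ⊠ ι {W} ~ L W f
  ⊠ι f = P.trans (⊠-LR _ _) (P.trans (⊚-congʳ _ (P.trans (R-cong (P.sym J-id))
    (P.trans R-J (P.trans (J-cong ⊗-id) J-id)))) ⊚-idʳ)

  ι⊠ : ∀ {U V W} (f : U ⇛ V) → ι {W} ⊠ f ~ R W f
  ι⊠ f = P.trans (⊠-RL _ _) (P.trans (⊚-congʳ _ (P.trans (L-cong (P.sym J-id))
    (P.trans L-J (P.trans (J-cong ⊗-id) J-id)))) ⊚-idʳ)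

  ι⊠J : ∀ {U V W} {f : U ⇒ V} → ι {W} ⊠ J f ~ J (id ⊗₁ f)
  ι⊠J = P.trans (ι⊠ _) R-J

  J⊠ι : ∀ {U V W} {f : U ⇒ V} → J f ⊠ ι {W} ~ J (f ⊗₁ id)
  J⊠ι = P.trans (⊠ι _) L-J

  J-iso : ∀ {U V} {f : V ⇒ U} {g : U ⇒ V} → f ∘ g ≈ id → J f ⊚ J g ~ ι
  J-iso p = P.trans J-∘ (P.trans (J-cong p) J-id)

  λ-natᴾ : ∀ {U V} {f : U ⇛ V} → J λ⇒ ⊚ (ι ⊠ f) ~ f ⊚ J λ⇒
  λ-natᴾ = sq-resp ρ-σ ρ-σ (P.sym (ι⊠ _)) P.refl (sq-v R-L L-ρ)

  ρ-natᴾ : ∀ {U V} {f : U ⇛ V} → J ρ⇒ ⊚ (f ⊠ ι) ~ f ⊚ J ρ⇒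
  ρ-natᴾ = P.trans (⊚-congʳ _ (⊠ι _)) L-ρ

  σ-natᴾ : ∀ {U U' V V'} {f : U ⇛ V} {g : U' ⇛ V'} → J σ ⊚ (f ⊠ g) ~ (g ⊠ f) ⊚ J σ
  σ-natᴾ {f = f} {g} =
    sq-resp E.refl E.refl (P.sym (⊠-LR f g)) (P.sym (⊠-RL g f)) (sq-h L-R R-L)

  α-natᴾ : ∀ {U U' V V' W W'} {f : U ⇛ U'} {g : V ⇛ V'} {h : W ⇛ W'} →
           J α⇒ ⊚ ((f ⊠ g) ⊠ h) ~ (f ⊠ (g ⊠ h)) ⊚ J α⇒
  α-natᴾ {f = f} {g} {h} = sq-resp E.refl E.refl (P.sym lhs) (P.sym rhs)
    (sq-h (sq-h L-α L-R-α) R-R-α)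
    where
      lhs : (f ⊠ g) ⊠ h ~ (L _ (L _ f) ⊚ L _ (R _ g)) ⊚ R _ h
      lhs = P.trans (⊠-LR _ _) (⊚-congˡ _ (P.trans (L-cong (⊠-LR f g)) L-⊚))

      rhs : f ⊠ (g ⊠ h) ~ (L _ f ⊚ R _ (L _ g)) ⊚ R _ (R _ h)
      rhs = P.trans (⊠-LR _ _) (P.trans (⊚-congʳ _ (P.trans (R-cong (⊠-LR g h)) R-⊚))
        (P.sym ⊚-assoc))

  triangleᴾ : ∀ {U V} → (ι ⊠ J λ⇒) ⊚ J α⇒ ~ J (ρ⇒ {U}) ⊠ ι {V}
  triangleᴾ = P.trans (⊚-congˡ _ ι⊠J) (P.trans J-∘ (P.trans (J-cong triangle) (P.sym J⊠ι)))

  pentagonᴾ : ∀ {A B C D} →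
    (ι {A} ⊠ J (α⇒ {B} {C} {D})) ⊚ (J α⇒ ⊚ (J α⇒ ⊠ ι)) ~ J α⇒ ⊚ J α⇒
  pentagonᴾ = P.trans (⊚-cong ι⊠J (P.trans (⊚-congʳ _ J⊠ι) J-∘))
    (P.trans J-∘ (P.trans (J-cong pentagon) (P.sym J-∘)))

  hexagonᴾ : ∀ {A B C} →
    (ι {B} ⊠ J (σ {A} {C})) ⊚ (J α⇒ ⊚ (J σ ⊠ ι)) ~ J α⇒ ⊚ (J σ ⊚ J α⇒)
  hexagonᴾ = P.trans (⊚-cong ι⊠J (P.trans (⊚-congʳ _ J⊠ι) J-∘))
    (P.trans J-∘ (P.trans (J-cong hexagon) (P.sym (P.trans (⊚-congʳ _ J-∘) J-∘))))

  Λ-cong : ∀ {U V W} {f g : U ⊗ V ⇛ W} → f ~ g → Λ f ~ Λ g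
  Λ-cong = lift Λ λ p {φ} {ψ} h → gen p (E.trans (curry-cong (begin
    φ ∘ α⇒                              ≈⟨ pushˡ h ⟩
    ψ ∘ ((perm p ⊗₁ id) ∘ α⇒)           ≈⟨ refl⟩∘⟨ α-natˡ ⟨
    ψ ∘ (α⇒ ∘ ((perm p ⊗₁ id) ⊗₁ id))   ≈⟨ assoc ⟨
    (ψ ∘ α⇒) ∘ ((perm p ⊗₁ id) ⊗₁ id)   ∎)) (E.sym curry-∘))

  Λ-β : ∀ {U V W} {f : U ⊗ V ⇛ W} → J ε ⊚ (Λ f ⊠ ι) ~ f
  Λ-β {f = ⟨ Γ , φ ⟩} = P.trans (⊚-congʳ _ (⊠ι (Λ ⟨ Γ , φ ⟩))) (P.trans J-⊚ˡ (eq
    (E.trans (pullˡ curry-β) (E.trans assoc (E.trans (refl⟩∘⟨ α-isoʳ) idʳ)))))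

  Λ-η : ∀ {U V W} {g : U ⇛ V ⊸ W} → Λ (J ε ⊚ (g ⊠ ι)) ~ g
  Λ-η {g = ⟨ Γ , γ ⟩} = P.trans (Λ-cong (P.trans (⊚-congʳ _ (⊠ι ⟨ Γ , γ ⟩)) J-⊚ˡ)) (eq (E.trans
    (curry-cong (E.trans assoc (refl⟩∘⟨ E.trans assoc (E.trans (refl⟩∘⟨ α-isoˡ) idʳ))))
    curry-η))

  Λ-⊚ : ∀ {U U' V W} {f : U ⊗ V ⇛ W} {g : U' ⇛ U} → Λ f ⊚ g ~ Λ (f ⊚ (g ⊠ ι))
  Λ-⊚ {f = f} {g} = P.trans (P.sym Λ-η) (Λ-cong (P.trans
    (⊚-congʳ _ (P.trans (⊠-cong P.refl (P.sym ⊚-idˡ)) ⊠-⊚))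
    (P.trans (P.sym ⊚-assoc) (⊚-congˡ _ Λ-β))))

  Λ-id : ∀ {U V} → Λ (ι {U ⊗ V}) ~ J η
  Λ-id = eq (E.trans (curry-cong (E.trans λ-α (E.sym idˡ)))
    (E.trans (E.sym curry-∘) (curry-id ⟩∘⟨refl)))

  ⊠-swp : ∀ {U U' V V'} {f : U ⇛ V} {g : U' ⇛ V'} → (ι ⊠ g) ⊚ (f ⊠ ι) ~ (f ⊠ ι) ⊚ (ι ⊠ g)
  ⊠-swp = P.trans (P.sym ⊠-⊚) (P.trans (⊠-cong (P.trans ⊚-idˡ (P.sym ⊚-idʳ))
    (P.trans ⊚-idʳ (P.sym ⊚-idˡ))) ⊠-⊚)

  ⊸-Λ : ∀ {U V V' W W'} {h : V' ⇛ V} {k : W ⇛ W'} {f : U ⊗ V ⇛ W} →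
        (h ⊸⇛ k) ⊚ Λ f ~ Λ (k ⊚ (f ⊚ (ι ⊠ h)))
  ⊸-Λ = P.trans Λ-⊚ (Λ-cong (P.trans ⊚-assoc (⊚-congʳ _ (P.trans ⊚-assoc
    (P.trans (⊚-congʳ _ ⊠-swp) (P.trans (P.sym ⊚-assoc) (⊚-congˡ _ Λ-β)))))))

  ⊸-congᴾ : ∀ {A A' B B'} {f f' : A' ⇛ A} {g g' : B ⇛ B'} → f ~ f' → g ~ g' → f ⊸⇛ g ~ f' ⊸⇛ g'
  ⊸-congᴾ p q = Λ-cong (⊚-cong q (⊚-congʳ _ (⊠-cong P.refl p)))

  ⊸-idᴾ : ∀ {A B} → ι {A} ⊸⇛ ι {B} ~ ι
  ⊸-idᴾ = P.trans (Λ-cong ⊚-idˡ) Λ-η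

  ⊸-⊚ᴾ : ∀ {A A' A″ B B' B″} {f : A″ ⇛ A'} {g : A' ⇛ A} {h : B' ⇛ B″} {k : B ⇛ B'} →
         (g ⊚ f) ⊸⇛ (h ⊚ k) ~ (f ⊸⇛ h) ⊚ (g ⊸⇛ k)
  ⊸-⊚ᴾ = P.sym (P.trans ⊸-Λ (Λ-cong (P.trans (⊚-congʳ _ (P.trans ⊚-assoc (⊚-congʳ _ ⊚-assoc)))
    (P.trans (P.sym ⊚-assoc) (⊚-congʳ _ (⊚-congʳ _
      (P.trans (P.sym ⊠-⊚) (⊠-cong ⊚-idˡ P.refl))))))))

  ⊸-η : ∀ {U V V' W} {h : V' ⇛ V} {k : U ⊗ V ⇛ W} → (h ⊸⇛ k) ⊚ J η ~ Λ (k ⊚ (ι ⊠ h))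
  ⊸-η = P.trans (⊚-congʳ _ (P.sym Λ-id)) (P.trans ⊸-Λ (Λ-cong (⊚-congʳ _ ⊚-idˡ)))

  η-natᴾ : ∀ {A A' B} {f : A ⇛ A'} → (ι {B} ⊸⇛ (f ⊠ ι)) ⊚ J η ~ J η ⊚ f
  η-natᴾ = P.trans ⊸-η (P.trans (Λ-cong (P.trans (⊚-congʳ _ ⊠-id) (P.trans ⊚-idʳ (P.sym ⊚-idˡ))))
    (P.trans (P.sym Λ-⊚) (⊚-congˡ _ Λ-id)))

  η-dinatᴾ : ∀ {A B B'} {g : B ⇛ B'} → (ι ⊸⇛ (ι {A} ⊠ g)) ⊚ J η ~ (g ⊸⇛ ι) ⊚ J η
  η-dinatᴾ = P.trans ⊸-η (P.trans (Λ-cong (P.trans (⊚-congʳ _ ⊠-id) (P.trans ⊚-idʳ (P.sym ⊚-idˡ))))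
    (P.sym ⊸-η))

  ε-natᴾ : ∀ {A B B'} {f : B ⇛ B'} → J ε ⊚ ((ι {A} ⊸⇛ f) ⊠ ι) ~ f ⊚ J ε
  ε-natᴾ = P.trans Λ-β (⊚-congʳ _ (P.trans (⊚-congʳ _ ⊠-id) ⊚-idʳ))

  ε-dinatᴾ : ∀ {A A' B} {g : A' ⇛ A} → J ε ⊚ ((g ⊸⇛ ι {B}) ⊠ ι) ~ J ε ⊚ (ι ⊠ g)
  ε-dinatᴾ = P.trans Λ-β ⊚-idˡ

  zigᴾ : ∀ {A B} → J ε ⊚ (J η ⊠ ι) ~ ι {A ⊗ B}
  zigᴾ = P.trans (⊚-congʳ (J ε) (⊠-cong {f = J η} {Λ ι} {ι} {ι} (P.sym Λ-id) P.refl)) (Λ-β {f = ι})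

  zagᴾ : ∀ {A B} → (ι ⊸⇛ J ε) ⊚ J η ~ ι {A ⊸ B}
  zagᴾ = P.trans (⊸-η {h = ι} {J ε}) (Λ-η {g = ι})

  smcc : SMCC o (c ⊔ ℓ) (c ⊔ ℓ ⊔ e)
  smcc = record
    { Obj = Obj ; _⇒_ = _⇛_ ; _≈_ = _~_ ; id = ι ; _∘_ = _⊚_
    ; ≈-equiv = ~-equiv ; ∘-cong = ⊚-cong ; assoc = ⊚-assoc ; idˡ = ⊚-idˡ ; idʳ = ⊚-idʳ
    ; I = I ; _⊗_ = _⊗_ ; _⊗₁_ = _⊠_
    ; λ⇒ = J λ⇒ ; λ⇐ = J λ⇐ ; ρ⇒ = J ρ⇒ ; ρ⇐ = J ρ⇐ ; α⇒ = J α⇒ ; α⇐ = J α⇐ ; σ = J σ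
    ; ⊗-cong = ⊠-cong ; ⊗-id = ⊠-id ; ⊗-∘ = ⊠-⊚
    ; λ-isoˡ = J-iso λ-isoˡ ; λ-isoʳ = J-iso λ-isoʳ
    ; ρ-isoˡ = J-iso ρ-isoˡ ; ρ-isoʳ = J-iso ρ-isoʳ
    ; α-isoˡ = J-iso α-isoˡ ; α-isoʳ = J-iso α-isoʳ
    ; λ-nat = λ-natᴾ ; ρ-nat = ρ-natᴾ ; α-nat = α-natᴾ ; σ-nat = σ-natᴾ
    ; σ-invol = J-iso σ-invol
    ; triangle = triangleᴾ ; pentagon = pentagonᴾ ; hexagon = hexagonᴾ
    ; _⊸_ = _⊸_ ; _⊸₁_ = _⊸⇛_ ; η = J η ; ε = J ε
    ; ⊸-cong = ⊸-congᴾ ; ⊸-id = ⊸-idᴾ ; ⊸-∘ = ⊸-⊚ᴾ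
    ; η-nat = η-natᴾ ; η-dinat = η-dinatᴾ ; ε-nat = ε-natᴾ ; ε-dinat = ε-dinatᴾ
    ; zig = zigᴾ ; zag = zagᴾ
    }

𝒞 : ∀ {x y} → Signature x y → SMCC x (x ⊔ y) (x ⊔ y)
𝒞 S = AdjoinSMCC.smcc (FreeSMCC.Free Sort) (λ f → dom f ⊸ᵗ cod f)
  where open Signature S

{-# OPTIONS --safe #-}
{-# OPTIONS --with-K #-}

-- A morphism ⟨ Γ , φ ⟩ of 𝒞 S is the composite of J φ with the names I ⇛ at f of
-- the operations f listed in Γ, so a strict functor out of 𝒞 S is determined by
-- its values on sorts and operations.  Conversely an interpretation in D
-- evaluates morphisms of the free SMC category and gives each operation a name
-- I ⇒ at f in D; plugging the names into the evaluation of φ is the required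
-- strict functor.

module Submission where

open import Defs
open import Level using (Level; _⊔_)
open import Data.List.Base using (List; []; _∷_; _++_)
open import Data.List.Relation.Binary.Permutation.Propositional
  using (_↭_; refl; prep; swap; trans)
open import Data.Product using (Σ-syntax; _,_; proj₁)
open import Function.Bundles using (Bijection)
open import Relation.Binary using (Setoid; IsEquivalence)
open import Relation.Binary.Construct.Closure.Equivalence as EqC
open import Relation.Binary.PropositionalEquality as ≡ using (_≡_)

-- Equality across propositionally equal objects, and some coherence identities.

module _ {o ℓ e : Level} {D : SMCC o ℓ e} where
  open SMCC D
  open SMCCLemmas D

  subst₂-≋ : ∀ {A A' B B'} (p : A ≡ A') (q : B ≡ B') (f : A ⇒ B) →
             D [ ≡.subst₂ _⇒_ p q f ≋ f ]
  subst₂-≋ ≡.refl ≡.refl f = ≋-refl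

  -- Used for components of structure maps at objects on which two functors agree only
  -- propositionally.
  family-≋ : ∀ {a} {X : Set a} {s t : X → Obj} (h : ∀ x → s x ⇒ t x) {x y : X} →
             x ≡ y → D [ h x ≋ h y ]
  family-≋ h ≡.refl = ≋-refl

  ∘-≋ : ∀ {A B C A' B' C'} {f : B ⇒ C} {g : A ⇒ B} {f' : B' ⇒ C'} {g' : A' ⇒ B'} →
        D [ f ≋ f' ] → D [ g ≋ g' ] → D [ f ∘ g ≋ f' ∘ g' ]
  ∘-≋ (≈⇒≋ p) (≈⇒≋ q) = ≈⇒≋ (∘-cong p q)

  ⊗-≋ : ∀ {A A' B B' C C' E E'} {f : A ⇒ A'} {g : B ⇒ B'} {f' : C ⇒ C'} {g' : E ⇒ E'} →
        D [ f ≋ f' ] → D [ g ≋ g' ] → D [ f ⊗₁ g ≋ f' ⊗₁ g' ]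
  ⊗-≋ (≈⇒≋ p) (≈⇒≋ q) = ≈⇒≋ (⊗-cong p q)

  ⊸-≋ : ∀ {A A' B B' C C' E E'} {f : A ⇒ A'} {g : B ⇒ B'} {f' : C ⇒ C'} {g' : E ⇒ E'} →
        D [ f ≋ f' ] → D [ g ≋ g' ] → D [ f ⊸₁ g ≋ f' ⊸₁ g' ]
  ⊸-≋ (≈⇒≋ p) (≈⇒≋ q) = ≈⇒≋ (⊸-cong p q)

  -- Uniqueness of inverses. Strict functors come with equations for `λ⇒`, `ρ⇒` and `α⇒` only, and
  -- this supplies those for `λ⇐`, `ρ⇐` and `α⇐`.
  inverse-≋ : ∀ {A B A' B'} {f : A ⇒ B} {g : B ⇒ A} {f' : A' ⇒ B'} {g' : B' ⇒ A'} →
              f ∘ g ≈ id → g' ∘ f' ≈ id → D [ f ≋ f' ] → D [ g ≋ g' ]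
  inverse-≋ a b (≈⇒≋ p) = ≈⇒≋ (inv-unique p a b)

  α⇐-λ : ∀ {A B} → α⇐ ∘ λ⇐ {A ⊗ B} ≈ λ⇐ ⊗₁ id
  α⇐-λ = E.sym (shiftˡ α-isoˡ α-λ⇐)

  σₗ-λ : ∀ {A B} → σₗ ∘ λ⇐ {A ⊗ B} ≈ id ⊗₁ λ⇐
  σₗ-λ = E.sym (shiftˡ σₗ-invol σₗ-λ⇐)

  -- Dinaturality of `ε` turns `id ⊗₁ f` into `(f ⊸₁ id) ⊗₁ id`, which `curry-η` absorbs. It links
  -- the definition of `_⊸⇛_` by `Λ` to the primitive `_⊸₁_`.
  ⊸-curry : ∀ {A A' B B'} {f : A' ⇒ A} {g : B ⇒ B'} →
            curry (g ∘ (ε ∘ (id ⊗₁ f))) ≈ f ⊸₁ g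
  ⊸-curry {f = f} {g} =
    E.trans (id⊸-∘ ⟩∘⟨refl) (E.trans assoc (E.trans
      (refl⟩∘⟨ E.trans (curry-cong (E.sym ε-dinat)) curry-η)
      (E.trans (E.sym ⊸-∘) (⊸-cong idʳ idʳ))))

-- Evaluation of the free SMC category in `D`.

module _ {x o ℓ e : Level} {X : Set x} (D : SMCC o ℓ e) (v : X → SMCC.Obj D) where
  open SMCC D
  private module Fr = FreeSMCC X

  ⟦_⟧ᵗ : Ty X → Obj
  ⟦_⟧ᵗ = extend D v

  eval : ∀ {A B} → A Fr.⇒ B → ⟦ A ⟧ᵗ ⇒ ⟦ B ⟧ᵗ
  eval Fr.id         = id
  eval (f Fr.∘ g)    = eval f ∘ eval g
  eval (f Fr.⊗₁ g)   = eval f ⊗₁ eval g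
  eval Fr.λ⇒         = λ⇒
  eval Fr.λ⇐         = λ⇐
  eval Fr.ρ⇒         = ρ⇒
  eval Fr.ρ⇐         = ρ⇐
  eval Fr.α⇒         = α⇒
  eval Fr.α⇐         = α⇐
  eval Fr.σ          = σ
  eval (f Fr.⊸₁ g)   = eval f ⊸₁ eval g
  eval Fr.η          = η
  eval Fr.ε          = ε

  eval-cong : ∀ {A B} {f g : A Fr.⇒ B} → f Fr.≈ g → eval f ≈ eval g
  eval-cong Fr.≈-refl        = IsEquivalence.refl ≈-equiv
  eval-cong (Fr.≈-sym p)     = IsEquivalence.sym ≈-equiv (eval-cong p)
  eval-cong (Fr.≈-trans p q) = IsEquivalence.trans ≈-equiv (eval-cong p) (eval-cong q)
  eval-cong (Fr.∘-cong p q)  = ∘-cong (eval-cong p) (eval-cong q)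
  eval-cong Fr.assoc         = assoc
  eval-cong Fr.idˡ           = idˡ
  eval-cong Fr.idʳ           = idʳ
  eval-cong (Fr.⊗-cong p q)  = ⊗-cong (eval-cong p) (eval-cong q)
  eval-cong Fr.⊗-id          = ⊗-id
  eval-cong Fr.⊗-∘           = ⊗-∘
  eval-cong Fr.λ-isoˡ        = λ-isoˡ
  eval-cong Fr.λ-isoʳ        = λ-isoʳ
  eval-cong Fr.ρ-isoˡ        = ρ-isoˡ
  eval-cong Fr.ρ-isoʳ        = ρ-isoʳ
  eval-cong Fr.α-isoˡ        = α-isoˡ
  eval-cong Fr.α-isoʳ        = α-isoʳ
  eval-cong Fr.λ-nat         = λ-nat
  eval-cong Fr.ρ-nat         = ρ-nat
  eval-cong Fr.α-nat         = α-nat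
  eval-cong Fr.σ-nat         = σ-nat
  eval-cong Fr.σ-invol       = σ-invol
  eval-cong Fr.triangle      = triangle
  eval-cong Fr.pentagon      = pentagon
  eval-cong Fr.hexagon       = hexagon
  eval-cong (Fr.⊸-cong p q)  = ⊸-cong (eval-cong p) (eval-cong q)
  eval-cong Fr.⊸-id          = ⊸-id
  eval-cong Fr.⊸-∘           = ⊸-∘
  eval-cong Fr.η-nat         = η-nat
  eval-cong Fr.η-dinat       = η-dinat
  eval-cong Fr.ε-nat         = ε-nat
  eval-cong Fr.ε-dinat       = ε-dinat
  eval-cong Fr.zig           = zig
  eval-cong Fr.zag           = zag

-- The generic interpretation and the factorisation of morphisms of `𝒞 S`.

module Syntactic {x y : Level} (S : Signature x y) where
  open Signature S public
  module Fr = FreeSMCC Sort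

  at : Op → Ty Sort
  at f = dom f ⊸ᵗ cod f

  open Adjoin Fr.Free at public
  module Laws = AdjoinLaws Fr.Free at
  open AdjoinSMCC Fr.Free at public
  open SMCC Fr.Free using (σₗ; middle)
  open SMCCLemmas Fr.Free

  -- The context `f ∷ []` has type `dom f ⊸ᵗ cod f`, so applying it by `ε` makes the operation a
  -- morphism.
  generator : ∀ f → dom f ⇛ cod f
  generator f = ⟨ f ∷ [] , Fr.ε ⟩

  -- True by induction but not definitionally, whence the transports in `generic`.
  extend-var : ∀ a → a ≡ extend (𝒞 S) var a
  extend-var (var a)  = ≡.refl
  extend-var Iᵗ       = ≡.refl
  extend-var (a ⊗ᵗ b) = ≡.cong₂ _⊗ᵗ_ (extend-var a) (extend-var b)
  extend-var (a ⊸ᵗ b) = ≡.cong₂ _⊸ᵗ_ (extend-var a) (extend-var b)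

  generic : Interpretation S (𝒞 S)
  generic = record
    { ⟦_⟧₀ = var
    ; ⟦_⟧₁ = λ { {a} {b} (f , p , q) →
        ≡.subst₂ _⇛_ (≡.trans p (extend-var a)) (≡.trans q (extend-var b)) (generator f) }
    }

  generic-≋ : ∀ {a b} (f : Op⟨ a , b ⟩) →
              𝒞 S [ Interpretation.⟦_⟧₁ generic f ≋ generator (proj₁ f) ]
  generic-≋ {a} {b} (f , p , q) =
    subst₂-≋ {D = 𝒞 S} (≡.trans p (extend-var a)) (≡.trans q (extend-var b)) (generator f)

  -- Clears both layers of transport, the one in `generic` and the one in `_·_`.
  ·-generic : ∀ {o ℓ e} {D : SMCC o ℓ e} (F : StrictFunctor (𝒞 S) D) {a b} (f : Op⟨ a , b ⟩) →
              D [ Interpretation.⟦_⟧₁ (F · generic) f ≋ StrictFunctor.F₁ F (generator (proj₁ f)) ]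
  ·-generic {D = D} F {a} {b} f =
    ≋-trans (subst₂-≋ {D = D} (extend-F₀ F var a) (extend-F₀ F var b) _)
            (StrictFunctor.F-≋ F (generic-≋ f))

  -- The global element of `ty Γ` that returns its own context.
  point : ∀ Γ → Iᵗ ⇛ ty Γ
  point Γ = ⟨ Γ , Fr.ρ⇒ ⟩

  -- The same element with values in `nest Γ`, which, unlike the left-nested `ty Γ`, is recursive in
  -- the head of the list.
  pointᴺ : ∀ Γ → Iᵗ ⇛ nest Γ
  pointᴺ Γ = ⟨ Γ , nest⇒ Γ Fr.∘ Fr.ρ⇒ ⟩

  -- After unfolding `_⊸⇛_` to a `Λ`, `λ-α` moves the empty context out of the curried term and
  -- `⊸-curry` identifies the rest.
  J-⊸ : ∀ {U U' V V'} {f : U' Fr.⇒ U} {g : V Fr.⇒ V'} → J f ⊸⇛ J g ~ J (f Fr.⊸₁ g)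
  J-⊸ {f = f} {g} = P.trans
    (Λ-cong (P.trans (⊚-congʳ (J g) (P.trans (⊚-congʳ (J Fr.ε) ι⊠J) J-∘)) J-∘))
    (eq (E.trans (curry-cong (E.trans Fr.assoc (refl⟩∘⟨ λ-α)))
      (E.trans (E.sym curry-∘) (⊸-curry {D = Fr.Free} ⟩∘⟨refl))))

  -- Expresses currying through operations that strict functors preserve by definition.
  Λ-via-⊸ : ∀ {U V W} (f : U ⊗ᵗ V ⇛ W) → Λ f ~ (ι ⊸⇛ f) ⊚ J Fr.η
  Λ-via-⊸ f = P.sym (P.trans ⊸-η (Λ-cong (P.trans (⊚-congʳ f ⊠-id) ⊚-idʳ)))

  -- Separates the pure part `J φ` from the context; the unit constraints left over cancel by the
  -- triangle.
  decompose : ∀ Γ {U V} (φ : ty Γ ⊗ᵗ U Fr.⇒ V) →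
              ⟨ Γ , φ ⟩ ~ J φ ⊚ ((point Γ ⊠ ι) ⊚ J Fr.λ⇐)
  decompose Γ φ = P.sym (P.trans
    (⊚-congʳ (J φ) (P.trans (⊚-congˡ (J Fr.λ⇐) (⊠ι (point Γ))) J-⊚ʳ))
    (P.trans J-⊚ˡ (eq (E.trans (refl⟩∘⟨ E.trans Fr.assoc
      (E.trans (refl⟩∘⟨ α⇐-λ⇐) (iso⊗ˡ Fr.ρ-isoʳ))) Fr.idʳ))))

  point-nest : ∀ Γ → point Γ ~ J (nest⇐ Γ) ⊚ pointᴺ Γ
  point-nest Γ = P.sym (P.trans J-⊚ˡ (eq (cancˡ (Laws.nest-isoˡ Γ))))

  pointᴺ-[] : pointᴺ [] ~ ι
  pointᴺ-[] = eq (E.trans Fr.idˡ (E.sym λ≈ρ))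

  -- By the triangle the right side curries `ε` after `ρ⇒` tensored with an identity, which is `ρ⇒`
  -- by `curry-η`. The formula is that of `name`, read in `𝒞 S`.
  point-[f] : ∀ f → point (f ∷ []) ~ Λ (generator f ⊚ J Fr.λ⇒)
  point-[f] f = P.sym (P.trans (Λ-cong J-⊚ʳ) (eq (E.trans
    (curry-cong (E.trans Fr.assoc (refl⟩∘⟨ Fr.triangle))) curry-η)))

  -- Reduces points to single operations by induction on the context. Both factors start from `Iᵗ`,
  -- so `middle` reduces to unit and associativity constraints.
  pointᴺ-∷ : ∀ f Γ → pointᴺ (f ∷ Γ) ~ (point (f ∷ []) ⊠ pointᴺ Γ) ⊚ J Fr.λ⇐
  pointᴺ-∷ f Γ = P.sym (P.trans J-⊚ʳ (eq (begin
    ((ρ⇒ ⊗₁ (nest⇒ Γ ∘ ρ⇒)) ∘ (middle ∘ (split (f ∷ []) Γ ⊗₁ id)))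
      ∘ (id ⊗₁ λ⇐)
      ≈⟨ E.trans assoc (refl⟩∘⟨ E.trans assoc (refl⟩∘⟨ swp)) ⟩
    (ρ⇒ ⊗₁ (nest⇒ Γ ∘ ρ⇒)) ∘
      (middle ∘ ((id ⊗₁ λ⇐) ∘ (split (f ∷ []) Γ ⊗₁ id)))
      ≈⟨ refl⟩∘⟨ pullˡ middle-λ⇐ ⟩
    (ρ⇒ ⊗₁ (nest⇒ Γ ∘ ρ⇒)) ∘
      (((ρ⇐ ⊗₁ id) ∘ α⇒) ∘ (split (f ∷ []) Γ ⊗₁ id))
      ≈⟨ E.trans (refl⟩∘⟨ assoc) (pullˡ (E.trans (E.sym ⊗-∘)
          (E.trans (⊗-cong ρ-isoʳ idʳ) ∘⊗ʳ))) ⟩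
    ((id ⊗₁ nest⇒ Γ) ∘ (id ⊗₁ ρ⇒)) ∘ (α⇒ ∘ (split (f ∷ []) Γ ⊗₁ id))
      ≈⟨ E.trans assoc (refl⟩∘⟨ pullˡ ρ-α) ⟩
    (id ⊗₁ nest⇒ Γ) ∘ (ρ⇒ ∘ (split (f ∷ []) Γ ⊗₁ id))
      ≈⟨ refl⟩∘⟨ ρ-nat ⟩
    (id ⊗₁ nest⇒ Γ) ∘ (split (f ∷ []) Γ ∘ ρ⇒)
      ≈⟨ refl⟩∘⟨ split-[f] ⟩∘⟨refl ⟩
    (id ⊗₁ nest⇒ Γ) ∘ (((id ⊗₁ nest⇐ Γ) ∘ nest⇒ (f ∷ Γ)) ∘ ρ⇒)
      ≈⟨ refl⟩∘⟨ assoc ⟩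
    (id ⊗₁ nest⇒ Γ) ∘ ((id ⊗₁ nest⇐ Γ) ∘ (nest⇒ (f ∷ Γ) ∘ ρ⇒))
      ≈⟨ cancˡ (iso⊗ʳ (Laws.nest-isoʳ Γ)) ⟩
    nest⇒ (f ∷ Γ) ∘ ρ⇒
      ∎)))
    where
      open FreeSMCC Sort
      open Reasoning

      middle-λ⇐ : ∀ {A B C} → middle {A} {B} {Iᵗ} {C} ∘ (id ⊗₁ λ⇐) ≈ (ρ⇐ ⊗₁ id) ∘ α⇒
      middle-λ⇐ = begin
        (α⇐ ∘ ((id ⊗₁ σₗ) ∘ α⇒)) ∘ (id ⊗₁ λ⇐)
          ≈⟨ E.trans assoc (refl⟩∘⟨ E.trans assoc (refl⟩∘⟨ α-natʳ)) ⟩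
        α⇐ ∘ ((id ⊗₁ σₗ) ∘ ((id ⊗₁ (id ⊗₁ λ⇐)) ∘ α⇒))
          ≈⟨ refl⟩∘⟨ pullˡ (E.trans (E.sym ∘⊗ʳ) (⊗ʳ σₗ-λ⇐)) ⟩
        α⇐ ∘ ((id ⊗₁ λ⇐) ∘ α⇒)
          ≈⟨ pullˡ α⇐-λ⇐ ⟩
        (ρ⇐ ⊗₁ id) ∘ α⇒
          ∎

      split-[f] : split (f ∷ []) Γ ≈ (id ⊗₁ nest⇐ Γ) ∘ nest⇒ (f ∷ Γ)
      split-[f] = E.trans (refl⟩∘⟨ α⇐-λ⇐ ⟩∘⟨refl) (pullˡ
        (E.trans (E.sym ⊗-∘) (⊗-cong ρ-isoʳ idʳ)))

-- Extension of an interpretation to a strict functor.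

module Interpret {x y o ℓ e : Level} (S : Signature x y) (D : SMCC o ℓ e)
                 (K : Interpretation S D) where
  open Syntactic S using (at; nest; nest⇒; nest⇐; splitᴺ; permᴺ; split; perm; ty;
                          _⇛_; ⟨_,_⟩; _~_; _↝_; permute; equal; J; ι; _⊚_; _⊠_; Λ; _⊸⇛_; L; R;
                          ⊠-LR; module Fr; module Laws; generator; generic;
                          ·-generic; Op⟨_,_⟩)
  open Interpretation K
  open SMCC D
  open SMCCLemmas D
  open Reasoning

  ev : ∀ {A B} → A Fr.⇒ B → ⟦ A ⟧ ⇒ ⟦ B ⟧
  ev = eval D ⟦_⟧₀

  ev-cong : ∀ {A B} {f g : A Fr.⇒ B} → f Fr.≈ g → ev f ≈ ev g
  ev-cong = eval-cong D ⟦_⟧₀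

  name : ∀ f → I ⇒ ⟦ at f ⟧
  name f = curry (⟦ f , ≡.refl , ≡.refl ⟧₁ ∘ λ⇒)

  namesᴺ : ∀ Γ → I ⇒ ⟦ nest Γ ⟧
  namesᴺ []      = id
  namesᴺ (f ∷ Γ) = (name f ⊗₁ namesᴺ Γ) ∘ λ⇐

  names : ∀ Γ → I ⇒ ⟦ ty Γ ⟧
  names Γ = ev (nest⇐ Γ) ∘ namesᴺ Γ

  -- By naturality the symmetry moves past the names onto copies of `I`, where it is absorbed. This
  -- makes evaluation invariant under the quotient by permutations.
  permᴺ-names : ∀ {Γ Δ} (p : Γ ↭ Δ) → ev (permᴺ p) ∘ namesᴺ Γ ≈ namesᴺ Δ
  permᴺ-names refl = idˡ
  permᴺ-names (prep f p) = pullˡ (E.trans (E.sym ⊗-∘) (⊗-cong idˡ (permᴺ-names p)))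
  permᴺ-names {f ∷ g ∷ Γ} {g ∷ f ∷ Δ} (swap f g p) = begin
    (σₗ ∘ (id ⊗₁ (id ⊗₁ ev (permᴺ p)))) ∘ ((name f ⊗₁ ((name g ⊗₁ namesᴺ Γ) ∘ λ⇐)) ∘ λ⇐)
      ≈⟨ E.trans assoc (refl⟩∘⟨ pullˡ (E.trans (E.sym ⊗-∘) (⊗-cong idˡ
          (pullˡ (E.trans (E.sym ⊗-∘) (⊗-cong idˡ (permᴺ-names p))))))) ⟩
    σₗ ∘ ((name f ⊗₁ ((name g ⊗₁ namesᴺ Δ) ∘ λ⇐)) ∘ λ⇐)
      ≈⟨ refl⟩∘⟨ E.trans (⊗-cong (E.sym idʳ) E.refl) ⊗-∘ ⟩∘⟨refl ⟩
    σₗ ∘ (((name f ⊗₁ (name g ⊗₁ namesᴺ Δ)) ∘ (id ⊗₁ λ⇐)) ∘ λ⇐)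
      ≈⟨ refl⟩∘⟨ assoc ⟩
    σₗ ∘ ((name f ⊗₁ (name g ⊗₁ namesᴺ Δ)) ∘ ((id ⊗₁ λ⇐) ∘ λ⇐))
      ≈⟨ exch σₗ-nat ⟩
    (name g ⊗₁ (name f ⊗₁ namesᴺ Δ)) ∘ (σₗ ∘ ((id ⊗₁ λ⇐) ∘ λ⇐))
      -- `σₗ-λ⇐` absorbs the symmetry into a unit constraint; `λ⇐-nat` then restores the shape
      -- needed for refolding.
      ≈⟨ refl⟩∘⟨ E.trans (pullˡ σₗ-λ⇐) λ⇐-nat ⟩
    (name g ⊗₁ (name f ⊗₁ namesᴺ Δ)) ∘ ((id ⊗₁ λ⇐) ∘ λ⇐)
      ≈⟨ pullˡ (E.trans (E.sym ⊗-∘) (⊗-cong idʳ E.refl)) ⟩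
    (name g ⊗₁ ((name f ⊗₁ namesᴺ Δ) ∘ λ⇐)) ∘ λ⇐
      ∎
  permᴺ-names (trans p q) = E.trans assoc (E.trans (refl⟩∘⟨ permᴺ-names p) (permᴺ-names q))

  splitᴺ-names : ∀ Δ Γ → ev (splitᴺ Δ Γ) ∘ namesᴺ (Δ ++ Γ) ≈ (namesᴺ Δ ⊗₁ namesᴺ Γ) ∘ λ⇐
  splitᴺ-names []      Γ = λ⇐-nat
  splitᴺ-names (f ∷ Δ) Γ = begin
    (α⇐ ∘ (id ⊗₁ ev (splitᴺ Δ Γ))) ∘ ((name f ⊗₁ namesᴺ (Δ ++ Γ)) ∘ λ⇐)
      ≈⟨ E.trans assoc (refl⟩∘⟨ pullˡ (E.trans (E.sym ⊗-∘)
          (⊗-cong (E.trans idˡ (E.sym idʳ)) (splitᴺ-names Δ Γ)))) ⟩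
    α⇐ ∘ (((name f ∘ id) ⊗₁ ((namesᴺ Δ ⊗₁ namesᴺ Γ) ∘ λ⇐)) ∘ λ⇐)
      ≈⟨ refl⟩∘⟨ E.trans (⊗-∘ ⟩∘⟨refl) assoc ⟩
    α⇐ ∘ ((name f ⊗₁ (namesᴺ Δ ⊗₁ namesᴺ Γ)) ∘ ((id ⊗₁ λ⇐) ∘ λ⇐))
      ≈⟨ exch α⇐-nat ⟩
    ((name f ⊗₁ namesᴺ Δ) ⊗₁ namesᴺ Γ) ∘ (α⇐ ∘ ((id ⊗₁ λ⇐) ∘ λ⇐))
      -- Reassociation leaves `ρ⇐` where `namesᴺ` has `λ⇐`; on `I` the two coincide.
      ≈⟨ refl⟩∘⟨ E.trans (pullˡ α⇐-λ⇐) (⊗ˡ (E.sym λ⇐≈ρ⇐) ⟩∘⟨refl) ⟩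
    ((name f ⊗₁ namesᴺ Δ) ⊗₁ namesᴺ Γ) ∘ ((λ⇐ ⊗₁ id) ∘ λ⇐)
      ≈⟨ pullˡ (E.trans (E.sym ⊗-∘) (⊗-cong E.refl idʳ)) ⟩
    (((name f ⊗₁ namesᴺ Δ) ∘ λ⇐) ⊗₁ namesᴺ Γ) ∘ λ⇐
      ∎

  nest⇒-names : ∀ Γ → ev (nest⇒ Γ) ∘ names Γ ≈ namesᴺ Γ
  nest⇒-names Γ = cancˡ (ev-cong (Laws.nest-isoʳ Γ))

  perm-names : ∀ {Γ Δ} (p : Γ ↭ Δ) → ev (perm p) ∘ names Γ ≈ names Δ
  perm-names {Γ} {Δ} p = E.trans (pullˡ (ev-cong (Laws.perm-nest⇐ p)))
    (E.trans assoc (refl⟩∘⟨ permᴺ-names p))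

  split-names : ∀ Δ Γ → ev (split Δ Γ) ∘ names (Δ ++ Γ) ≈ (names Δ ⊗₁ names Γ) ∘ λ⇐
  split-names Δ Γ = E.trans (pullˡ (ev-cong (Laws.split-nest⇐ Δ Γ)))
    (E.trans assoc (E.trans (refl⟩∘⟨ splitᴺ-names Δ Γ) (pullˡ (E.sym ⊗-∘))))

  -- Supplies the assumptions of a context with the names of their operations.
  plug : ∀ Γ {A} → A ⇒ ⟦ ty Γ ⟧ ⊗ A
  plug Γ = (names Γ ⊗₁ id) ∘ λ⇐

  interpret : ∀ {U V} → U ⇛ V → ⟦ U ⟧ ⇒ ⟦ V ⟧
  interpret ⟨ Γ , φ ⟩ = ev φ ∘ plug Γ

  interpret-cong : ∀ {U V} {f g : U ⇛ V} → f ~ g → interpret f ≈ interpret g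
  interpret-cong = EqC.gfold ≈-equiv interpret step
    where
      step : ∀ {U V} {f g : U ⇛ V} → f ↝ g → interpret f ≈ interpret g
      step (permute p φ) = E.sym (E.trans assoc (refl⟩∘⟨
        pullˡ (E.trans (E.sym ∘⊗ˡ) (⊗ˡ (perm-names p)))))
      step (equal p) = ev-cong p ⟩∘⟨refl

  plug-[] : ∀ {A} → plug [] {A} ≈ λ⇐
  plug-[] = E.trans (E.trans (⊗ˡ idˡ) ⊗-id ⟩∘⟨refl) idˡ

  interpret-J : ∀ {U V} (φ : U Fr.⇒ V) → interpret (J φ) ≈ ev φ
  interpret-J φ = E.trans assoc (E.trans
    (refl⟩∘⟨ E.trans (refl⟩∘⟨ plug-[]) λ-isoʳ) idʳ)

  interpret-ι : ∀ {U} → interpret (ι {U}) ≈ id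
  interpret-ι = E.trans (refl⟩∘⟨ plug-[]) λ-isoʳ

  plug-nat : ∀ Γ {A B} {h : A ⇒ B} → (id ⊗₁ h) ∘ plug Γ ≈ plug Γ ∘ h
  plug-nat Γ = E.trans (exch (E.sym swp)) (E.trans (refl⟩∘⟨ E.sym λ⇐-nat) (E.sym assoc))

  -- A concatenated context can be plugged in two stages; with `plug-nat` this is functoriality of
  -- `interpret`.
  plug-++ : ∀ Δ Γ {A} → α⇒ ∘ ((ev (split Δ Γ) ⊗₁ id) ∘ plug (Δ ++ Γ) {A}) ≈ plug Δ ∘ plug Γ
  plug-++ Δ Γ = begin
    α⇒ ∘ ((ev (split Δ Γ) ⊗₁ id) ∘ ((names (Δ ++ Γ) ⊗₁ id) ∘ λ⇐))
      ≈⟨ refl⟩∘⟨ pullˡ (E.trans (E.sym ∘⊗ˡ) (E.trans (⊗ˡ (split-names Δ Γ)) ∘⊗ˡ)) ⟩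
    α⇒ ∘ ((((names Δ ⊗₁ names Γ) ⊗₁ id) ∘ (λ⇐ ⊗₁ id)) ∘ λ⇐)
      ≈⟨ E.trans (refl⟩∘⟨ assoc) (exch α-nat) ⟩
    (names Δ ⊗₁ (names Γ ⊗₁ id)) ∘ (α⇒ ∘ ((λ⇐ ⊗₁ id) ∘ λ⇐))
      ≈⟨ refl⟩∘⟨ E.trans (pullˡ α-λ⇐) λ⇐-nat ⟩
    (names Δ ⊗₁ (names Γ ⊗₁ id)) ∘ ((id ⊗₁ λ⇐) ∘ λ⇐)
      ≈⟨ pullˡ (E.trans (E.sym ⊗-∘) (⊗-cong idʳ E.refl)) ⟩
    (names Δ ⊗₁ plug Γ) ∘ λ⇐
      ≈⟨ E.sym ser₁ ⟩∘⟨refl ⟩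
    ((names Δ ⊗₁ id) ∘ (id ⊗₁ plug Γ)) ∘ λ⇐
      ≈⟨ E.trans assoc (refl⟩∘⟨ E.sym λ⇐-nat) ⟩
    (names Δ ⊗₁ id) ∘ (λ⇐ ∘ plug Γ)
      ≈⟨ assoc ⟨
    plug Δ ∘ plug Γ
      ∎

  interpret-⊚ : ∀ {U V W} (g : V ⇛ W) (f : U ⇛ V) →
                interpret (g ⊚ f) ≈ interpret g ∘ interpret f
  interpret-⊚ ⟨ Δ , ψ ⟩ ⟨ Γ , φ ⟩ = begin
    (ev ψ ∘ ((id ⊗₁ ev φ) ∘ (α⇒ ∘ (ev (split Δ Γ) ⊗₁ id)))) ∘ plug (Δ ++ Γ)
      ≈⟨ E.trans assoc (refl⟩∘⟨ E.trans assoc (refl⟩∘⟨ E.trans assoc (plug-++ Δ Γ))) ⟩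
    ev ψ ∘ ((id ⊗₁ ev φ) ∘ (plug Δ ∘ plug Γ))
      ≈⟨ refl⟩∘⟨ exch (plug-nat Δ) ⟩
    ev ψ ∘ (plug Δ ∘ (ev φ ∘ plug Γ))
      ≈⟨ assoc ⟨
    (ev ψ ∘ plug Δ) ∘ (ev φ ∘ plug Γ)
      ∎

  plug-α : ∀ Γ {A B} → α⇐ ∘ plug Γ {A ⊗ B} ≈ plug Γ ⊗₁ id
  plug-α Γ = E.trans (exch α⇐-natˡ) (E.trans (refl⟩∘⟨ α⇐-λ {D = D}) (E.sym ∘⊗ˡ))

  interpret-L : ∀ {W U V} (f : U ⇛ V) → interpret (L W f) ≈ interpret f ⊗₁ id
  interpret-L ⟨ Γ , φ ⟩ = E.trans assoc (E.trans (refl⟩∘⟨ plug-α Γ) (E.sym ∘⊗ˡ))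

  interpret-R : ∀ {W U V} (f : U ⇛ V) → interpret (R W f) ≈ id ⊗₁ interpret f
  interpret-R ⟨ Γ , φ ⟩ = E.trans assoc (E.trans (refl⟩∘⟨ plug-σ) (E.sym ∘⊗ʳ))
    where
      plug-σ : ∀ {A B} → σₗ ∘ plug Γ {A ⊗ B} ≈ id ⊗₁ plug Γ
      plug-σ = E.trans (exch (E.trans (refl⟩∘⟨ ⊗-cong E.refl (E.sym ⊗-id)) σₗ-nat))
        (E.trans (refl⟩∘⟨ σₗ-λ {D = D}) (E.sym ∘⊗ʳ))

  -- Factoring the tensor into two whiskerings by `⊠-LR` avoids computing with `middle`.
  interpret-⊠ : ∀ {U U' V V'} (f : U ⇛ V) (g : U' ⇛ V') →
                interpret (f ⊠ g) ≈ interpret f ⊗₁ interpret g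
  interpret-⊠ f g = E.trans (interpret-cong (⊠-LR f g)) (E.trans
    (interpret-⊚ (L _ f) (R _ g))
    (E.trans (interpret-L f ⟩∘⟨ interpret-R g) ser₁))

  -- Currying leaves the context in place, and `plug-α` moves the plugged names across the
  -- associator.
  interpret-Λ : ∀ {U V W} (f : U ⊗ᵗ V ⇛ W) → interpret (Λ f) ≈ curry (interpret f)
  interpret-Λ ⟨ Γ , φ ⟩ = E.trans curry-∘ (curry-cong (E.trans assoc
    (refl⟩∘⟨ E.sym (shiftˡ α-isoʳ (plug-α Γ)))))

  interpret-⊸ : ∀ {U U' V V'} (f : U' ⇛ U) (g : V ⇛ V') →
                interpret (f ⊸⇛ g) ≈ interpret f ⊸₁ interpret g
  interpret-⊸ {U} {U'} {V} f g = E.trans (interpret-Λ (g ⊚ (J Fr.ε ⊚ (ι ⊠ f))))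
    (E.trans (curry-cong body) (⊸-curry {D = D}))
    where
      body : interpret (g ⊚ (J Fr.ε ⊚ (ι ⊠ f))) ≈ interpret g ∘ (ε ∘ (id ⊗₁ interpret f))
      body = E.trans (interpret-⊚ g (J Fr.ε ⊚ (ι ⊠ f))) (refl⟩∘⟨
        E.trans (interpret-⊚ (J Fr.ε) (ι {U ⊸ᵗ V} ⊠ f)) (interpret-J (Fr.ε {U} {V}) ⟩∘⟨
          E.trans (interpret-⊠ ι f) (⊗-cong (interpret-ι {U ⊸ᵗ V}) E.refl)))

  functor : StrictFunctor (𝒞 S) D
  functor = record
    { F₀ = ⟦_⟧ ; F₁ = interpret ; F-cong = interpret-cong ; F-id = λ {A} → interpret-ι {A}
    ; F-∘ = λ {_} {_} {_} {g} {f} → interpret-⊚ g f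
    ; F-I = ≡.refl ; F-⊗ = ≡.refl ; F-⊸ = ≡.refl
    ; F-⊗₁ = λ {_} {_} {_} {_} {f} {g} → ≈⇒≋ (interpret-⊠ f g)
    ; F-⊸₁ = λ {_} {_} {_} {_} {f} {g} → ≈⇒≋ (interpret-⊸ f g)
    ; F-λ = λ {A} → ≈⇒≋ (interpret-J (Fr.λ⇒ {A}))
    ; F-ρ = λ {A} → ≈⇒≋ (interpret-J (Fr.ρ⇒ {A}))
    ; F-α = λ {A} {B} {E} → ≈⇒≋ (interpret-J (Fr.α⇒ {A} {B} {E}))
    ; F-σ = λ {A} {B} → ≈⇒≋ (interpret-J (Fr.σ {A} {B}))
    ; F-η = λ {A} {B} → ≈⇒≋ (interpret-J (Fr.η {A} {B}))
    ; F-ε = λ {A} {B} → ≈⇒≋ (interpret-J (Fr.ε {A} {B}))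
    }

  -- The β-law: applying the name of an operation returns the operation.
  interpret-generator : ∀ f → interpret (generator f) ≈ ⟦ f , ≡.refl , ≡.refl ⟧₁
  interpret-generator f = begin
    ε ∘ ((names (f ∷ []) ⊗₁ id) ∘ λ⇐)            ≈⟨ refl⟩∘⟨ ⊗ˡ names-[f] ⟩∘⟨refl ⟩
    ε ∘ ((name f ⊗₁ id) ∘ λ⇐)                    ≈⟨ pullˡ curry-β ⟩
    (⟦ f , ≡.refl , ≡.refl ⟧₁ ∘ λ⇒) ∘ λ⇐         ≈⟨ E.trans assoc (E.trans (refl⟩∘⟨ λ-isoʳ) idʳ) ⟩
    ⟦ f , ≡.refl , ≡.refl ⟧₁                     ∎
    where
      names-[f] : names (f ∷ []) ≈ name f
      names-[f] = E.trans (pullˡ ρ-nat) (E.trans assoc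
        (E.trans (refl⟩∘⟨ E.trans (refl⟩∘⟨ λ⇐≈ρ⇐) ρ-isoʳ) idʳ))

  functor-generic : Setoid._≈_ (Interpretations S D) (functor · generic) K
  functor-generic = (λ _ → ≡.refl) , λ f → ≋-trans (·-generic functor f) (on-generators f)
    where
      on-generators : ∀ {a b} (f : Op⟨ a , b ⟩) →
                      D [ interpret (generator (proj₁ f)) ≋ ⟦ f ⟧₁ ]
      -- Matching on the typing equations reduces arbitrary `a`, `b` to `dom f`, `cod f`.
      on-generators (f , ≡.refl , ≡.refl) = ≈⇒≋ (interpret-generator f)

-- Strict functors agreeing on sorts and generators are equal.

module Uniqueness {x y o ℓ e : Level} (S : Signature x y) (D : SMCC o ℓ e)
                  (F G : StrictFunctor (𝒞 S) D) where
  open Syntactic S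
  private
    module D = SMCC D
    module F = StrictFunctor F
    module G = StrictFunctor G
    module DE {A B} = IsEquivalence (D.≈-equiv {A} {B})

  infix 4 _∼_
  _∼_ : ∀ {A B A' B'} → A D.⇒ B → A' D.⇒ B' → Set (ℓ ⊔ e)
  f ∼ g = D [ f ≋ g ]

  Agree : ∀ {U V} → U ⇛ V → Set (ℓ ⊔ e)
  Agree f = F.F₁ f ∼ G.F₁ f

  module _ (agree₀ : ∀ a → F.F₀ (var a) ≡ G.F₀ (var a)) where

    agree-Obj : ∀ A → F.F₀ A ≡ G.F₀ A
    agree-Obj (var a)  = agree₀ a
    agree-Obj Iᵗ       = ≡.trans F.F-I (≡.sym G.F-I)
    agree-Obj (A ⊗ᵗ B) = ≡.trans F.F-⊗
      (≡.trans (≡.cong₂ D._⊗_ (agree-Obj A) (agree-Obj B)) (≡.sym G.F-⊗))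
    agree-Obj (A ⊸ᵗ B) = ≡.trans F.F-⊸
      (≡.trans (≡.cong₂ D._⊸_ (agree-Obj A) (agree-Obj B)) (≡.sym G.F-⊸))

    agree-~ : ∀ {U V} {f g : U ⇛ V} → f ~ g → Agree g → Agree f
    agree-~ p a = ≋-trans (≈⇒≋ (F.F-cong p)) (≋-trans a (≈⇒≋ (DE.sym (G.F-cong p))))

    agree-id : ∀ {A} → D.id {F.F₀ A} ∼ D.id {G.F₀ A}
    agree-id {A} = family-≋ {D = D} (λ A → D.id {A}) (agree-Obj A)

    agree-ι : ∀ {U} → Agree (ι {U})
    agree-ι {U} = ≋-trans (≈⇒≋ F.F-id) (≋-trans (agree-id {U}) (≋-sym (≈⇒≋ G.F-id)))

    agree-⊚ : ∀ {U V W} {g : V ⇛ W} {f : U ⇛ V} → Agree g → Agree f → Agree (g ⊚ f)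
    agree-⊚ a b = ≋-trans (≈⇒≋ F.F-∘) (≋-trans (∘-≋ {D = D} a b) (≋-sym (≈⇒≋ G.F-∘)))

    agree-⊠ : ∀ {U U' V V'} {f : U ⇛ V} {g : U' ⇛ V'} → Agree f → Agree g → Agree (f ⊠ g)
    agree-⊠ a b = ≋-trans F.F-⊗₁ (≋-trans (⊗-≋ {D = D} a b) (≋-sym G.F-⊗₁))

    agree-⊸ : ∀ {U U' V V'} {f : U' ⇛ U} {g : V ⇛ V'} → Agree f → Agree g → Agree (f ⊸⇛ g)
    agree-⊸ a b = ≋-trans F.F-⊸₁ (≋-trans (⊸-≋ {D = D} a b) (≋-sym G.F-⊸₁))

    agree-inverse : ∀ {U V} {f : U ⇛ V} {g : V ⇛ U} →
                    f ⊚ g ~ ι → g ⊚ f ~ ι → Agree f → Agree g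
    agree-inverse p q = inverse-≋ {D = D}
      (DE.trans (DE.sym F.F-∘) (DE.trans (F.F-cong p) F.F-id))
      (DE.trans (DE.sym G.F-∘) (DE.trans (G.F-cong q) G.F-id))

    agree-α : ∀ {A B E} → Agree (J (Fr.α⇒ {A} {B} {E}))
    agree-α {A} {B} {E} = ≋-trans F.F-α (≋-trans
      (α-≋ (agree-Obj A) (agree-Obj B) (agree-Obj E)) (≋-sym G.F-α))
      where
        α-≋ : ∀ {A B E A' B' E'} → A ≡ A' → B ≡ B' → E ≡ E' →
              D.α⇒ {A} {B} {E} ∼ D.α⇒ {A'} {B'} {E'}
        α-≋ ≡.refl ≡.refl ≡.refl = ≋-refl

    agree-λ : ∀ {A} → Agree (J (Fr.λ⇒ {A}))
    agree-λ {A} = ≋-trans F.F-λ (≋-trans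
      (family-≋ {D = D} (λ A → D.λ⇒ {A}) (agree-Obj A)) (≋-sym G.F-λ))

    agree-ρ : ∀ {A} → Agree (J (Fr.ρ⇒ {A}))
    agree-ρ {A} = ≋-trans F.F-ρ (≋-trans
      (family-≋ {D = D} (λ A → D.ρ⇒ {A}) (agree-Obj A)) (≋-sym G.F-ρ))

    -- Indexing by pairs of objects lets `family-≋` treat `σ`, `η` and `ε`.
    agree-pair : ∀ {s t : D.Obj → D.Obj → D.Obj} (h : ∀ A B → s A B D.⇒ t A B) A B →
                 h (F.F₀ A) (F.F₀ B) ∼ h (G.F₀ A) (G.F₀ B)
    agree-pair h A B = family-≋ {D = D} (λ (A , B) → h A B)
      (≡.cong₂ _,_ (agree-Obj A) (agree-Obj B))

    -- Induction on free terms: `J` carries each constructor to the corresponding structure of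
    -- `𝒞 S`.
    agree-J : ∀ {A B} (φ : A Fr.⇒ B) → Agree (J φ)
    agree-J Fr.id       = agree-~ J-id agree-ι
    agree-J (f Fr.∘ g)  = agree-~ (P.sym J-∘) (agree-⊚ (agree-J f) (agree-J g))
    agree-J (f Fr.⊗₁ g) = agree-~ (P.sym J-⊠) (agree-⊠ (agree-J f) (agree-J g))
    agree-J Fr.λ⇒       = agree-λ
    agree-J Fr.λ⇐       = agree-inverse (J-iso Fr.λ-isoʳ) (J-iso Fr.λ-isoˡ) agree-λ
    agree-J Fr.ρ⇒       = agree-ρ
    agree-J Fr.ρ⇐       = agree-inverse (J-iso Fr.ρ-isoʳ) (J-iso Fr.ρ-isoˡ) agree-ρ
    agree-J Fr.α⇒       = agree-α
    agree-J Fr.α⇐       = agree-inverse (J-iso Fr.α-isoʳ) (J-iso Fr.α-isoˡ) agree-α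
    agree-J (Fr.σ {A} {B}) = ≋-trans F.F-σ (≋-trans
      (agree-pair (λ A B → D.σ {A} {B}) A B) (≋-sym G.F-σ))
    agree-J (f Fr.⊸₁ g) = agree-~ (P.sym J-⊸) (agree-⊸ (agree-J f) (agree-J g))
    agree-J (Fr.η {A} {B}) = ≋-trans F.F-η (≋-trans
      (agree-pair (λ A B → D.η {A} {B}) A B) (≋-sym G.F-η))
    agree-J (Fr.ε {A} {B}) = ≋-trans F.F-ε (≋-trans
      (agree-pair (λ A B → D.ε {A} {B}) A B) (≋-sym G.F-ε))

    agree-Λ : ∀ {U V W} {f : U ⊗ᵗ V ⇛ W} → Agree f → Agree (Λ f)
    agree-Λ {f = f} a = agree-~ (Λ-via-⊸ f) (agree-⊚ (agree-⊸ agree-ι a) (agree-J Fr.η))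

    module _ (agree₁ : ∀ f → Agree (generator f)) where

      -- The only step of the uniqueness argument that uses agreement on generators.
      agree-pointᴺ : ∀ Γ → Agree (pointᴺ Γ)
      agree-pointᴺ []      = agree-~ pointᴺ-[] agree-ι
      agree-pointᴺ (f ∷ Γ) = agree-~ (pointᴺ-∷ f Γ) (agree-⊚
        (agree-⊠ (agree-~ (point-[f] f) (agree-Λ (agree-⊚ (agree₁ f) agree-λ)))
                 (agree-pointᴺ Γ))
        (agree-J Fr.λ⇐))

      agree : ∀ {U V} (f : U ⇛ V) → Agree f
      agree ⟨ Γ , φ ⟩ = agree-~ (decompose Γ φ) (agree-⊚ (agree-J φ) (agree-⊚
        (agree-⊠ (agree-~ (point-nest Γ) (agree-⊚ (agree-J (nest⇐ Γ)) (agree-pointᴺ Γ))) agree-ι)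
        (agree-J Fr.λ⇐)))

-- The natural bijection, given by restriction along `generic`.

theorem1 : ∀ {x y o ℓ e : Level} (S : Signature x y) →
    Σ[ Φ ∈ ((D : SMCC o ℓ e) → Bijection (StrictFunctors (𝒞 S) D) (Interpretations S D)) ]
    (∀ (D D' : SMCC o ℓ e) (G : StrictFunctor D D') (F : StrictFunctor (𝒞 S) D) →
    Setoid._≈_ (Interpretations S D')
    (Bijection.to (Φ D') (G ∘F F))
    (G · Bijection.to (Φ D) F))
theorem1 {o = o} {ℓ} {e} S = Φ , natural
  where
    open Syntactic S

    to-cong : ∀ {D : SMCC o ℓ e} {F G : StrictFunctor (𝒞 S) D} →
              Setoid._≈_ (StrictFunctors (𝒞 S) D) F G →
              Setoid._≈_ (Interpretations S D) (F · generic) (G · generic)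
    to-cong {F = F} {G} (p , q) = (λ a → p (var a)) , λ f →
      ≋-trans (·-generic F f) (≋-trans (q _) (≋-sym (·-generic G f)))

    Φ : (D : SMCC o ℓ e) → Bijection (StrictFunctors (𝒞 S) D) (Interpretations S D)
    Φ D = record
      { to = _· generic
      ; cong = λ {F} {G} → to-cong {D} {F} {G}
      ; bijective =
          (λ {F} {G} (p , q) →
            -- Injectivity: each operation is tested at its own domain and codomain, where the
            -- interpretation recovers the value on its generator.
            let agree₁ = λ f → ≋-trans (≋-sym (·-generic F (f , ≡.refl , ≡.refl)))
                  (≋-trans (q (f , ≡.refl , ≡.refl)) (·-generic G (f , ≡.refl , ≡.refl)))
            in Uniqueness.agree-Obj S D F G p , Uniqueness.agree S D F G p agree₁)
        -- Surjectivity for setoids is required of every `F` equal to the chosen preimage, so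
        -- `to-cong` precedes `functor-generic`.
        , λ K → Interpret.functor S D K , λ {F} r →
            Setoid.trans (Interpretations S D) {F · generic} {Interpret.functor S D K · generic} {K}
              (to-cong {D} {F} r) (Interpret.functor-generic S D K)
      }

    natural : ∀ (D D' : SMCC o ℓ e) (G : StrictFunctor D D') (F : StrictFunctor (𝒞 S) D) →
              Setoid._≈_ (Interpretations S D') ((G ∘F F) · generic) (G · (F · generic))
    -- Without transports both sides are the image of the generator under `F` and then `G`.
    natural D D' G F = (λ _ → ≡.refl) , λ {a} {b} f → ≋-trans (·-generic (G ∘F F) f)
      (≋-trans (≋-sym (StrictFunctor.F-≋ G (·-generic F f)))
        (≋-sym (subst₂-≋ {D = D'} (extend-F₀ G _ a) (extend-F₀ G _ b) _)))
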